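{- Let $\mathbb{k}$ be a field. There exists a graded $\mathbb{k}$-bialgebra $\mathbf{\Pi}$ with a basis given by symbols $[\pi]$, where $\pi$ ranges over all elements of $S_1\sqcup S_2\sqcup S_3\sqcup\cdots$, with the following properties: (a) For $1\le m\le n$, the product of $[m\cdots 321]$ and $[(n-m+1)\cdots 321]$ in $\mathbf{\Pi}$ is $\sum_{\pi\in\mathcal{B}(m,n)}[\pi]$. (b) The coproduct of $\mathbf{\Pi}$ is the linear map with $[\pi]\mapsto\sum [\pi']\otimes[\pi'']$, the sum over all pairs $(\pi',\pi'')$ with $\pi=\pi'\pi''$ a length-additive factorization (i.e. $\pi',\pi''\in S_n$ when $\pi\in S_n$, $\pi=\pi'\pi''$, and $\ell(\pi)=\ell(\pi')+\ell(\pi'')$). (c) If $\operatorname{char}(\mathbb{k})=0$ then the linear map $\mathbf{\Pi}\to\mathbb{k}$ with $[\pi]\mapsto \frac{r(\pi)}{\ell(\pi)!}$ is an algebra morphism.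
   Context: $S_n$ is the symmetric group on $\{1,\dots,n\}$, elements in one-line notation $\pi=\pi_1\cdots\pi_n$; $m\cdots321\in S_m$ is the reversal permutation. Let $s_i=(i,i+1)$; a reduced word of $\pi$ is a word $i_1\cdots i_l$ of minimal length with $\pi=s_{i_1}\cdots s_{i_l}$; $\ell(\pi)$ is this minimal length and $r(\pi)$ the number of reduced words. For a word $w$ with distinct integer letters, $\operatorname{fl}(w)$ replaces each letter by its rank among the letters of $w$. The sets $\mathcal{B}(m,n)\subseteq S_n$ are defined recursively: $\mathcal{B}(1,n)=\mathcal{B}(n,n)=\{n\cdots 321\}$, and for $1<m<n$, $\mathcal{B}(m,n)$ is the set of $\pi\in S_n$ such that either $\pi_1=m$ and $\operatorname{fl}(\pi_2\cdots\pi_n)\in\mathcal{B}(m-1,n-1)$, or $\pi_n=m$ and $\operatorname{fl}(\pi_1\cdots\pi_{n-1})\in\mathcal{B}(m,n-1)$. -}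

module Defs where

open import Level using (_⊔_) renaming (suc to lsuc)
open import Data.Bool using (Bool; true; false; T; _∧_; _∨_; not; if_then_else_)
open import Data.Nat using (ℕ; zero; suc; _∸_; _≡ᵇ_; _≤ᵇ_; _<ᵇ_; NonZero)
open import Data.Nat.Base using (_!) renaming (_+_ to _+ℕ_; _*_ to _*ℕ_)
open import Data.Maybe using (Maybe; just; nothing; maybe)
open import Data.List using (List; []; _∷_; map; length; concatMap; mapMaybe;
  cartesianProduct; filterᵇ; takeWhileᵇ; upTo; reverse; foldr; head; last; tail)
open import Data.Bool.ListAction using (any; all)
open import Data.Product using (Σ; ∃-syntax; _×_; _,_; proj₁)
open import Relation.Nullary using (¬_; yes; no)
open import Relation.Binary.PropositionalEquality using (_≡_)
open import Relation.Nullary.Decidable using (⌊_⌋)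
open import Data.Bool.Properties using (T?)
import Data.List.Properties as LP
import Data.Nat.Properties as NP
open import Algebra.Bundles using (CommutativeRing)

record Field c ℓ : Set (lsuc (c ⊔ ℓ)) where
  field
    commutativeRing : CommutativeRing c ℓ
  open CommutativeRing commutativeRing public
  field
    0≉1     : ¬ (0# ≈ 1#)
    inverse : ∀ x → ¬ (x ≈ 0#) → ∃[ y ] (x * y ≈ 1#)

_==_ : List ℕ → List ℕ → Bool
u == v = ⌊ LP.≡-dec NP._≟_ u v ⌋

range : ℕ → List ℕ
range n = map suc (upTo n)

-- 1-based lookup (default 0)
nth : List ℕ → ℕ → ℕ
nth []       _             = 0
nth (x ∷ xs) zero          = 0
nth (x ∷ xs) (suc zero)    = x
nth (x ∷ xs) (suc (suc i)) = nth xs (suc i)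

count : ℕ → List ℕ → ℕ
count j w = length (filterᵇ (λ x → x ≡ᵇ j) w)

-- w is a permutation of {1,...,n}, n = length w ≥ 1, in one-line notation
isPermᵇ : List ℕ → Bool
isPermᵇ w = (1 ≤ᵇ length w) ∧ all (λ j → count j w ≡ᵇ 1) (range (length w))

Perm : Set
Perm = Σ (List ℕ) (λ w → T (isPermᵇ w))

toPerm : List ℕ → Maybe Perm
toPerm w with T? (isPermᵇ w)
... | yes p = just (w , p)
... | no _  = nothing

wordsOver : List ℕ → ℕ → List (List ℕ)
wordsOver xs zero    = [] ∷ []
wordsOver xs (suc k) = concatMap (λ x → map (x ∷_) (wordsOver xs k)) xs

-- S_n, each element listed once
allPerms : ℕ → List Perm
allPerms n = mapMaybe toPerm (wordsOver (range n) n)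

compose : List ℕ → List ℕ → List ℕ
compose σ τ = map (nth σ) τ

simple : ℕ → ℕ → List ℕ
simple n i = map (λ j → if j ≡ᵇ i then suc i else (if j ≡ᵇ suc i then i else j)) (range n)

wordProduct : ℕ → List ℕ → List ℕ
wordProduct n []      = range n
wordProduct n (i ∷ u) = compose (simple n i) (wordProduct n u)

wordsS : ℕ → ℕ → List (List ℕ)
wordsS n l = wordsOver (range (n ∸ 1)) l

hasWordOfLength : List ℕ → ℕ → Bool
hasWordOfLength w l = any (λ u → wordProduct (length w) u == w) (wordsS (length w) l)

-- ℓ(π): the least l such that π is a product of l simple transpositions
-- (searched over 0 ≤ l ≤ n*n; every π ∈ S_n has a word of length ≤ n(n-1)/2)
lengthW : List ℕ → ℕ
lengthW w = length (takeWhileᵇ (λ l → not (hasWordOfLength w l))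
                               (upTo (suc (length w *ℕ length w))))

reducedWordCount : List ℕ → ℕ
reducedWordCount w =
  length (filterᵇ (λ u → wordProduct (length w) u == w) (wordsS (length w) (lengthW w)))

ℓ : Perm → ℕ
ℓ π = lengthW (proj₁ π)

r : Perm → ℕ
r π = reducedWordCount (proj₁ π)

size : Perm → ℕ
size π = length (proj₁ π)

revW : ℕ → List ℕ
revW m = reverse (range m)

fl : List ℕ → List ℕ
fl w = map (λ x → length (filterᵇ (λ y → y ≤ᵇ x) w)) w

init : List ℕ → List ℕ
init w = reverse (tail' (reverse w))
  where
  tail' : List ℕ → List ℕ
  tail' []       = []
  tail' (_ ∷ xs) = xs

tailW : List ℕ → List ℕ
tailW []       = []
tailW (_ ∷ xs) = xs

isJust : ℕ → Maybe ℕ → Bool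
isJust m (just x) = x ≡ᵇ m
isJust m nothing  = false

inB : ℕ → ℕ → List ℕ → Bool
inB m zero    w = false
inB m (suc n) w =
  (((m ≡ᵇ 1) ∨ (m ≡ᵇ suc n)) ∧ (w == revW (suc n)))
  ∨ (((1 <ᵇ m) ∧ (m <ᵇ suc n))
     ∧ ((isJust m (head w) ∧ inB (m ∸ 1) n (fl (tailW w)))
        ∨ (isJust m (last w) ∧ inB m n (fl (init w)))))

𝓑 : ℕ → ℕ → List Perm
𝓑 m n = filterᵇ (λ π → inB m n (proj₁ π)) (allPerms n)

isLAᵇ : Perm → Perm → Perm → Bool
isLAᵇ π π′ π″ =
  (size π′ ≡ᵇ size π) ∧ (size π″ ≡ᵇ size π)
  ∧ (compose (proj₁ π′) (proj₁ π″) == proj₁ π) ∧ (ℓ π ≡ᵇ (ℓ π′ +ℕ ℓ π″))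

LAfactorizations : Perm → List (Perm × Perm)
LAfactorizations π =
  filterᵇ (λ p → isLAᵇ π (proj₁ p) (Data.Product.proj₂ p))
          (cartesianProduct (allPerms (size π)) (allPerms (size π)))

-- The free k-module with basis [π] (π ∈ Perm) and its tensor powers,
-- elements represented as finite formal sums, compared coefficientwise.

module _ {c ℓ′} (F : Field c ℓ′) where
  open Field F

  fromℕ : ℕ → Carrier
  fromℕ zero    = 0#
  fromℕ (suc n) = 1# + fromℕ n

  sumK : List Carrier → Carrier
  sumK = foldr _+_ 0#

  V : Set c
  V = List (Carrier × Perm)

  V⊗V : Set c
  V⊗V = List (Carrier × Perm × Perm)

  V⊗V⊗V : Set c
  V⊗V⊗V = List (Carrier × Perm × Perm × Perm)

  coeff : Perm → V → Carrier
  coeff π x = sumK (map (λ { (a , σ) → if proj₁ σ == proj₁ π then a else 0# }) x)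

  coeff₂ : Perm → Perm → V⊗V → Carrier
  coeff₂ π ρ x = sumK (map (λ { (a , σ , τ) →
    if (proj₁ σ == proj₁ π) ∧ (proj₁ τ == proj₁ ρ) then a else 0# }) x)

  coeff₃ : Perm → Perm → Perm → V⊗V⊗V → Carrier
  coeff₃ π ρ κ x = sumK (map (λ { (a , σ , τ , υ) →
    if (proj₁ σ == proj₁ π) ∧ (proj₁ τ == proj₁ ρ) ∧ (proj₁ υ == proj₁ κ) then a else 0# }) x)

  _≋_ : V → V → Set ℓ′
  x ≋ y = ∀ π → coeff π x ≈ coeff π y

  _≋₂_ : V⊗V → V⊗V → Set ℓ′
  x ≋₂ y = ∀ π ρ → coeff₂ π ρ x ≈ coeff₂ π ρ y

  _≋₃_ : V⊗V⊗V → V⊗V⊗V → Set ℓ′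
  x ≋₃ y = ∀ π ρ κ → coeff₃ π ρ κ x ≈ coeff₃ π ρ κ y

  [_] : Perm → V
  [ π ] = (1# , π) ∷ []

  -- the basis vector [w] for a word w that is a permutation (0 otherwise)
  basisW : List ℕ → V
  basisW w = maybe [_] [] (toPerm w)

  scale : Carrier → V → V
  scale a = map (λ { (b , σ) → (a * b , σ) })

  scale₂ : Carrier → V⊗V → V⊗V
  scale₂ a = map (λ { (b , σ , τ) → (a * b , σ , τ) })

  _⊗_ : V → V → V⊗V
  x ⊗ y = concatMap (λ { (a , σ) → map (λ { (b , τ) → (a * b , σ , τ) }) y }) x

  mulL : (Perm → Perm → V) → V → V → V
  mulL m x y = concatMap (λ { (a , σ) →
                 concatMap (λ { (b , τ) → scale (a * b) (m σ τ) }) y }) x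

  mulL₂ : (Perm → Perm → V) → V⊗V → V⊗V → V⊗V
  mulL₂ m x y = concatMap (λ { (a , σ′ , σ″) →
                  concatMap (λ { (b , τ′ , τ″) →
                    scale₂ (a * b) (m σ′ τ′ ⊗ m σ″ τ″) }) y }) x

  linL₂ : (Perm → V⊗V) → V → V⊗V
  linL₂ Δ x = concatMap (λ { (a , σ) → scale₂ a (Δ σ) }) x

  linK : (Perm → Carrier) → V → Carrier
  linK f x = sumK (map (λ { (a , σ) → a * f σ }) x)

  Δ⊗id : (Perm → V⊗V) → Perm → V⊗V⊗V
  Δ⊗id Δ π = concatMap (λ { (a , σ , τ) →
               map (λ { (b , σ₁ , σ₂) → (a * b , σ₁ , σ₂ , τ) }) (Δ σ) }) (Δ π)

  id⊗Δ : (Perm → V⊗V) → Perm → V⊗V⊗V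
  id⊗Δ Δ π = concatMap (λ { (a , σ , τ) →
               map (λ { (b , τ₁ , τ₂) → (a * b , σ , τ₁ , τ₂) }) (Δ τ) }) (Δ π)

  ε⊗id : (Perm → V⊗V) → (Perm → Carrier) → Perm → V
  ε⊗id Δ ε π = map (λ { (a , σ , τ) → (a * ε σ , τ) }) (Δ π)

  id⊗ε : (Perm → V⊗V) → (Perm → Carrier) → Perm → V
  id⊗ε Δ ε π = map (λ { (a , σ , τ) → (a * ε τ , σ) }) (Δ π)

  -- A graded k-bialgebra structure on the free k-module with basis
  -- {[π] : π ∈ S_1 ⊔ S_2 ⊔ ⋯}, graded by ℓ (deg [π] = ℓ(π)).
  record GradedBialgebraΠ : Set (c ⊔ ℓ′) where
    field
      mul    : Perm → Perm → V
      unit   : V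
      Δ      : Perm → V⊗V
      ε      : Perm → Carrier
      assoc  : ∀ σ τ υ → mulL mul (mul σ τ) [ υ ] ≋ mulL mul [ σ ] (mul τ υ)
      unitˡ  : ∀ σ → mulL mul unit [ σ ] ≋ [ σ ]
      unitʳ  : ∀ σ → mulL mul [ σ ] unit ≋ [ σ ]
      coassoc : ∀ π → Δ⊗id Δ π ≋₃ id⊗Δ Δ π
      counitˡ : ∀ π → ε⊗id Δ ε π ≋ [ π ]
      counitʳ : ∀ π → id⊗ε Δ ε π ≋ [ π ]
      Δ-mul   : ∀ σ τ → linL₂ Δ (mul σ τ) ≋₂ mulL₂ mul (Δ σ) (Δ τ)
      Δ-unit  : linL₂ Δ unit ≋₂ (unit ⊗ unit)
      ε-mul   : ∀ σ τ → linK ε (mul σ τ) ≈ ε σ * ε τ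
      ε-unit  : linK ε unit ≈ 1#
      mul-graded   : ∀ σ τ π → ¬ (ℓ π ≡ ℓ σ +ℕ ℓ τ) → coeff π (mul σ τ) ≈ 0#
      unit-graded  : ∀ π → ¬ (ℓ π ≡ 0) → coeff π unit ≈ 0#
      Δ-graded     : ∀ π σ τ → ¬ (ℓ π ≡ ℓ σ +ℕ ℓ τ) → coeff₂ σ τ (Δ π) ≈ 0#
      ε-graded     : ∀ π → ¬ (ℓ π ≡ 0) → ε π ≈ 0#

  sumB : ℕ → ℕ → V
  sumB m n = map (λ π → (1# , π)) (𝓑 m n)

  ΔLA : Perm → V⊗V
  ΔLA π = map (λ { (π′ , π″) → (1# , π′ , π″) }) (LAfactorizations π)

  CharZero : Set ℓ′
  CharZero = ∀ n → .{{_ : NonZero n}} → ¬ (fromℕ n ≈ 0#)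

  φ : CharZero → Perm → Carrier
  φ ch π = fromℕ (r π) * proj₁ (inverse (fromℕ (ℓ π !)) (ch (ℓ π !) {{ℓ π NP.!≢0}}))

  module _ (B : GradedBialgebraΠ) where
    open GradedBialgebraΠ B

    PropertyA : Set ℓ′
    PropertyA = ∀ m n → 1 Data.Nat.≤ m → m Data.Nat.≤ n →
      mulL mul (basisW (revW m)) (basisW (revW (n ∸ m +ℕ 1))) ≋ sumB m n

    PropertyB : Set ℓ′
    PropertyB = ∀ π → Δ π ≋₂ ΔLA π

    PropertyC : Set ℓ′
    PropertyC = (ch : CharZero) →
      (∀ σ τ → linK (φ ch) (mul σ τ) ≈ φ ch σ * φ ch τ) × (linK (φ ch) unit ≈ 1#)

{-# OPTIONS --safe #-}

-- A permutation is represented by the set of its reduced words. The exchange property, proved for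
-- words directly, shows that the reduced words of π form one class under braid and commutation
-- moves. For σ ∈ S_{k+1} and τ ∈ S_{l+1}, consider the words on the letters 1, …, k+l whose
-- letters ≤ k spell a reduced word of σ and whose letters > k, lowered by k, spell one of τ. This
-- set is closed under the moves, because a braid on k, k+1 would need a square in one of the two
-- parts; for the same reason, by exchange, all these words are reduced. So it is a disjoint union
-- of the sets of reduced words of some permutations π ∈ S_{k+l+1}, and [σ][τ] is the sum of these
-- [π]. In this way product and coproduct become shuffling and deconcatenation of words: each
-- bialgebra axiom is an equality of two multiplicity-free sums, checked on words, and (c) counts
-- shuffles, since there are (a+b)!/(a! b!) ways to shuffle words of lengths a and b.
--
-- For (a), let u be a word of π whose two parts are reduced words of the reversals of S_m and
-- S_{n-m+1}. The low part alone would move the value m to position 1, the high part alone to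
-- position n. Whichever part moves it first wins, so π_1 = m or π_n = m, and exchange splits off
-- the word (m-1)⋯1, respectively m⋯(n-1), which leaves a word for the recursive condition.

module Submission where

import Level
open import Defs
open import Data.Bool using (Bool; true; false; T; _∧_; _∨_; not; if_then_else_)
open import Data.Bool.Properties using (T?; T-irrelevant; T-≡; T-∧; T-∨)
open import Data.Empty using (⊥; ⊥-elim)
open import Data.List using (List; []; _∷_; _++_; _∷ʳ_; length; map; concatMap; mapMaybe;
  cartesianProduct; filterᵇ; takeWhileᵇ; upTo; applyUpTo; applyDownFrom; reverse)
import Data.List.Base as ListB
open import Data.List.Membership.Propositional using (_∈_; find; lose)
open import Data.List.Membership.Propositional.Properties
open import Data.List.Membership.Propositional.Properties.WithK using (unique∧set⇒bag)
open import Data.List.Properties using (≡-dec; ++-assoc; ++-identityʳ; length-map; length-++;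
  length-upTo; map-cong; map-∘; map-id; map-++; map-applyUpTo; upTo-∷ʳ; reverse-++;
  reverse-involutive; reverse-applyUpTo; ∷-injectiveˡ; ∷-injectiveʳ)
open import Data.List.Relation.Binary.BagAndSetEquality using (∼bag⇒↭)
open import Data.List.Relation.Binary.Permutation.Propositional as Perm
  using (_↭_; ↭-trans; ↭-reflexive)
open import Data.List.Relation.Binary.Permutation.Propositional.Properties using (↭-length; map⁺)
open import Data.List.Relation.Unary.All as All using (All; []; _∷_)
import Data.List.Relation.Unary.All.Properties as AllP
open import Data.List.Relation.Unary.AllPairs using ([]; _∷_)
open import Data.List.Relation.Unary.Any using (here; there)
open import Data.List.Relation.Unary.Any.Properties using (any⁺; any⁻)
open import Data.List.Relation.Unary.Unique.Propositional using (Unique)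
import Data.List.Relation.Unary.Unique.Propositional.Properties as UniqueP
open import Data.Maybe using (Maybe; just; nothing; maybe)
open import Data.Nat hiding (_!)
open import Data.Nat.Base using (_!)
open import Data.Nat.Properties
open import Data.Nat.Tactic.RingSolver using (solve-∀)
open import Data.List.Membership.DecPropositional (≡-dec _≟_) using (_∈?_)
open import Data.Product using (Σ; _×_; _,_; proj₁; proj₂; ∃-syntax)
open import Data.Sum using (_⊎_; inj₁; inj₂)
open import Data.Unit using (⊤; tt)
open import Function using (_∘_; id)
open import Function.Bundles using (mk⇔; Equivalence; _⇔_)
open import Relation.Binary.PropositionalEquality hiding ([_])
open import Relation.Nullary using (¬_; Dec; yes; no; contradiction)
open import Relation.Nullary.Decidable using (⌊_⌋; toWitness; fromWitness)

-- Minimal length is awkward for induction, so reducedness is the letterwise condition `Reduced`;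
-- its agreement with the bounded search behind `ℓ` comes only after every permutation has received
-- a word of length at most n². Words act on all of ℕ, so moves and cuts never mention n, and the
-- group enters through `Letters`. As a word does not determine its group, each permutation carries
-- its rank n-1, the number of available generators, which is additive under the product. Absence of
-- repetitions is the recurring obligation: a reduced word and the rank determine the permutation,
-- and a word and the place of the cut determine both parts. The axioms thus become equivalences
-- between statements about one word, cut by letter value for the product or by place for the
-- coproduct. These two kinds of cut commute, and that is the compatibility of product and
-- coproduct.

Word : Set
Word = List ℕ

-- Braid equivalence and reduced words

-- The transposition of i and i+1 on all of ℕ. Recursion on both arguments reduces each identity to
-- a few cases near zero; `sw-if` recovers the form with tests used in `simple`.
sw : ℕ → ℕ → ℕ
sw zero    zero          = 1
sw zero    (suc zero)    = 0
sw zero    (suc (suc x)) = suc (suc x)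
sw (suc i) zero          = zero
sw (suc i) (suc x)       = suc (sw i x)

sw-involutive : ∀ i x → sw i (sw i x) ≡ x
sw-involutive zero    zero          = refl
sw-involutive zero    (suc zero)    = refl
sw-involutive zero    (suc (suc x)) = refl
sw-involutive (suc i) zero          = refl
sw-involutive (suc i) (suc x)       = cong suc (sw-involutive i x)

sw-left : ∀ i → sw i i ≡ suc i
sw-left zero    = refl
sw-left (suc i) = cong suc (sw-left i)

sw-right : ∀ i → sw i (suc i) ≡ i
sw-right zero    = refl
sw-right (suc i) = cong suc (sw-right i)

sw-below : ∀ {i x} → x < i → sw i x ≡ x
sw-below {suc i} {zero}  _         = refl
sw-below {suc i} {suc x} (s≤s x<i) = cong suc (sw-below x<i)

sw-above : ∀ {i x} → suc i < x → sw i x ≡ x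
sw-above {zero}  {suc (suc x)} _         = refl
sw-above {zero}  {suc zero}    (s≤s ())
sw-above {suc i} {suc x}       (s≤s i<x) = cong suc (sw-above i<x)

sw-comm : ∀ {i j} → suc i < j → ∀ x → sw i (sw j x) ≡ sw j (sw i x)
sw-comm {zero}  {suc (suc j)} _         zero          = refl
sw-comm {zero}  {suc (suc j)} _         (suc zero)    = refl
sw-comm {zero}  {suc (suc j)} _         (suc (suc x)) = refl
sw-comm {zero}  {suc zero}    (s≤s ())  _
sw-comm {suc i} {suc j}       (s≤s i<j) zero          = refl
sw-comm {suc i} {suc j}       (s≤s i<j) (suc x)       = cong suc (sw-comm i<j x)

sw-braid : ∀ i x → sw i (sw (suc i) (sw i x)) ≡ sw (suc i) (sw i (sw (suc i) x))
sw-braid zero    zero                = refl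
sw-braid zero    (suc zero)          = refl
sw-braid zero    (suc (suc zero))    = refl
sw-braid zero    (suc (suc (suc x))) = refl
sw-braid (suc i) zero                = refl
sw-braid (suc i) (suc x)             = cong suc (sw-braid i x)

act : Word → ℕ → ℕ
act []      x = x
act (i ∷ u) x = sw i (act u x)

-- Inverse to `act`: a value is sent to its position in one-line notation. A new first letter i only
-- exchanges the positions of the values i and i+1, which suits conditions on words grown at the
-- left.
pre : Word → ℕ → ℕ
pre []      x = x
pre (i ∷ u) x = pre u (sw i x)

pre-act : ∀ u x → pre u (act u x) ≡ x
pre-act []      x = refl
pre-act (i ∷ u) x = trans (cong (pre u) (sw-involutive i (act u x))) (pre-act u x)

act-pre : ∀ u x → act u (pre u x) ≡ x
act-pre []      x = refl
act-pre (i ∷ u) x = trans (cong (sw i) (act-pre u (sw i x))) (sw-involutive i x)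

pre-injective : ∀ u {x y} → pre u x ≡ pre u y → x ≡ y
pre-injective u {x} {y} eq = trans (sym (act-pre u x)) (trans (cong (act u) eq) (act-pre u y))

act-injective : ∀ u {x y} → act u x ≡ act u y → x ≡ y
act-injective u {x} {y} eq = trans (sym (pre-act u x)) (trans (cong (pre u) eq) (pre-act u y))

pre-++ : ∀ u v x → pre (u ++ v) x ≡ pre v (pre u x)
pre-++ []      v x = refl
pre-++ (i ∷ u) v x = pre-++ u v (sw i x)

act-++ : ∀ u v x → act (u ++ v) x ≡ act u (act v x)
act-++ []      v x = refl
act-++ (i ∷ u) v x = cong (sw i) (act-++ u v x)

pre⇒act : ∀ u v → (∀ x → pre u x ≡ pre v x) → ∀ x → act u x ≡ act v x
pre⇒act u v eq x =
  pre-injective u (trans (pre-act u x) (sym (trans (eq (act v x)) (pre-act v x))))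

act⇒pre : ∀ u v → (∀ x → act u x ≡ act v x) → ∀ x → pre u x ≡ pre v x
act⇒pre u v eq x =
  act-injective u (trans (act-pre u x) (sym (trans (eq (pre v x)) (act-pre v x))))

pre-left : ∀ i u → pre (i ∷ u) i ≡ pre u (suc i)
pre-left i u = cong (pre u) (sw-left i)

pre-right : ∀ i u → pre (i ∷ u) (suc i) ≡ pre u i
pre-right i u = cong (pre u) (sw-right i)

pre-below : ∀ {i x} u → x < i → pre (i ∷ u) x ≡ pre u x
pre-below u x<i = cong (pre u) (sw-below x<i)

pre-above : ∀ {i x} u → suc i < x → pre (i ∷ u) x ≡ pre u x
pre-above u i<x = cong (pre u) (sw-above i<x)

-- s_i · w is longer than w exactly when w⁻¹ keeps i and i+1 in order.
Reduced : Word → Set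
Reduced []      = ⊤
Reduced (i ∷ u) = pre u i < pre u (suc i) × Reduced u

infix 4 _~_
infixr 5 _∷~_

-- Both directions of every move are constructors, so symmetry is derived and invariants such as
-- `Reduced` and `Good` can be carried forward along a derivation.
data _~_ : Word → Word → Set where
  ~-refl  : ∀ {u} → u ~ u
  ~-trans : ∀ {u v w} → u ~ v → v ~ w → u ~ w
  _∷~_    : ∀ i {u v} → u ~ v → i ∷ u ~ i ∷ v
  comm    : ∀ {i j u} → suc i < j → i ∷ j ∷ u ~ j ∷ i ∷ u
  comm⁻   : ∀ {i j u} → suc i < j → j ∷ i ∷ u ~ i ∷ j ∷ u
  braid   : ∀ {i u} → i ∷ suc i ∷ i ∷ u ~ suc i ∷ i ∷ suc i ∷ u
  braid⁻  : ∀ {i u} → suc i ∷ i ∷ suc i ∷ u ~ i ∷ suc i ∷ i ∷ u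

~-sym : ∀ {u v} → u ~ v → v ~ u
~-sym ~-refl          = ~-refl
~-sym (~-trans p q)   = ~-trans (~-sym q) (~-sym p)
~-sym (i ∷~ p)        = i ∷~ ~-sym p
~-sym (comm i<j)      = comm⁻ i<j
~-sym (comm⁻ i<j)     = comm i<j
~-sym braid           = braid⁻
~-sym braid⁻          = braid

~-length : ∀ {u v} → u ~ v → length u ≡ length v
~-length ~-refl        = refl
~-length (~-trans p q) = trans (~-length p) (~-length q)
~-length (i ∷~ p)      = cong suc (~-length p)
~-length (comm _)      = refl
~-length (comm⁻ _)     = refl
~-length braid         = refl
~-length braid⁻        = refl

~-All : ∀ {p} {P : ℕ → Set p} {u v} → u ~ v → All P u → All P v
~-All ~-refl        ps               = ps
~-All (~-trans p q) ps               = ~-All q (~-All p ps)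
~-All (i ∷~ p)      (px ∷ ps)        = px ∷ ~-All p ps
~-All (comm _)      (px ∷ py ∷ ps)   = py ∷ px ∷ ps
~-All (comm⁻ _)     (px ∷ py ∷ ps)   = py ∷ px ∷ ps
~-All braid         (px ∷ py ∷ _ ∷ ps) = py ∷ px ∷ py ∷ ps
~-All braid⁻        (px ∷ py ∷ _ ∷ ps) = py ∷ px ∷ py ∷ ps

~-++ˡ : ∀ w {u v} → u ~ v → w ++ u ~ w ++ v
~-++ˡ []      p = p
~-++ˡ (i ∷ w) p = i ∷~ ~-++ˡ w p

~-pre : ∀ {u v} → u ~ v → ∀ x → pre u x ≡ pre v x
~-pre ~-refl        x = refl
~-pre (~-trans p q) x = trans (~-pre p x) (~-pre q x)
~-pre (i ∷~ p)      x = ~-pre p (sw i x)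
~-pre (comm {i} {j} {u} i<j)  x = cong (pre u) (sym (sw-comm i<j x))
~-pre (comm⁻ {i} {j} {u} i<j) x = cong (pre u) (sw-comm i<j x)
~-pre (braid {i} {u})  x = cong (pre u) (sw-braid i x)
~-pre (braid⁻ {i} {u}) x = cong (pre u) (sym (sw-braid i x))

~-act : ∀ {u v} → u ~ v → ∀ x → act u x ≡ act v x
~-act {u} {v} p = pre⇒act u v (~-pre p)

private
  reduced-comm : ∀ {i j u} → suc i < j → Reduced (i ∷ j ∷ u) → Reduced (j ∷ i ∷ u)
  reduced-comm {i} {j} {u} i<j (p , q , r) =
    subst₂ _<_ (sym (pre-above u i<j)) (sym (pre-above u (m≤n⇒m≤1+n i<j))) q ,
    subst₂ _<_ (pre-below u (<-trans (n<1+n i) i<j)) (pre-below u i<j) p , r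

  reduced-comm⁻ : ∀ {i j u} → suc i < j → Reduced (j ∷ i ∷ u) → Reduced (i ∷ j ∷ u)
  reduced-comm⁻ {i} {j} {u} i<j (p , q , r) =
    subst₂ _<_ (sym (pre-below u (<-trans (n<1+n i) i<j))) (sym (pre-below u i<j)) q ,
    subst₂ _<_ (pre-above u i<j) (pre-above u (m≤n⇒m≤1+n i<j)) p , r

  -- On either side the three conditions are the three comparisons among the positions `pre u` of i,
  -- i+1 and i+2, met in opposite order.
  reduced-braid : ∀ {i u} → Reduced (i ∷ suc i ∷ i ∷ u) → Reduced (suc i ∷ i ∷ suc i ∷ u)
  reduced-braid {i} {u} (p , q , r , s) =
    subst₂ _<_ (sym (trans (pre-right i (suc i ∷ u)) (pre-below u (n<1+n i))))
               (sym (trans (pre-above (suc i ∷ u) (n<1+n (suc i))) (pre-right (suc i) u))) r ,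
    subst₂ _<_ (sym (pre-below u (n<1+n i))) (sym (pre-left (suc i) u))
               (subst₂ _<_ (pre-right i u) (pre-above u (n<1+n (suc i))) q) ,
    subst₂ _<_ (trans (pre-below (i ∷ u) (n<1+n i)) (pre-left i u))
               (trans (pre-left (suc i) (i ∷ u)) (pre-above u (n<1+n (suc i)))) p , s

  reduced-braid⁻ : ∀ {i u} → Reduced (suc i ∷ i ∷ suc i ∷ u) → Reduced (i ∷ suc i ∷ i ∷ u)
  reduced-braid⁻ {i} {u} (p , q , r , s) =
    subst₂ _<_ (sym (trans (pre-below (i ∷ u) (n<1+n i)) (pre-left i u)))
               (sym (trans (pre-left (suc i) (i ∷ u)) (pre-above u (n<1+n (suc i))))) r ,
    subst₂ _<_ (sym (pre-right i u)) (sym (pre-above u (n<1+n (suc i))))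
               (subst₂ _<_ (pre-below u (n<1+n i)) (pre-left (suc i) u) q) ,
    subst₂ _<_ (trans (pre-right i (suc i ∷ u)) (pre-below u (n<1+n i)))
               (trans (pre-above (suc i ∷ u) (n<1+n (suc i))) (pre-right (suc i) u)) p , s

~-Reduced : ∀ {u v} → u ~ v → Reduced u → Reduced v
~-Reduced ~-refl        r       = r
~-Reduced (~-trans p q) r       = ~-Reduced q (~-Reduced p r)
~-Reduced (i ∷~ p)      (a , r) = subst₂ _<_ (~-pre p i) (~-pre p (suc i)) a , ~-Reduced p r
~-Reduced (comm {u = u} i<j)  r = reduced-comm {u = u} i<j r
~-Reduced (comm⁻ {u = u} i<j) r = reduced-comm⁻ {u = u} i<j r
~-Reduced (braid {u = u})     r = reduced-braid {u = u} r
~-Reduced (braid⁻ {u = u})    r = reduced-braid⁻ {u = u} r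

data Position : ℕ → ℕ → Set where
  same   : ∀ {i} → Position i i
  above  : ∀ {i} → Position i (suc i)
  below  : ∀ {i} → Position (suc i) i
  far    : ∀ {i j} → suc i < j → Position i j
  far⁻   : ∀ {i j} → suc j < i → Position i j

position : ∀ i j → Position i j
position zero          zero          = same
position zero          (suc zero)    = above
position zero          (suc (suc j)) = far (s≤s (s≤s z≤n))
position (suc zero)    zero          = below
position (suc (suc i)) zero          = far⁻ (s≤s (s≤s z≤n))
position (suc i)       (suc j) with position i j
... | same   = same
... | above  = above
... | below  = below
... | far p  = far (s≤s p)
... | far⁻ p = far⁻ (s≤s p)

-- A first letter that commutes with i is passed directly, an adjacent one by a braid. The adjacent
-- case extracts a second letter from a word that the induction itself produced, so the recursion
-- runs on a bound for the length.
exchange : ∀ u i → Reduced u → pre u (suc i) < pre u i → ∃[ v ] (u ~ i ∷ v)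
exchange u = go (length u) u ≤-refl
  where
  go : ∀ n u → length u ≤ n → ∀ i → Reduced u → pre u (suc i) < pre u i → ∃[ v ] (u ~ i ∷ v)
  go n       []      _         i _       d = contradiction d (<-asym (n<1+n i))
  go (suc n) (j ∷ u) (s≤s u≤n) i (a , r) d with position i j
  ... | same = u , ~-refl
  ... | far i<j
    with v , p ← go n u u≤n i r
           (subst₂ _<_ (pre-below u i<j) (pre-below u (<-trans (n<1+n i) i<j)) d)
    = j ∷ v , ~-trans (j ∷~ p) (comm⁻ i<j)
  ... | far⁻ j<i
    with v , p ← go n u u≤n i r (subst₂ _<_ (pre-above u (m≤n⇒m≤1+n j<i)) (pre-above u j<i) d)
    = j ∷ v , ~-trans (j ∷~ p) (comm j<i)
  -- Here j = i+1, and the two inequalities put the positions of i+1, i+2, i in u in increasing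
  -- order. So i comes out of u, then i+1 out of the remainder, and a braid turns (i+1) i (i+1) into
  -- i (i+1) i.
  ... | above
    with d′ ← subst₂ _<_ (pre-left (suc i) u) (pre-below u (n<1+n i)) d
    with v , p ← go n u u≤n i r (<-trans a d′)
    with z , q ← go n v (≤-trans (n≤1+n _) (subst (_≤ n) (~-length p) u≤n)) (suc i)
           (proj₂ (~-Reduced p r))
           (subst₂ _<_ (trans (~-pre p (suc (suc i))) (pre-above v (n<1+n (suc i))))
                       (trans (~-pre p i) (pre-left i v)) d′)
    = suc i ∷ i ∷ z , ~-trans (suc i ∷~ ~-trans p (i ∷~ q)) braid⁻
  go (suc n) (j ∷ u) (s≤s u≤n) .(suc j) (a , r) d | below
    with d′ ← subst₂ _<_ (pre-above u (n<1+n (suc j))) (pre-right j u) d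
    with v , p ← go n u u≤n (suc j) r (<-trans d′ a)
    with z , q ← go n v (≤-trans (n≤1+n _) (subst (_≤ n) (~-length p) u≤n)) j
           (proj₂ (~-Reduced p r))
           (subst₂ _<_ (trans (~-pre p (suc (suc j))) (pre-right (suc j) v))
                       (trans (~-pre p j) (pre-below v (n<1+n j))) d′)
    = j ∷ suc j ∷ z , ~-trans (j ∷~ ~-trans p (suc j ∷~ q)) braid

-- The first letter i of the second word is a descent of the common permutation, so `exchange`
-- brings i to the front of the first word, and both words lose a letter.
matsumoto : ∀ u v → Reduced u → Reduced v → (∀ x → pre u x ≡ pre v x) → u ~ v
matsumoto []      []      _       _       eq = ~-refl
matsumoto (i ∷ u) []      (a , _) _       eq =
  contradiction (subst₂ _<_ (trans (sym (pre-right i u)) (eq (suc i))) (trans (sym (pre-left i u)) (eq i)) a)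
                (<-asym (n<1+n i))
matsumoto u       (i ∷ v) ru      (a , rv) eq
  with u′ , p ← exchange u i ru
         (subst₂ _<_ (sym (trans (eq (suc i)) (pre-right i v))) (sym (trans (eq i) (pre-left i v))) a)
  = ~-trans p (i ∷~ matsumoto u′ v (proj₂ (~-Reduced p ru)) rv λ x →
      trans (cong (pre u′) (sym (sw-involutive i x)))
     (trans (sym (~-pre p (sw i x)))
     (trans (eq (sw i x)) (cong (pre v) (sw-involutive i x)))))

-- Splitting a word into its letters ≤ k and its letters > k, the latter lowered by k

-- The decision is an argument, so that repeated cuts can be compared by congruence without deciding
-- again, as in `low-low`.
lowIf : ∀ {P : Set} → Dec P → ℕ → Word → Word
lowIf (yes _) i u = i ∷ u
lowIf (no  _) i u = u

highIf : ∀ {P : Set} → ℕ → Dec P → ℕ → Word → Word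
highIf k (yes _) i u = u
highIf k (no  _) i u = i ∸ k ∷ u

low : ℕ → Word → Word
low k []      = []
low k (i ∷ u) = lowIf (i ≤? k) i (low k u)

high : ℕ → Word → Word
high k []      = []
high k (i ∷ u) = highIf k (i ≤? k) i (high k u)

low-∷-≤ : ∀ {k i} u → i ≤ k → low k (i ∷ u) ≡ i ∷ low k u
low-∷-≤ {k} {i} u i≤k with i ≤? k
... | yes _ = refl
... | no  p = contradiction i≤k p

high-∷-≤ : ∀ {k i} u → i ≤ k → high k (i ∷ u) ≡ high k u
high-∷-≤ {k} {i} u i≤k with i ≤? k
... | yes _ = refl
... | no  p = contradiction i≤k p

low-∷-> : ∀ {k i} u → k < i → low k (i ∷ u) ≡ low k u
low-∷-> {k} {i} u k<i with i ≤? k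
... | yes p = contradiction k<i (≤⇒≯ p)
... | no  _ = refl

high-∷-> : ∀ {k i} u → k < i → high k (i ∷ u) ≡ i ∸ k ∷ high k u
high-∷-> {k} {i} u k<i with i ≤? k
... | yes p = contradiction k<i (≤⇒≯ p)
... | no  _ = refl

low-++ : ∀ k u v → low k (u ++ v) ≡ low k u ++ low k v
low-++ k []      v = refl
low-++ k (i ∷ u) v with i ≤? k
... | yes _ = cong (i ∷_) (low-++ k u v)
... | no  _ = low-++ k u v

high-++ : ∀ k u v → high k (u ++ v) ≡ high k u ++ high k v
high-++ k []      v = refl
high-++ k (i ∷ u) v with i ≤? k
... | yes _ = high-++ k u v
... | no  _ = cong (i ∸ k ∷_) (high-++ k u v)

Good : ℕ → Word → Set
Good k u = Reduced (low k u) × Reduced (high k u)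

¬Reduced-square : ∀ i u → ¬ Reduced (i ∷ i ∷ u)
¬Reduced-square i u (p , q , _) = <-asym q (subst₂ _<_ (pre-left i u) (pre-right i u) p)

-- A braid move involving both k and k+1 meets a square in the low or in the high part.
~-split : ∀ {k u v} → u ~ v → Good k u → low k u ~ low k v × high k u ~ high k v
~-split ~-refl g = ~-refl , ~-refl
~-split {k} (~-trans p q) (gl , gh)
  with pl , ph ← ~-split p (gl , gh)
  with ql , qh ← ~-split q (~-Reduced pl gl , ~-Reduced ph gh)
  = ~-trans pl ql , ~-trans ph qh
~-split {k} (i ∷~ p) g with i ≤? k
... | yes _ with pl , ph ← ~-split p (proj₂ (proj₁ g) , proj₂ g) = i ∷~ pl , ph
... | no  _ with pl , ph ← ~-split p (proj₁ g , proj₂ (proj₂ g)) = pl , (i ∸ k) ∷~ ph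
~-split {k} (comm {i} {j} i<j) g with i ≤? k | j ≤? k
... | yes _ | yes _ = comm i<j , ~-refl
... | yes _ | no  _ = ~-refl , ~-refl
... | no  p | yes q = contradiction (≤-trans (≤-trans (n≤1+n i) (<⇒≤ i<j)) q) p
... | no  p | no  _ = ~-refl , comm (subst (_< j ∸ k) (+-∸-assoc 1 (<⇒≤ (≰⇒> p))) (∸-monoˡ-< i<j (m≤n⇒m≤1+n (<⇒≤ (≰⇒> p)))))
~-split {k} (comm⁻ {i} {j} i<j) g with i ≤? k | j ≤? k
... | yes _ | yes _ = comm⁻ i<j , ~-refl
... | yes _ | no  _ = ~-refl , ~-refl
... | no  p | yes q = contradiction (≤-trans (≤-trans (n≤1+n i) (<⇒≤ i<j)) q) p
... | no  p | no  _ = ~-refl , comm⁻ (subst (_< j ∸ k) (+-∸-assoc 1 (<⇒≤ (≰⇒> p))) (∸-monoˡ-< i<j (m≤n⇒m≤1+n (<⇒≤ (≰⇒> p)))))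
~-split {k} (braid {i} {u}) g with i ≤? k | suc i ≤? k
... | yes _ | yes _ = braid , ~-refl
... | yes _ | no  _ = contradiction (proj₁ g) (¬Reduced-square i (low k u))
... | no  p | yes q = contradiction (≤-trans (n≤1+n i) q) p
... | no  p | no  _ rewrite +-∸-assoc 1 (<⇒≤ (≰⇒> p)) = ~-refl , braid
~-split {k} (braid⁻ {i} {u}) g with i ≤? k | suc i ≤? k
... | yes _ | yes _ = braid⁻ , ~-refl
... | yes _ | no  _ = contradiction (proj₂ g) (¬Reduced-square (suc i ∸ k) (high k u))
... | no  p | yes q = contradiction (≤-trans (n≤1+n i) q) p
... | no  p | no  _ rewrite +-∸-assoc 1 (<⇒≤ (≰⇒> p)) = ~-refl , braid⁻

~-Good : ∀ {k u v} → u ~ v → Good k u → Good k v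
~-Good p g with pl , ph ← ~-split p g = ~-Reduced pl (proj₁ g) , ~-Reduced ph (proj₂ g)

Good-tail : ∀ {k} i u → Good k (i ∷ u) → Good k u
Good-tail {k} i u g with i ≤? k
... | yes _ = proj₂ (proj₁ g) , proj₂ g
... | no  _ = proj₁ g , proj₂ (proj₂ g)

¬Good-square : ∀ {k} i u → ¬ Good k (i ∷ i ∷ u)
¬Good-square {k} i u g with i ≤? k
... | yes _ = ¬Reduced-square i (low k u) (proj₁ g)
... | no  _ = ¬Reduced-square (i ∸ k) (high k u) (proj₂ g)

descent-or-ascent : ∀ u i → pre u i < pre u (suc i) ⊎ pre u (suc i) < pre u i
descent-or-ascent u i with pre u i <? pre u (suc i)
... | yes p = inj₁ p
... | no  p = inj₂ (≤∧≢⇒< (≮⇒≥ p) λ eq → 1+n≢n (pre-injective u eq))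

-- If the first letter i were not an ascent, `exchange` would make the whole word equivalent to one
-- beginning with i i. Moves preserve `Good`, and the square would lie inside one of the two reduced
-- parts.
Good⇒Reduced : ∀ {k} u → Good k u → Reduced u
Good⇒Reduced []      _ = tt
Good⇒Reduced {k} (i ∷ u) g with r ← Good⇒Reduced u (Good-tail i u g) | descent-or-ascent u i
... | inj₁ a = a , r
... | inj₂ d with v , p ← exchange u i r d = contradiction (~-Good (i ∷~ p) g) (¬Good-square i v)

-- Duplicate-free enumerations of predicates

record Enumerates {A : Set} (P : A → Set) (xs : List A) : Set where
  field
    unique   : Unique xs
    sound    : ∀ {x} → x ∈ xs → P x
    complete : ∀ {x} → P x → x ∈ xs

open Enumerates

enum-resp : ∀ {A : Set} {P Q : A → Set} {xs} → (∀ {x} → P x → Q x) → (∀ {x} → Q x → P x) →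
            Enumerates P xs → Enumerates Q xs
enum-resp f g e = record
  { unique   = unique e
  ; sound    = f ∘ sound e
  ; complete = complete e ∘ g
  }

-- Duplicate-free lists with the same members are rearrangements of each other; this turns an
-- identity of multiplicity-free sums into a logical equivalence.
enum-↭ : ∀ {A : Set} {P Q : A → Set} {xs ys} → (∀ {x} → P x → Q x) → (∀ {x} → Q x → P x) →
         Enumerates P xs → Enumerates Q ys → xs ↭ ys
enum-↭ f g e e′ = ∼bag⇒↭ (unique∧set⇒bag (unique e) (unique e′)
  (mk⇔ (complete e′ ∘ f ∘ sound e) (complete e ∘ g ∘ sound e′)))

enum-filter : ∀ {A : Set} {P : A → Set} {xs} (q : A → Bool) → Enumerates P xs →
              Enumerates (λ x → P x × T (q x)) (filterᵇ q xs)
enum-filter q e = record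
  { unique   = UniqueP.filter⁺ (T? ∘ q) (unique e)
  ; sound    = λ x∈ → let x∈xs , qx = ∈-filter⁻ (T? ∘ q) x∈ in sound e x∈xs , qx
  ; complete = λ (px , qx) → ∈-filter⁺ (T? ∘ q) (complete e px) qx
  }

concatMap-Unique : ∀ {A B : Set} (f : A → List B) xs → Unique xs →
  (∀ {x} → x ∈ xs → Unique (f x)) →
  (∀ {x y z} → x ∈ xs → y ∈ xs → z ∈ f x → z ∈ f y → x ≡ y) → Unique (concatMap f xs)
concatMap-Unique f []       _           _ _   = []
concatMap-Unique f (x ∷ xs) (x∉xs ∷ !xs) u inj =
  UniqueP.++⁺ (u (here refl))
    (concatMap-Unique f xs !xs (u ∘ there) (λ x∈ y∈ → inj (there x∈) (there y∈)))
    λ (z∈fx , z∈rest) → let y , y∈xs , z∈fy = find (∈-concatMap⁻ f {xs = xs} z∈rest) in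
      All.lookup x∉xs y∈xs (inj (here refl) (there y∈xs) z∈fx z∈fy)

-- The last hypothesis is what makes a double sum multiplicity-free: z must reveal the x it came
-- from.
enum-concatMap : ∀ {A B : Set} {P : A → Set} {Q : A → B → Set} {f : A → List B} {xs} →
  Enumerates P xs → (∀ {x} → P x → Enumerates (Q x) (f x)) →
  (∀ {x y z} → P x → P y → Q x z → Q y z → x ≡ y) →
  Enumerates (λ z → ∃[ x ] P x × Q x z) (concatMap f xs)
enum-concatMap {f = f} {xs} e e′ inj = record
  { unique   = concatMap-Unique f xs (unique e) (unique ∘ e′ ∘ sound e) λ x∈ y∈ z∈ z∈′ →
      inj (sound e x∈) (sound e y∈) (sound (e′ (sound e x∈)) z∈) (sound (e′ (sound e y∈)) z∈′)
  ; sound    = λ z∈ → let x , x∈xs , z∈fx = find (∈-concatMap⁻ f {xs = xs} z∈)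
                          px = sound e x∈xs in x , px , sound (e′ px) z∈fx
  ; complete = λ (x , px , q) → ∈-concatMap⁺ f (lose (complete e px) (complete (e′ px) q))
  }

enum-map : ∀ {A B : Set} {P : A → Set} {f : A → B} {xs} →
  Enumerates P xs → (∀ {x y} → P x → P y → f x ≡ f y → x ≡ y) →
  Enumerates (λ z → ∃[ x ] P x × z ≡ f x) (map f xs)
enum-map {P = P} {f} {xs} e inj = record
  { unique   = go xs (unique e) (sound e)
  ; sound    = λ z∈ → let x , x∈xs , eq = ∈-map⁻ f z∈ in x , sound e x∈xs , eq
  ; complete = λ { (x , px , refl) → ∈-map⁺ f (complete e px) }
  }
  where
  go : ∀ xs → Unique xs → (∀ {x} → x ∈ xs → P x) → Unique (map f xs)
  go []       _            _ = []
  go (x ∷ xs) (x∉xs ∷ !xs) s =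
    AllP.map⁺ (All.tabulate λ y∈xs eq → All.lookup x∉xs y∈xs (inj (s (here refl)) (s (there y∈xs)) eq)) ∷
    go xs !xs (s ∘ there)

enum-cartesianProduct : ∀ {A B : Set} {P : A → Set} {Q : B → Set} {xs ys} →
  Enumerates P xs → Enumerates Q ys →
  Enumerates (λ (x , y) → P x × Q y) (cartesianProduct xs ys)
enum-cartesianProduct {xs = xs} {ys} e e′ = record
  { unique   = UniqueP.cartesianProduct⁺ (unique e) (unique e′)
  ; sound    = λ z∈ → let x∈ , y∈ = ∈-cartesianProduct⁻ xs ys z∈ in sound e x∈ , sound e′ y∈
  ; complete = λ (p , q) → ∈-cartesianProduct⁺ (complete e p) (complete e′ q)
  }

enum-mapMaybe : ∀ {A B : Set} {P : A → Set} {f : A → Maybe B} {xs} →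
  Enumerates P xs → (∀ {x y z} → f x ≡ just z → f y ≡ just z → x ≡ y) →
  Enumerates (λ z → ∃[ x ] P x × f x ≡ just z) (mapMaybe f xs)
enum-mapMaybe {A} {B} {P = P} {f} {xs} e inj = record
  { unique   = go xs (unique e)
  ; sound    = λ z∈ → let x , x∈ , eq = mem⁻ xs z∈ in x , sound e x∈ , eq
  ; complete = λ (x , px , eq) → mem⁺ xs (complete e px) eq
  }
  where
  mem⁻ : ∀ xs {z} → z ∈ mapMaybe f xs → ∃[ x ] x ∈ xs × f x ≡ just z
  mem⁻ (x ∷ xs) z∈ with f x in eq
  mem⁻ (x ∷ xs) (here refl) | just _  = x , here refl , eq
  mem⁻ (x ∷ xs) (there z∈)  | just _  = let y , y∈ , q = mem⁻ xs z∈ in y , there y∈ , q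
  mem⁻ (x ∷ xs) z∈          | nothing = let y , y∈ , q = mem⁻ xs z∈ in y , there y∈ , q

  mem⁺ : ∀ xs {x z} → x ∈ xs → f x ≡ just z → z ∈ mapMaybe f xs
  mem⁺ (x ∷ xs) (here refl) eq rewrite eq = here refl
  mem⁺ (y ∷ xs) (there x∈)  eq with f y
  ... | just _  = there (mem⁺ xs x∈ eq)
  ... | nothing = mem⁺ xs x∈ eq

  go : ∀ xs → Unique xs → Unique (mapMaybe f xs)
  go []       _            = []
  go (x ∷ xs) (x∉xs ∷ !xs) with f x in eq
  ... | nothing = go xs !xs
  ... | just z  = All.tabulate (λ z′∈ z≡z′ → let y , y∈ , q = mem⁻ xs z′∈ in
                    All.lookup x∉xs y∈ (inj eq (trans q (cong just (sym z≡z′))))) ∷ go xs !xs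

enum-wordsOver : ∀ {P : ℕ → Set} {xs} → Enumerates P xs → ∀ l →
  Enumerates (λ u → length u ≡ l × All P u) (wordsOver xs l)
enum-wordsOver e zero = record
  { unique   = [] ∷ []
  ; sound    = λ { (here refl) → refl , [] }
  ; complete = λ { {[]} _ → here refl }
  }
enum-wordsOver e (suc l) =
  enum-resp (λ { (x , px , u , (refl , pu) , refl) → refl , px ∷ pu })
            (λ { {x ∷ u} (refl , px ∷ pu) → x , px , u , (refl , pu) , refl })
    (enum-concatMap e (λ _ → enum-map (enum-wordsOver e l) (λ { _ _ refl → refl }))
      (λ { _ _ (_ , _ , refl) (_ , _ , refl) → refl }))

InRange : ℕ → ℕ → Set
InRange n x = 1 ≤ x × x ≤ n

enum-range : ∀ n → Enumerates (InRange n) (range n)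
enum-range n = record
  { unique   = UniqueP.map⁺ suc-injective (UniqueP.upTo⁺ n)
  ; sound    = λ x∈ → let y , y∈ , eq = ∈-map⁻ suc x∈ in
                 subst (InRange n) (sym eq) (s≤s z≤n , ∈-upTo⁻ y∈)
  ; complete = λ { {suc x} (_ , x<n) → ∈-map⁺ suc (∈-upTo⁺ x<n) }
  }

-- Words as products of simple transpositions

Letters : ℕ → Word → Set
Letters n = All (λ i → 1 ≤ i × i < n)

==⇒≡ : ∀ u v → T (u == v) → u ≡ v
==⇒≡ u v = toWitness

≡⇒== : ∀ {u v} → u ≡ v → T (u == v)
≡⇒== = fromWitness

length-range : ∀ n → length (range n) ≡ n
length-range n = trans (length-map suc (upTo n)) (length-upTo n)

map-range-cong : ∀ n {f g : ℕ → ℕ} → (∀ {x} → InRange n x → f x ≡ g x) → map f (range n) ≡ map g (range n)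
map-range-cong n {f} {g} eq = go (range n) (All.tabulate (eq ∘ sound (enum-range n)))
  where
  go : ∀ xs → All (λ x → f x ≡ g x) xs → map f xs ≡ map g xs
  go []       []       = refl
  go (x ∷ xs) (p ∷ ps) = cong₂ _∷_ p (go xs ps)

map-range-injective : ∀ n {f g : ℕ → ℕ} → map f (range n) ≡ map g (range n) →
                      ∀ {x} → InRange n x → f x ≡ g x
map-range-injective n {f} {g} eq x∈ = All.lookup (go (range n) eq) (complete (enum-range n) x∈)
  where
  go : ∀ xs → map f xs ≡ map g xs → All (λ x → f x ≡ g x) xs
  go []       _ = []
  go (x ∷ xs) p = ∷-injectiveˡ p ∷ go xs (∷-injectiveʳ p)

nth-map-range : ∀ n (f : ℕ → ℕ) {x} → InRange n x → nth (map f (range n)) x ≡ f x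
nth-map-range n f {suc x} (_ , x<n) rewrite sym (map-∘ {g = f} {suc} (upTo n)) = go id n x x<n
  where
  go : ∀ (h : ℕ → ℕ) n x → x < n → nth (map (f ∘ suc) (applyUpTo h n)) (suc x) ≡ f (suc (h x))
  go h (suc n) zero    _         = refl
  go h (suc n) (suc x) (s≤s x<n) = go (h ∘ suc) n x x<n

sw-if : ∀ i x → (if x ≡ᵇ i then suc i else (if x ≡ᵇ suc i then i else x)) ≡ sw i x
sw-if zero    zero          = refl
sw-if zero    (suc zero)    = refl
sw-if zero    (suc (suc x)) = refl
sw-if (suc i) zero          = refl
sw-if (suc i) (suc x) with x ≡ᵇ i | x ≡ᵇ suc i | sw-if i x
... | true  | _     | eq = cong suc eq
... | false | true  | eq = cong suc eq
... | false | false | eq = cong suc eq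

sw-range : ∀ {n i x} → 1 ≤ i × i < n → InRange n x → InRange n (sw i x)
sw-range {n} {i} {x} (1≤i , i<n) (1≤x , x≤n) with position x i
... | same   rewrite sw-left i = s≤s z≤n , i<n
... | above  rewrite sw-below {i} {x} ≤-refl = 1≤x , x≤n
... | below  rewrite sw-right i = 1≤i , <⇒≤ i<n
... | far p  rewrite sw-below (<-trans (n<1+n x) p) = 1≤x , x≤n
... | far⁻ p rewrite sw-above p = 1≤x , x≤n

act-range : ∀ {n u x} → Letters n u → InRange n x → InRange n (act u x)
act-range []       x∈ = x∈
act-range (i∈ ∷ l) x∈ = sw-range i∈ (act-range l x∈)

pre-range : ∀ {n u x} → Letters n u → InRange n x → InRange n (pre u x)
pre-range []       x∈ = x∈
pre-range (i∈ ∷ l) x∈ = pre-range l (sw-range i∈ x∈)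

act-zero : ∀ {n u} → Letters n u → act u 0 ≡ 0
act-zero []              = refl
act-zero ((1≤i , _) ∷ l) = trans (cong (sw _) (act-zero l)) (sw-below 1≤i)

act-beyond : ∀ {n u x} → Letters n u → n < x → act u x ≡ x
act-beyond []              n<x = refl
act-beyond ((_ , i<n) ∷ l) n<x = trans (cong (sw _) (act-beyond l n<x)) (sw-above (≤-trans (s≤s i<n) n<x))

-- Letters of S_n fix 0 and everything beyond n, so one-line notation, which records only 1, ..., n,
-- determines the action on ℕ.
act-ext : ∀ {n u v} → Letters n u → Letters n v →
          (∀ {x} → InRange n x → act u x ≡ act v x) → ∀ x → act u x ≡ act v x
act-ext lu lv eq zero = trans (act-zero lu) (sym (act-zero lv))
act-ext {n} lu lv eq (suc x) with suc x ≤? n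
... | yes p = eq (s≤s z≤n , p)
... | no  p = trans (act-beyond lu (≰⇒> p)) (sym (act-beyond lv (≰⇒> p)))

wordProduct-act : ∀ {n u} → Letters n u → wordProduct n u ≡ map (act u) (range n)
wordProduct-act {n} {[]}    []       = sym (map-id (range n))
wordProduct-act {n} {i ∷ u} (i∈ ∷ l) = trans (cong (compose (simple n i)) (wordProduct-act l))
  (trans (sym (map-∘ (range n))) (map-range-cong n λ {x} x∈ →
    trans (nth-map-range n _ (act-range l x∈)) (sw-if i (act u x))))

length-wordProduct : ∀ {n u} → Letters n u → length (wordProduct n u) ≡ n
length-wordProduct {n} l = trans (cong length (wordProduct-act l)) (trans (length-map _ (range n)) (length-range n))

wordProduct⇒pre : ∀ {n u v} → Letters n u → Letters n v → wordProduct n u ≡ wordProduct n v →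
                  ∀ x → pre u x ≡ pre v x
wordProduct⇒pre {n} {u} {v} lu lv eq = act⇒pre u v (act-ext lu lv (map-range-injective n
  (trans (sym (wordProduct-act lu)) (trans eq (wordProduct-act lv)))))

pre⇒wordProduct : ∀ {n u v} → Letters n u → Letters n v → (∀ x → pre u x ≡ pre v x) →
                  wordProduct n u ≡ wordProduct n v
pre⇒wordProduct {n} {u} {v} lu lv eq = trans (wordProduct-act lu)
  (trans (map-cong (pre⇒act u v eq) (range n)) (sym (wordProduct-act lv)))

wordProduct-++ : ∀ {n u v} → Letters n u → Letters n v →
                 compose (wordProduct n u) (wordProduct n v) ≡ wordProduct n (u ++ v)
wordProduct-++ {n} {u} {v} lu lv
  rewrite wordProduct-act lu | wordProduct-act lv | wordProduct-act (AllP.++⁺ lu lv) =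
  trans (sym (map-∘ (range n))) (map-range-cong n λ {x} x∈ →
    trans (nth-map-range n (act u) (act-range lv x∈)) (sym (act-++ u v x)))

-- Built from the right end: a letter that is not an ascent cancels against the same letter brought
-- to the front by `exchange`. The last component, that a word losing no length was reduced already,
-- later shows that words of minimal length are reduced.
reduce : ∀ {n} v → Letters n v → ∃[ u ] Letters n u × Reduced u × (∀ x → pre u x ≡ pre v x) ×
         length u ≤ length v × (length u ≡ length v → Reduced v)
reduce []      []       = [] , [] , tt , (λ _ → refl) , z≤n , λ _ → tt
reduce (i ∷ v) (i∈ ∷ l) with u , lu , ru , eq , len , r ← reduce v l | descent-or-ascent u i
... | inj₁ a = i ∷ u , i∈ ∷ lu , (a , ru) , (λ x → eq (sw i x)) , s≤s len ,
               λ e → subst₂ _<_ (eq i) (eq (suc i)) a , r (suc-injective e)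
... | inj₂ d with z , p ← exchange u i ru d
    with i∈′ ∷ lz ← ~-All p lu | short ← subst (_≤ length v) (~-length p) len =
  z , lz , proj₂ (~-Reduced p ru) ,
  (λ x → trans (cong (pre z) (sym (sw-involutive i x))) (trans (sym (~-pre p (sw i x))) (eq (sw i x)))) ,
  ≤-trans (<⇒≤ short) (n≤1+n _) , λ e → contradiction e (<⇒≢ (≤-trans short (n≤1+n _)))

-- Permutations and their reduced words

perm-≡ : ∀ {σ τ : Perm} → proj₁ σ ≡ proj₁ τ → σ ≡ τ
perm-≡ {w , p} {w , q} refl = cong (w ,_) (T-irrelevant p q)

count⇒∈ : ∀ {j} w → T (count j w ≡ᵇ 1) → j ∈ w
count⇒∈ {j} w c with filterᵇ (λ x → x ≡ᵇ j) w in eq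
... | x ∷ _ with x∈w , x≡j ← ∈-filter⁻ (T? ∘ (_≡ᵇ j)) {xs = w} (subst (x ∈_) (sym eq) (here refl)) =
  subst (_∈ w) (≡ᵇ⇒≡ x j x≡j) x∈w

∈⇒count : ∀ {j w} → Unique w → j ∈ w → T (count j w ≡ᵇ 1)
∈⇒count {j} {w} !w j∈w = ≡⇒≡ᵇ _ 1 (↭-length (enum-↭ (λ {x} (_ , q) → ≡ᵇ⇒≡ x j q)
    (λ { refl → j∈w , ≡⇒≡ᵇ j j refl })
  (enum-filter (_≡ᵇ j) record { unique = !w ; sound = id ; complete = id })
  record { unique = [] ∷ [] ; sound = λ { (here refl) → refl } ; complete = λ { refl → here refl } }))

isPerm⇒∈ : ∀ w → T (isPermᵇ w) → 1 ≤ length w × (∀ {j} → InRange (length w) j → j ∈ w)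
isPerm⇒∈ w p with p₁ , p₂ ← Equivalence.to (T-∧ {1 ≤ᵇ length w}) p =
  ≤ᵇ⇒≤ 1 (length w) p₁ ,
  λ j∈ → count⇒∈ w (All.lookup (AllP.all⁺ _ (range (length w)) p₂) (complete (enum-range (length w)) j∈))

enum-map-act : ∀ {n u} → Letters n u → Enumerates (InRange n) (map (act u) (range n))
enum-map-act {n} {u} l = enum-resp (λ { (x , x∈ , refl) → act-range l x∈ })
  (λ {x} x∈ → pre u x , pre-range l x∈ , sym (act-pre u x))
  (enum-map (enum-range n) λ _ _ → act-injective u)

wordProduct-isPerm : ∀ {n u} → 1 ≤ n → Letters n u → T (isPermᵇ (wordProduct n u))
wordProduct-isPerm {n} {u} 1≤n l rewrite length-wordProduct l | wordProduct-act l =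
  Equivalence.from (T-∧ {1 ≤ᵇ n}) (≤⇒≤ᵇ 1≤n , AllP.all⁻ _ (All.tabulate λ j∈ →
    ∈⇒count (unique (enum-map-act l)) (complete (enum-map-act l) (sound (enum-range n) j∈))))

wordPerm : ∀ {n u} → 1 ≤ n → Letters n u → Perm
wordPerm {n} {u} 1≤n l = wordProduct n u , wordProduct-isPerm 1≤n l

-- The bound n² is the range searched by `lengthW`. The target is `pre u` and not `act u`, so a
-- permutation is realized through the positions of its values.
realize : ∀ n (g : ℕ → ℕ) → (∀ {x} → InRange n x → InRange n (g x)) →
  (∀ {x y} → InRange n x → InRange n y → g x ≡ g y → x ≡ y) →
  ∃[ u ] Letters n u × length u ≤ n * n × (∀ {x} → InRange n x → pre u x ≡ g x)

private
  -- sorts g by raising the value g (suc n) one step at a time up to suc n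
  realize-step : ∀ n d (g : ℕ → ℕ) → d + g (suc n) ≡ suc n →
    (∀ {x} → InRange (suc n) x → InRange (suc n) (g x)) →
    (∀ {x y} → InRange (suc n) x → InRange (suc n) y → g x ≡ g y → x ≡ y) →
    ∃[ u ] Letters (suc n) u × length u ≤ d + n * n × (∀ {x} → InRange (suc n) x → pre u x ≡ g x)
  realize-step n zero g fix rng inj
    with u , l , len , eq ← realize n g
           (λ {x} (1≤x , x≤n) → let 1≤gx , gx≤ = rng (1≤x , m≤n⇒m≤1+n x≤n) in 1≤gx ,
              ≤-pred (≤∧≢⇒< gx≤ λ gx≡ →
                <⇒≢ (s≤s x≤n) (inj (1≤x , m≤n⇒m≤1+n x≤n) (s≤s z≤n , ≤-refl) (trans gx≡ (sym fix)))))
           (λ (1≤x , x≤n) (1≤y , y≤n) → inj (1≤x , m≤n⇒m≤1+n x≤n) (1≤y , m≤n⇒m≤1+n y≤n))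
    = u , All.map (λ (1≤i , i<n) → 1≤i , m≤n⇒m≤1+n i<n) l , len , eq′
    where
    eq′ : ∀ {x} → InRange (suc n) x → pre u x ≡ g x
    eq′ {x} (1≤x , x≤) with x ≟ suc n
    ... | no  x≢ = eq (1≤x , ≤-pred (≤∧≢⇒< x≤ x≢))
    ... | yes refl = trans (trans (cong (pre u) (sym (act-beyond l ≤-refl))) (pre-act u (suc n))) (sym fix)
  realize-step n (suc d) g fix rng inj
    with p∈ ← proj₁ (rng (s≤s z≤n , ≤-refl)) , subst (g (suc n) <_) fix (s≤s (m≤n+m (g (suc n)) d))
    with u , l , len , eq ← realize-step n d (sw (g (suc n)) ∘ g)
           (trans (cong (d +_) (sw-left (g (suc n)))) (trans (+-suc d _) fix))
           (sw-range p∈ ∘ rng)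
           (λ {x} {y} x∈ y∈ e → inj x∈ y∈ (trans (sym (sw-involutive (g (suc n)) (g x)))
             (trans (cong (sw (g (suc n))) e) (sw-involutive (g (suc n)) (g y)))))
    -- `pre` applies the last letter last, so this letter undoes the swap that was composed with g.
    = u ++ g (suc n) ∷ [] , AllP.++⁺ l (p∈ ∷ []) ,
      subst (_≤ suc d + n * n) (sym (trans (length-++ u) (+-comm (length u) 1))) (s≤s len) ,
      λ {x} x∈ → trans (pre-++ u _ x) (trans (cong (sw _) (eq x∈)) (sw-involutive _ (g x)))

realize zero    g rng inj = [] , [] , z≤n , λ { (s≤s _ , ()) }
realize (suc n) g rng inj
  with g≤ ← proj₂ (rng (s≤s z≤n , ≤-refl))
  with u , l , len , eq ← realize-step n (suc n ∸ g (suc n)) g (m∸n+n≡m g≤) rng inj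
  = u , l , ≤-trans len (+-mono-≤ (m∸n≤m (suc n) (g (suc n))) (*-monoʳ-≤ n (n≤1+n n))) , eq

private
  position-of : ℕ → List ℕ → ℕ
  position-of j []      = 0
  position-of j (x ∷ w) with j ≟ x
  ... | yes _ = 1
  ... | no  _ = suc (position-of j w)

  position-of-∈ : ∀ {j w} → j ∈ w → InRange (length w) (position-of j w) × nth w (position-of j w) ≡ j
  position-of-∈ {j} {x ∷ w} j∈ with j ≟ x
  ... | yes refl = (s≤s z≤n , s≤s z≤n) , refl
  position-of-∈ {j} {x ∷ w} (here j≡x) | no j≢x = contradiction j≡x j≢x
  position-of-∈ {j} {x ∷ w} (there j∈) | no _ with position-of j w | position-of-∈ j∈
  ... | suc p | (_ , p≤) , eq = (s≤s z≤n , s≤s p≤) , eq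

  map-nth-range : ∀ w → map (nth w) (range (length w)) ≡ w
  map-nth-range w = trans (sym (map-∘ (upTo (length w)))) (go w id λ _ _ → refl)
    where
    go : ∀ {f} v h → (∀ i → i < length v → f (h i) ≡ nth v (suc i)) → map f (applyUpTo h (length v)) ≡ v
    go []      h eq = refl
    go (x ∷ v) h eq = cong₂ _∷_ (eq 0 (s≤s z≤n)) (go v (h ∘ suc) λ i i< → eq (suc i) (s≤s i<))

-- Minimality is encoded by `Reduced`; `RedWord-length` and `RedWord⁺` identify these words with the
-- words of π of length `ℓ π`.
RedWord : Perm → Word → Set
RedWord π u = Letters (size π) u × Reduced u × wordProduct (size π) u ≡ proj₁ π

size≥1 : ∀ π → 1 ≤ size π
size≥1 (w , p) = proj₁ (isPerm⇒∈ w p)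

abstract
  -- Sending a value to its position in the list inverts π, which is the form that `realize`
  -- accepts; `reduce` never lengthens the word found.
  perm-word : ∀ π → ∃[ u ] RedWord π u × length u ≤ size π * size π
  perm-word (w , p)
    with _ , mem ← isPerm⇒∈ w p
    with v , l , len , eq ← realize (length w) (λ j → position-of j w) (proj₁ ∘ position-of-∈ ∘ mem)
           (λ x∈ y∈ e → trans (sym (proj₂ (position-of-∈ (mem x∈))))
                        (trans (cong (nth w) e) (proj₂ (position-of-∈ (mem y∈)))))
    with u , lu , ru , eq′ , len′ , _ ← reduce v l
    = u , (lu , ru , trans (pre⇒wordProduct lu l eq′) (trans (wordProduct-act l)
        (trans (map-range-cong (length w) λ {x} x∈ → let y∈ = act-range l x∈ in
          trans (trans (sym (proj₂ (position-of-∈ (mem y∈)))) (cong (nth w) (sym (eq y∈))))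
                (cong (nth w) (pre-act v x))) (map-nth-range w)))) ,
      ≤-trans len′ len

redWord : Perm → Word
redWord π = proj₁ (perm-word π)

redWord-RedWord : ∀ π → RedWord π (redWord π)
redWord-RedWord π = proj₁ (proj₂ (perm-word π))

RedWord-~ : ∀ {π u v} → RedWord π u → RedWord π v → u ~ v
RedWord-~ (lu , ru , eu) (lv , rv , ev) =
  matsumoto _ _ ru rv (wordProduct⇒pre lu lv (trans eu (sym ev)))

RedWord-resp : ∀ {π u v} → u ~ v → RedWord π u → RedWord π v
RedWord-resp p (l , r , e) =
  ~-All p l , ~-Reduced p r , trans (sym (pre⇒wordProduct l (~-All p l) (~-pre p))) e

RedWord-unique : ∀ {σ τ u} → size σ ≡ size τ → RedWord σ u → RedWord τ u → σ ≡ τ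
RedWord-unique {u = u} eq (_ , _ , e) (_ , _ , e′) =
  perm-≡ (trans (sym e) (trans (cong (λ n → wordProduct n u) eq) e′))

wordPerm-size : ∀ {n u} (1≤n : 1 ≤ n) (l : Letters n u) → size (wordPerm 1≤n l) ≡ n
wordPerm-size 1≤n l = length-wordProduct l

wordPerm-RedWord : ∀ {n u} (1≤n : 1 ≤ n) (l : Letters n u) → Reduced u → RedWord (wordPerm 1≤n l) u
wordPerm-RedWord {n} {u} 1≤n l r =
  subst (λ m → Letters m u) (sym (length-wordProduct l)) l , r ,
  cong (λ m → wordProduct m u) (length-wordProduct l)

-- Reducing v yields a reduced word of π, equivalent to u by `matsumoto` and hence of the same
-- length.
RedWord-minimal : ∀ {π u v} → RedWord π u → Letters (size π) v → wordProduct (size π) v ≡ proj₁ π →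
                  length u ≤ length v × (length v ≡ length u → Reduced v)
RedWord-minimal {v = v} (lu , ru , eu) lv ev
  with v′ , lv′ , rv′ , eq , len , red ← reduce v lv
  with u≡v′ ← ~-length (matsumoto _ _ ru rv′ λ x → trans (wordProduct⇒pre lu lv (trans eu (sym ev)) x) (sym (eq x)))
  = subst (_≤ length v) (sym u≡v′) len , λ e → red (trans (sym u≡v′) (sym e))

takeWhile-upTo : ∀ (p : ℕ → Bool) {m n} → m < n → (∀ l → l < m → T (p l)) → ¬ T (p m) →
                 length (takeWhileᵇ p (upTo n)) ≡ m
takeWhile-upTo p = go id
  where
  go : ∀ (h : ℕ → ℕ) {m n} → m < n → (∀ l → l < m → T (p (h l))) → ¬ T (p (h m)) →
       length (takeWhileᵇ p (applyUpTo h n)) ≡ m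
  go h {zero}  {suc n} _         _  ¬p with p (h 0)
  ... | true  = contradiction tt ¬p
  ... | false = refl
  go h {suc m} {suc n} (s≤s m<n) ps ¬p with p (h 0) | ps 0 (s≤s z≤n)
  ... | true | _ = cong suc (go (h ∘ suc) m<n (λ l l<m → ps (suc l) (s≤s l<m)) ¬p)

enum-wordsS : ∀ n l → Enumerates (λ u → length u ≡ l × Letters n u) (wordsS n l)
enum-wordsS n l = enum-resp (λ (e , a) → e , All.map to a) (λ (e , a) → e , All.map from a)
  (enum-wordsOver (enum-range (n ∸ 1)) l)
  where
  to : ∀ {n i} → InRange (n ∸ 1) i → 1 ≤ i × i < n
  to {zero}  (s≤s _ , ())
  to {suc n} (1≤i , i≤n) = 1≤i , s≤s i≤n

  from : ∀ {i} → 1 ≤ i × i < n → InRange (n ∸ 1) i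
  from {suc i} (_ , s≤s i≤) = s≤s z≤n , i≤

hasWord⁺ : ∀ w {u} → Letters (length w) u → wordProduct (length w) u ≡ w → T (hasWordOfLength w (length u))
hasWord⁺ w l e = any⁺ _ (lose (complete (enum-wordsS _ _) (refl , l)) (≡⇒== e))

hasWord⁻ : ∀ w {l} → T (hasWordOfLength w l) →
           ∃[ u ] length u ≡ l × Letters (length w) u × wordProduct (length w) u ≡ w
hasWord⁻ w {l} h with u , u∈ , e ← find (any⁻ _ (wordsS (length w) l) h)
  with len , lu ← sound (enum-wordsS _ _) u∈ = u , len , lu , ==⇒≡ _ w e

private
  T-not⁺ : ∀ {b} → ¬ T b → T (not b)
  T-not⁺ {true}  p = contradiction tt p
  T-not⁺ {false} p = tt

  T-not⁻ : ∀ {b} → T (not b) → ¬ T b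
  T-not⁻ {false} _ ()

-- By minimality the search fails at every smaller l. The n² bound for `redWord π`, which has the
-- length of u, keeps the stopping point inside the searched range.
RedWord-length : ∀ {π u} → RedWord π u → ℓ π ≡ length u
RedWord-length {π@(w , _)} {u} ru@(lu , _ , eu) =
  takeWhile-upTo (not ∘ hasWordOfLength w)
    (s≤s (subst (_≤ length w * length w) (~-length (RedWord-~ {π} (redWord-RedWord π) ru)) (proj₂ (proj₂ (perm-word π)))))
    (λ l l<u → T-not⁺ λ h → let v , len , lv , ev = hasWord⁻ w h in
      <⇒≱ l<u (subst (length u ≤_) len (proj₁ (RedWord-minimal {π} ru lv ev))))
    (λ h → T-not⁻ h (hasWord⁺ w lu eu))

RedWord⁺ : ∀ {π u} → Letters (size π) u → wordProduct (size π) u ≡ proj₁ π → length u ≡ ℓ π → RedWord π u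
RedWord⁺ {π} l e len = l , proj₂ (RedWord-minimal {π} rw l e) (trans len (RedWord-length {π} rw)) , e
  where
  rw : RedWord π (redWord π)
  rw = redWord-RedWord π

reducedWords : Perm → List Word
reducedWords (w , _) = filterᵇ (λ u → wordProduct (length w) u == w) (wordsS (length w) (lengthW w))

enum-reducedWords : ∀ π → Enumerates (RedWord π) (reducedWords π)
enum-reducedWords π@(w , _) = enum-resp (λ {u} ((len , l) , e) → RedWord⁺ {π} l (==⇒≡ _ w e) len)
  (λ rw@(l , _ , e) → (sym (RedWord-length {π} rw) , l) , ≡⇒== e)
  (enum-filter _ (enum-wordsS _ _))

toPerm⁻ : ∀ w {π} → toPerm w ≡ just π → w ≡ proj₁ π
toPerm⁻ w eq with T? (isPermᵇ w)
toPerm⁻ w refl | yes _ = refl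

toPerm⁺ : ∀ π → toPerm (proj₁ π) ≡ just π
toPerm⁺ (w , p) with T? (isPermᵇ w)
... | yes q = cong just (perm-≡ {w , q} {w , p} refl)
... | no ¬p = contradiction p ¬p

enum-allPerms : ∀ n → Enumerates (λ π → size π ≡ n) (allPerms n)
enum-allPerms n = enum-resp (λ { {π} (w , (len , _) , e) → trans (cong length (sym (toPerm⁻ w e))) len })
  (λ { {π} refl → proj₁ π , (refl , entries π) , toPerm⁺ π })
  (enum-mapMaybe (enum-wordsOver (enum-range n) n) λ {x} {y} {z} e e′ → trans (toPerm⁻ x {z} e) (sym (toPerm⁻ y {z} e′)))
  where
  entries : ∀ π → All (InRange (size π)) (proj₁ π)
  entries π with u , (l , _ , e) , _ ← perm-word π =
    subst (All (InRange (size π))) e (subst (All (InRange (size π))) (sym (wordProduct-act l))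
      (All.tabulate (sound (enum-map-act l))))

-- The product and coproduct on the level of reduced words

low-low : ∀ {j k} u → j ≤ k → low j (low k u) ≡ low j u
low-low []      j≤k = refl
low-low {j} {k} (i ∷ u) j≤k with i ≤? k
... | yes _ = cong (lowIf (i ≤? j) i) (low-low u j≤k)
... | no  p = trans (low-low u j≤k) (sym (low-∷-> u (≤-<-trans j≤k (≰⇒> p))))

private
  +-<⇒<-∸ : ∀ j k i → j + k < i → k < i ∸ j
  +-<⇒<-∸ j k i p = m+n≤o⇒m≤o∸n (suc k) (subst (_< i) (+-comm j k) p)

high-low : ∀ j k u → high j (low (j + k) u) ≡ low k (high j u)
high-low j k []      = refl
high-low j k (i ∷ u) with i ≤? j | i ≤? j + k
... | yes p | yes _ = trans (high-∷-≤ (low (j + k) u) p) (high-low j k u)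
... | yes p | no  q = contradiction (≤-trans p (m≤m+n j k)) q
... | no  p | yes q = trans (high-∷-> (low (j + k) u) (≰⇒> p)) (trans (cong (i ∸ j ∷_) (high-low j k u))
                        (sym (low-∷-≤ (high j u) (m≤n+o⇒m∸n≤o i j q))))
... | no  p | no  q = trans (high-low j k u)
                        (sym (low-∷-> (high j u) (+-<⇒<-∸ j k i (≰⇒> q))))

high-high : ∀ j k u → high k (high j u) ≡ high (j + k) u
high-high j k []      = refl
high-high j k (i ∷ u) with i ≤? j | i ≤? j + k
... | yes p | yes _ = high-high j k u
... | yes p | no  q = contradiction (≤-trans p (m≤m+n j k)) q
... | no  p | yes q = trans (high-∷-≤ (high j u) (m≤n+o⇒m∸n≤o i j q)) (high-high j k u)
... | no  p | no  q = trans (high-∷-> (high j u) (+-<⇒<-∸ j k i (≰⇒> q)))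
                        (cong₂ _∷_ (∸-+-assoc i j k) (high-high j k u))

low-all : ∀ {k u} → All (_≤ k) u → low k u ≡ u
low-all []       = refl
low-all {u = i ∷ u} (p ∷ ps) = trans (low-∷-≤ u p) (cong (i ∷_) (low-all ps))

high-none : ∀ {k u} → All (_≤ k) u → high k u ≡ []
high-none []       = refl
high-none {u = i ∷ u} (p ∷ ps) = trans (high-∷-≤ u p) (high-none ps)

low-zero : ∀ {u} → All (1 ≤_) u → low 0 u ≡ []
low-zero []       = refl
low-zero {i ∷ u} (p ∷ ps) = trans (low-∷-> u p) (low-zero ps)

high-zero : ∀ {u} → All (1 ≤_) u → high 0 u ≡ u
high-zero []       = refl
high-zero {i ∷ u} (p ∷ ps) = trans (high-∷-> u p) (cong (i ∷_) (high-zero ps))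

length-low-high : ∀ k u → length u ≡ length (low k u) + length (high k u)
length-low-high k []      = refl
length-low-high k (i ∷ u) with i ≤? k
... | yes _ = cong suc (length-low-high k u)
... | no  _ = trans (cong suc (length-low-high k u)) (sym (+-suc _ _))

Letters-low : ∀ {n u} k → Letters n u → Letters (suc k) (low k u)
Letters-low k []              = []
Letters-low {u = i ∷ u} k ((1≤i , i<n) ∷ l) with i ≤? k
... | yes p = (1≤i , s≤s p) ∷ Letters-low k l
... | no  _ = Letters-low k l

Letters-high : ∀ {n u} k → Letters n u → Letters (n ∸ k) (high k u)
Letters-high k []              = []
Letters-high {u = i ∷ u} k ((1≤i , i<n) ∷ l) with i ≤? k
... | yes p = Letters-high k l
... | no  p = (m<n⇒0<n∸m (≰⇒> p) , ∸-monoˡ-< i<n (<⇒≤ (≰⇒> p))) ∷ Letters-high k l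

-- S_{rank π + 1} is the group containing π.
rank : Perm → ℕ
rank π = size π ∸ 1

size-rank : ∀ π → size π ≡ suc (rank π)
size-rank π with size π | size≥1 π
... | suc n | _ = refl

rank⇒size : ∀ {σ τ} → rank σ ≡ rank τ → size σ ≡ size τ
rank⇒size {σ} {τ} eq = trans (size-rank σ) (trans (cong suc eq) (sym (size-rank τ)))

RedWord-Letters : ∀ {π u} → RedWord π u → Letters (suc (rank π)) u
RedWord-Letters {π} {u} (l , _) = subst (λ n → Letters n u) (size-rank π) l

RedWord-1≤ : ∀ {π u} → RedWord π u → All (1 ≤_) u
RedWord-1≤ (l , _) = All.map proj₁ l

RedWord-≤rank : ∀ {π u} → RedWord π u → All (_≤ rank π) u
RedWord-≤rank {π} r = All.map (≤-pred ∘ proj₂) (RedWord-Letters {π} r)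

RedWord-rank-unique : ∀ {σ τ u} → rank σ ≡ rank τ → RedWord σ u → RedWord τ u → σ ≡ τ
RedWord-rank-unique {σ} {τ} eq = RedWord-unique {σ} {τ} (rank⇒size {σ} {τ} eq)

permOf : ∀ {n u} → Letters (suc n) u → Perm
permOf l = wordPerm (s≤s z≤n) l

permOf-rank : ∀ {n u} (l : Letters (suc n) u) → rank (permOf l) ≡ n
permOf-rank l = cong (_∸ 1) (wordPerm-size (s≤s z≤n) l)

permOf-RedWord : ∀ {n u} (l : Letters (suc n) u) → Reduced u → RedWord (permOf l) u
permOf-RedWord l = wordPerm-RedWord (s≤s z≤n) l

-- These π are the terms of [σ][τ]. One reduced word with the right parts is asked for; `Split-any`
-- extends this to all reduced words of π.
Split : Perm → Perm → Perm → Set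
Split σ τ π = rank π ≡ rank σ + rank τ ×
  ∃[ u ] RedWord π u × RedWord σ (low (rank σ) u) × RedWord τ (high (rank σ) u)

-- Reduced words of π are linked by moves, and `~-split` follows the moves in both parts.
Split-any : ∀ {σ τ π u} → Split σ τ π → RedWord π u →
            RedWord σ (low (rank σ) u) × RedWord τ (high (rank σ) u)
Split-any {σ} {τ} {π} (_ , v , rv , rl , rh) ru
  with pl , ph ← ~-split (RedWord-~ {π} rv ru) (proj₁ (proj₂ rl) , proj₁ (proj₂ rh))
  = RedWord-resp {σ} pl rl , RedWord-resp {τ} ph rh

-- A reduced word of π cut at one place has one pair of parts. Equal ranks fix the place: the
-- identity of S_3 splits with ranks 0+2, 1+1 and 2+0.
Split-unique : ∀ {σ σ′ τ τ′ π} → rank σ ≡ rank σ′ → Split σ τ π → Split σ′ τ′ π → σ ≡ σ′ × τ ≡ τ′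
Split-unique {σ} {σ′} {τ} {τ′} {π} eq s@(r , u , ru , rl , rh) s′@(r′ , _)
  with rl′ , rh′ ← Split-any {σ′} {τ′} {π} s′ ru
  = RedWord-rank-unique {σ} {σ′} eq rl (subst (λ k → RedWord σ′ (low k u)) (sym eq) rl′) ,
    RedWord-rank-unique {τ} {τ′}
      (+-cancelˡ-≡ (rank σ) _ _ (trans (sym r) (trans r′ (cong (_+ rank τ′) (sym eq)))))
      rh (subst (λ k → RedWord τ′ (high k u)) (sym eq) rh′)

Split-construct : ∀ {σ τ u} (l : Letters (suc (rank σ + rank τ)) u) →
  RedWord σ (low (rank σ) u) → RedWord τ (high (rank σ) u) → Split σ τ (permOf l)
Split-construct {u = u} l rl rh = permOf-rank l , u ,
  permOf-RedWord l (Good⇒Reduced u (proj₁ (proj₂ rl) , proj₁ (proj₂ rh))) , rl , rh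

Split-length : ∀ {σ τ π} → Split σ τ π → ℓ π ≡ ℓ σ + ℓ τ
Split-length {σ} {τ} {π} (_ , u , ru , rl , rh) = trans (RedWord-length {π} ru)
  (trans (length-low-high (rank σ) u) (sym (cong₂ _+_ (RedWord-length {σ} rl) (RedWord-length {τ} rh))))

abstract
  isRedWord : Perm → Word → Bool
  isRedWord π u = ⌊ u ∈? reducedWords π ⌋

  isRedWord⁻ : ∀ π u → T (isRedWord π u) → RedWord π u
  isRedWord⁻ π u t = sound (enum-reducedWords π) (toWitness t)

  isRedWord⁺ : ∀ π u → RedWord π u → T (isRedWord π u)
  isRedWord⁺ π u r = fromWitness (complete (enum-reducedWords π) r)

  -- Testing the chosen word `redWord π` is conclusive by `Split-any`.
  splits : Perm → Perm → Perm → Bool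
  splits σ τ π = isRedWord σ (low (rank σ) (redWord π)) ∧ isRedWord τ (high (rank σ) (redWord π))

  product : Perm → Perm → List Perm
  product σ τ = filterᵇ (splits σ τ) (allPerms (suc (rank σ + rank τ)))

  enum-product : ∀ σ τ → Enumerates (Split σ τ) (product σ τ)
  enum-product σ τ = enum-resp
    (λ {π} (size≡ , t) → let tl , th = Equivalence.to (T-∧ {isRedWord σ _}) t in
       cong (_∸ 1) size≡ , redWord π , redWord-RedWord π , isRedWord⁻ σ _ tl , isRedWord⁻ τ _ th)
    (λ {π} s → let rl , rh = Split-any {σ} {τ} {π} s (redWord-RedWord π) in
       trans (size-rank π) (cong suc (proj₁ s)) ,
       Equivalence.from (T-∧ {isRedWord σ _}) (isRedWord⁺ σ _ rl , isRedWord⁺ τ _ rh))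
    (enum-filter (splits σ τ) (enum-allPerms _))

enum-productOf : ∀ {P Q : Perm → Set} {xs ys} → Enumerates P xs → Enumerates Q ys →
  (∀ {σ σ′} → P σ → P σ′ → rank σ ≡ rank σ′) →
  Enumerates (λ π → ∃[ σ ] P σ × ∃[ τ ] Q τ × Split σ τ π) (concatMap (λ σ → concatMap (product σ) ys) xs)
enum-productOf e e′ eq = enum-concatMap e
  (λ {σ} _ → enum-concatMap e′ (λ {τ} _ → enum-product σ τ)
    λ {τ} {τ′} {π} _ _ s s′ → proj₂ (Split-unique {σ} {σ} {τ} {τ′} {π} refl s s′))
  λ {σ} {σ′} {π} pσ pσ′ (τ , _ , s) (τ′ , _ , s′) → proj₁ (Split-unique {σ} {σ′} {τ} {τ′} {π} (eq pσ pσ′) s s′)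

enum-singleton : ∀ {A : Set} (a : A) → Enumerates (_≡ a) (a ∷ [])
enum-singleton a = record
  { unique   = [] ∷ []
  ; sound    = λ { (here eq) → eq }
  ; complete = λ { refl → here refl }
  }

-- The common refinement of both bracketings: one word, cut into three blocks of letters at `rank σ`
-- and at `rank σ + rank τ`.
Split₃ : Perm → Perm → Perm → Perm → Set
Split₃ σ τ υ π = rank π ≡ rank σ + (rank τ + rank υ) × ∃[ u ] RedWord π u ×
  RedWord σ (low (rank σ) u) × RedWord τ (low (rank τ) (high (rank σ) u)) ×
  RedWord υ (high (rank σ + rank τ) u)

split₃ˡ : ∀ {σ τ υ π} → ∃[ ρ ] Split σ τ ρ × Split ρ υ π → Split₃ σ τ υ π
split₃ˡ {σ} {τ} {υ} {π} (ρ , s@(r , _) , (r′ , u , ru , rρ , rυ))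
  with rσ , rτ ← Split-any {σ} {τ} {ρ} s rρ
  rewrite r | low-low {rank σ} {rank σ + rank τ} u (m≤m+n _ _) | high-low (rank σ) (rank τ) u
  = trans r′ (+-assoc (rank σ) _ _) , u , ru , rσ , rτ , rυ

-- The intermediate ρ is spelled by the letters up to `rank σ + rank τ`; that word is reduced
-- because its own two parts are.
split₃ˡ⁻ : ∀ {σ τ υ π} → Split₃ σ τ υ π → ∃[ ρ ] Split σ τ ρ × Split ρ υ π
split₃ˡ⁻ {σ} {τ} {υ} {π} (r , u , ru , rσ , rτ , rυ) =
  ρ , s ,
  (trans r (trans (sym (+-assoc (rank σ) _ _)) (cong (_+ rank υ) (sym rρ))) , u , ru ,
   subst (λ k → RedWord ρ (low k u)) (sym rρ) (permOf-RedWord l (Good⇒Reduced w (proj₁ (proj₂ rσ′) , proj₁ (proj₂ rτ′)))) ,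
   subst (λ k → RedWord υ (high k u)) (sym rρ) rυ)
  where
  w : Word
  w = low (rank σ + rank τ) u

  l : Letters (suc (rank σ + rank τ)) w
  l = Letters-low _ (proj₁ ru)

  ρ : Perm
  ρ = permOf l

  rρ : rank ρ ≡ rank σ + rank τ
  rρ = permOf-rank l

  rσ′ : RedWord σ (low (rank σ) w)
  rσ′ = subst (RedWord σ) (sym (low-low u (m≤m+n _ _))) rσ

  rτ′ : RedWord τ (high (rank σ) w)
  rτ′ = subst (RedWord τ) (sym (high-low (rank σ) (rank τ) u)) rτ

  s : Split σ τ ρ
  s = Split-construct {σ} {τ} l rσ′ rτ′

split₃ʳ : ∀ {σ τ υ π} → ∃[ ρ ] Split τ υ ρ × Split σ ρ π → Split₃ σ τ υ π
split₃ʳ {σ} {τ} {υ} {π} (ρ , s@(r , _) , (r′ , u , ru , rσ , rρ))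
  with rτ , rυ ← Split-any {τ} {υ} {ρ} s rρ
  rewrite high-high (rank σ) (rank τ) u
  = trans r′ (cong (rank σ +_) r) , u , ru , rσ , rτ , rυ

split₃ʳ⁻ : ∀ {σ τ υ π} → Split₃ σ τ υ π → ∃[ ρ ] Split τ υ ρ × Split σ ρ π
split₃ʳ⁻ {σ} {τ} {υ} {π} (r , u , ru , rσ , rτ , rυ) =
  permOf l , Split-construct {τ} {υ} l rτ rυ′ ,
  (trans r (cong (rank σ +_) (sym (permOf-rank l))) , u , ru , rσ ,
   permOf-RedWord l (Good⇒Reduced (high (rank σ) u) (proj₁ (proj₂ rτ) , proj₁ (proj₂ rυ′))))
  where
  rυ′ : RedWord υ (high (rank τ) (high (rank σ) u))
  rυ′ = subst (RedWord υ) (sym (high-high (rank σ) (rank τ) u)) rυ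

  l : Letters (suc (rank τ + rank υ)) (high (rank σ) u)
  l = subst (λ n → Letters n (high (rank σ) u))
        (trans (cong (λ n → suc n ∸ rank σ) (trans r (+-comm (rank σ) _)))
               (m+n∸n≡m (suc (rank τ + rank υ)) (rank σ)))
        (Letters-high (rank σ) (RedWord-Letters {π} ru))

-- Length-additive factorizations

-- Length additivity appears as reducedness of a concatenation; `isLA⁻` and `isLA⁺` translate from
-- and to the numerical test.
Factors : Perm → Perm → Perm → Set
Factors π σ τ = rank σ ≡ rank π × rank τ ≡ rank π ×
  ∃[ u ] ∃[ v ] RedWord σ u × RedWord τ v × RedWord π (u ++ v)

~-++ʳ : ∀ {u v} w → u ~ v → u ++ w ~ v ++ w
~-++ʳ w ~-refl        = ~-refl
~-++ʳ w (~-trans p q) = ~-trans (~-++ʳ w p) (~-++ʳ w q)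
~-++ʳ w (i ∷~ p)      = i ∷~ ~-++ʳ w p
~-++ʳ w (comm i<j)    = comm i<j
~-++ʳ w (comm⁻ i<j)   = comm⁻ i<j
~-++ʳ w braid         = braid
~-++ʳ w braid⁻        = braid⁻

Factors-any : ∀ {π σ τ u v} → Factors π σ τ → RedWord σ u → RedWord τ v → RedWord π (u ++ v)
Factors-any {π} {σ} {τ} {u} {v} (_ , _ , u′ , v′ , ru′ , rv′ , r) ru rv =
  RedWord-resp {π} (~-trans (~-++ʳ v′ (RedWord-~ {σ} ru′ ru)) (~-++ˡ u (RedWord-~ {τ} rv′ rv))) r

Reduced-++ʳ : ∀ u {v} → Reduced (u ++ v) → Reduced v
Reduced-++ʳ []      r       = r
Reduced-++ʳ (i ∷ u) (_ , r) = Reduced-++ʳ u r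

-- `Reduced` compares each letter with what stands to its right, so prefixes need an argument by
-- length: a shorter word for u would give a shorter word for u ++ v, against the equality of
-- lengths of reduced words.
Reduced-++ˡ : ∀ {n} u {v} → Letters n u → Letters n v → Reduced (u ++ v) → Reduced u
Reduced-++ˡ u {v} lu lv r
  with u′ , lu′ , ru′ , eq , len , red ← reduce u lu
  with w , lw , rw , eq′ , len′ , _ ← reduce (u′ ++ v) (AllP.++⁺ lu′ lv)
  with same-length ← ~-length (matsumoto (u ++ v) w r rw λ x →
         trans (pre-++ u v x) (trans (cong (pre v) (sym (eq x))) (trans (sym (pre-++ u′ v x)) (sym (eq′ x)))))
  = red (≤-antisym len (+-cancelʳ-≤ (length v) _ _ (subst₂ _≤_ (trans (sym same-length) (length-++ u))
          (length-++ u′) len′)))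

Factors-construct : ∀ {π n u v} (lu : Letters (suc n) u) (lv : Letters (suc n) v) → rank π ≡ n →
  RedWord π (u ++ v) → Factors π (permOf lu) (permOf lv)
Factors-construct {u = u} {v} lu lv eq r@(_ , red , _) =
  trans (permOf-rank lu) (sym eq) , trans (permOf-rank lv) (sym eq) , u , v ,
  permOf-RedWord lu (Reduced-++ˡ u lu lv red) , permOf-RedWord lv (Reduced-++ʳ u red) , r

Factors-length : ∀ {π σ τ} → Factors π σ τ → ℓ π ≡ ℓ σ + ℓ τ
Factors-length {π} {σ} {τ} (_ , _ , u , v , ru , rv , r) = trans (RedWord-length {π} r)
  (trans (length-++ u) (sym (cong₂ _+_ (RedWord-length {σ} ru) (RedWord-length {τ} rv))))

-- Reduced words of σ and τ concatenate to a word of π of length `ℓ π`, and such a word is reduced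
-- by minimality.
isLA⁻ : ∀ {π σ τ} → T (isLAᵇ π σ τ) → Factors π σ τ
isLA⁻ {π} {σ} {τ} t
  with tσ , t₁ ← Equivalence.to (T-∧ {size σ ≡ᵇ size π}) t
  with tτ , t₂ ← Equivalence.to (T-∧ {size τ ≡ᵇ size π}) t₁
  with tc , tl ← Equivalence.to (T-∧ {compose (proj₁ σ) (proj₁ τ) == proj₁ π}) t₂
  with sσ ← ≡ᵇ⇒≡ (size σ) _ tσ | sτ ← ≡ᵇ⇒≡ (size τ) _ tτ
  with u , ru@(lu , _ , eu) , _ ← perm-word σ
  with v , rv@(lv , _ , ev) , _ ← perm-word τ
  with lu′ ← subst (λ n → Letters n u) sσ lu | lv′ ← subst (λ n → Letters n v) sτ lv
  = cong (_∸ 1) sσ , cong (_∸ 1) sτ , u , v , ru , rv ,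
    RedWord⁺ {π} (AllP.++⁺ lu′ lv′)
      (trans (sym (wordProduct-++ lu′ lv′))
      (trans (cong₂ compose (trans (cong (λ n → wordProduct n u) (sym sσ)) eu)
                            (trans (cong (λ n → wordProduct n v) (sym sτ)) ev))
             (==⇒≡ _ (proj₁ π) tc)))
      (trans (length-++ u) (trans (sym (cong₂ _+_ (RedWord-length {σ} ru) (RedWord-length {τ} rv)))
             (sym (≡ᵇ⇒≡ (ℓ π) _ tl))))

isLA⁺ : ∀ {π σ τ} → Factors π σ τ → T (isLAᵇ π σ τ)
isLA⁺ {π} {σ} {τ} f@(rσ , rτ , u , v , ru@(lu , _ , eu) , rv@(lv , _ , ev) , r@(_ , _ , e)) =
  Equivalence.from (T-∧ {size σ ≡ᵇ size π}) (≡⇒≡ᵇ (size σ) _ sσ ,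
  Equivalence.from (T-∧ {size τ ≡ᵇ size π}) (≡⇒≡ᵇ (size τ) _ sτ ,
  Equivalence.from (T-∧ {compose (proj₁ σ) (proj₁ τ) == proj₁ π}) (≡⇒== (trans
    (sym (cong₂ compose (trans (cong (λ n → wordProduct n u) (sym sσ)) eu)
                        (trans (cong (λ n → wordProduct n v) (sym sτ)) ev)))
    (trans (wordProduct-++ (subst (λ n → Letters n u) sσ lu) (subst (λ n → Letters n v) sτ lv)) e)) ,
  ≡⇒≡ᵇ (ℓ π) _ (Factors-length {π} {σ} {τ} f))))
  where
  sσ : size σ ≡ size π
  sσ = rank⇒size {σ} {π} rσ

  sτ : size τ ≡ size π
  sτ = rank⇒size {τ} {π} rτ

Factors-unique : ∀ {π π′ σ τ} → Factors π σ τ → Factors π′ σ τ → π ≡ π′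
Factors-unique {π} {π′} {σ} {τ} f@(_ , r , u , v , ru , rv , _) f′@(_ , r′ , _) =
  RedWord-rank-unique {π} {π′} (trans (sym r) r′)
    (Factors-any {π} {σ} {τ} f ru rv) (Factors-any {π′} {σ} {τ} f′ ru rv)

enum-LAfactorizations : ∀ π → Enumerates (λ (σ , τ) → Factors π σ τ) (LAfactorizations π)
enum-LAfactorizations π = enum-resp (λ {(σ , τ)} (_ , t) → isLA⁻ {π} {σ} {τ} t)
  (λ {(σ , τ)} f → (rank⇒size {σ} {π} (proj₁ f) , rank⇒size {τ} {π} (proj₁ (proj₂ f))) , isLA⁺ {π} {σ} {τ} f)
  (enum-filter _ (enum-cartesianProduct (enum-allPerms _) (enum-allPerms _)))

-- The threefold concatenation to which both sides of coassociativity reduce.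
Factors₃ : Perm → Perm → Perm → Perm → Set
Factors₃ π σ τ υ = rank σ ≡ rank π × rank τ ≡ rank π × rank υ ≡ rank π ×
  ∃[ u ] ∃[ v ] ∃[ w ] RedWord σ u × RedWord τ v × RedWord υ w × RedWord π (u ++ v ++ w)

Letters-cast : ∀ {π ρ u} → rank π ≡ rank ρ → RedWord π u → Letters (suc (rank ρ)) u
Letters-cast {π} {u = u} eq r = subst (λ n → Letters (suc n) u) eq (RedWord-Letters {π} r)

factors₃ˡ : ∀ {π σ τ υ} → ∃[ ρ ] Factors π ρ υ × Factors ρ σ τ → Factors₃ π σ τ υ
factors₃ˡ {π} {σ} {τ} {υ} (ρ , f@(rρ , rυ , _ , w , _ , ww , _) , (rσ , rτ , u , v , wu , wv , wuv)) =
  trans rσ rρ , trans rτ rρ , rυ , u , v , w , wu , wv , ww ,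
  subst (RedWord π) (++-assoc u v w) (Factors-any {π} {ρ} {υ} f wuv ww)

factors₃ˡ⁻ : ∀ {π σ τ υ} → Factors₃ π σ τ υ → ∃[ ρ ] Factors π ρ υ × Factors ρ σ τ
factors₃ˡ⁻ {π} {σ} {τ} {υ} (rσ , rτ , rυ , u , v , w , wu , wv , ww , r) =
  permOf l , (permOf-rank l , rυ , u ++ v , w , wuv , ww , r′) ,
  (trans rσ (sym (permOf-rank l)) , trans rτ (sym (permOf-rank l)) , u , v , wu , wv , wuv)
  where
  l : Letters (suc (rank π)) (u ++ v)
  l = AllP.++⁺ (Letters-cast {σ} {π} rσ wu) (Letters-cast {τ} {π} rτ wv)

  r′ : RedWord π ((u ++ v) ++ w)
  r′ = subst (RedWord π) (sym (++-assoc u v w)) r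

  wuv : RedWord (permOf l) (u ++ v)
  wuv = permOf-RedWord l (Reduced-++ˡ (u ++ v) l (Letters-cast {υ} {π} rυ ww) (proj₁ (proj₂ r′)))

factors₃ʳ : ∀ {π σ τ υ} → ∃[ ρ ] Factors π σ ρ × Factors ρ τ υ → Factors₃ π σ τ υ
factors₃ʳ {π} {σ} {τ} {υ} (ρ , f@(rσ , rρ , u , _ , wu , _) , (rτ , rυ , v , w , wv , ww , wvw)) =
  rσ , trans rτ rρ , trans rυ rρ , u , v , w , wu , wv , ww , Factors-any {π} {σ} {ρ} f wu wvw

factors₃ʳ⁻ : ∀ {π σ τ υ} → Factors₃ π σ τ υ → ∃[ ρ ] Factors π σ ρ × Factors ρ τ υ
factors₃ʳ⁻ {π} {σ} {τ} {υ} (rσ , rτ , rυ , u , v , w , wu , wv , ww , r) =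
  permOf l , (rσ , permOf-rank l , u , v ++ w , wu , wvw , r) ,
  (trans rτ (sym (permOf-rank l)) , trans rυ (sym (permOf-rank l)) , v , w , wv , ww , wvw)
  where
  l : Letters (suc (rank π)) (v ++ w)
  l = AllP.++⁺ (Letters-cast {τ} {π} rτ wv) (Letters-cast {υ} {π} rυ ww)

  wvw : RedWord (permOf l) (v ++ w)
  wvw = permOf-RedWord l (Reduced-++ʳ u (proj₁ (proj₂ r)))

-- Cutting by place and by letter value commute: with k = `rank σ`, a word u ++ v of π has the four
-- parts `low k u`, `low k v`, `high k u`, `high k v`. Grouped one way they factor σ and τ, grouped
-- the other way they split π′ and π″.
split-factors : ∀ {σ τ π′ π″} → ∃[ π ] Split σ τ π × Factors π π′ π″ →
  ∃[ σσ ] Factors σ (proj₁ σσ) (proj₂ σσ) × ∃[ ττ ] Factors τ (proj₁ ττ) (proj₂ ττ) ×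
    Split (proj₁ σσ) (proj₁ ττ) π′ × Split (proj₂ σσ) (proj₂ ττ) π″
split-factors {σ} {τ} {π′} {π″} (π , s@(r , _) , (r′ , r″ , u , v , ru , rv , ruv)) =
  (permOf lu , permOf lv) , fσ , (permOf hu , permOf hv) , fτ ,
    (ranks lu hu (trans r′ r) , u , ru ,
      part (λ k → low k u) lu lu (permOf-RedWord lu (Reduced-++ˡ (low (rank σ) u) lu lv redl)) ,
      part (λ k → high k u) lu hu (permOf-RedWord hu (Reduced-++ˡ (high (rank σ) u) hu hv redh))) ,
    (ranks lv hv (trans r″ r) , v , rv ,
      part (λ k → low k v) lv lv (permOf-RedWord lv (Reduced-++ʳ (low (rank σ) u) redl)) ,
      part (λ k → high k v) lv hv (permOf-RedWord hv (Reduced-++ʳ (high (rank σ) u) redh)))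
  where
  N : ∀ {n} → n ≡ rank π → suc n ∸ rank σ ≡ suc (rank τ)
  N eq = trans (cong (λ n → suc n ∸ rank σ) (trans eq (trans r (+-comm (rank σ) _))))
               (m+n∸n≡m (suc (rank τ)) (rank σ))

  lu : Letters (suc (rank σ)) (low (rank σ) u)
  lu = Letters-low _ (proj₁ ru)

  lv : Letters (suc (rank σ)) (low (rank σ) v)
  lv = Letters-low _ (proj₁ rv)

  hu : Letters (suc (rank τ)) (high (rank σ) u)
  hu = subst (λ n → Letters n (high (rank σ) u)) (N r′) (Letters-high _ (RedWord-Letters {π′} ru))

  hv : Letters (suc (rank τ)) (high (rank σ) v)
  hv = subst (λ n → Letters n (high (rank σ) v)) (N r″) (Letters-high _ (RedWord-Letters {π″} rv))

  rl′ : RedWord σ (low (rank σ) u ++ low (rank σ) v)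
  rl′ = subst (RedWord σ) (low-++ (rank σ) u v) (proj₁ (Split-any {σ} {τ} {π} s ruv))

  rh′ : RedWord τ (high (rank σ) u ++ high (rank σ) v)
  rh′ = subst (RedWord τ) (high-++ (rank σ) u v) (proj₂ (Split-any {σ} {τ} {π} s ruv))

  redl : Reduced (low (rank σ) u ++ low (rank σ) v)
  redl = proj₁ (proj₂ rl′)

  redh : Reduced (high (rank σ) u ++ high (rank σ) v)
  redh = proj₁ (proj₂ rh′)

  fσ : Factors σ (permOf lu) (permOf lv)
  fσ = Factors-construct {σ} lu lv refl rl′

  fτ : Factors τ (permOf hu) (permOf hv)
  fτ = Factors-construct {τ} hu hv refl rh′

  ranks : ∀ {n x y} (l : Letters (suc (rank σ)) x) (h : Letters (suc (rank τ)) y) →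
          n ≡ rank σ + rank τ → n ≡ rank (permOf l) + rank (permOf h)
  ranks l h eq = trans eq (sym (cong₂ _+_ (permOf-rank l) (permOf-rank h)))

  part : ∀ (f : ℕ → Word) {x y} (l : Letters (suc (rank σ)) x) (h : Letters (suc y) (f (rank σ))) →
         RedWord (permOf h) (f (rank σ)) → RedWord (permOf h) (f (rank (permOf l)))
  part f l h = subst (RedWord (permOf h) ∘ f) (sym (permOf-rank l))

-- The low part of u ++ v concatenates words of σ′ and σ″, the high part words of τ′ and τ″. Both
-- are reduced by length additivity, so `Good⇒Reduced` applies to u ++ v.
factors-split : ∀ {σ τ π′ π″} →
  ∃[ σσ ] Factors σ (proj₁ σσ) (proj₂ σσ) × ∃[ ττ ] Factors τ (proj₁ ττ) (proj₂ ττ) ×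
    Split (proj₁ σσ) (proj₁ ττ) π′ × Split (proj₂ σσ) (proj₂ ττ) π″ →
  ∃[ π ] Split σ τ π × Factors π π′ π″
factors-split {σ} {τ} {π′} {π″}
  ((σ′ , σ″) , fσ@(rσ′ , rσ″ , _) , (τ′ , τ″) , fτ@(rτ′ , rτ″ , _) , (r′ , u , ru , rlu , rhu) , (r″ , v , rv , rlv , rhv)) =
  permOf l , Split-construct {σ} {τ} l rl rh ,
  (trans rank′ (sym (permOf-rank l)) , trans rank″ (sym (permOf-rank l)) , u , v , ru , rv ,
   permOf-RedWord l (Good⇒Reduced (u ++ v) (proj₁ (proj₂ rl) , proj₁ (proj₂ rh))))
  where
  rank′ : rank π′ ≡ rank σ + rank τ
  rank′ = trans r′ (cong₂ _+_ rσ′ rτ′)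

  rank″ : rank π″ ≡ rank σ + rank τ
  rank″ = trans r″ (cong₂ _+_ rσ″ rτ″)

  l : Letters (suc (rank σ + rank τ)) (u ++ v)
  l = AllP.++⁺ (subst (λ n → Letters (suc n) u) rank′ (RedWord-Letters {π′} ru))
               (subst (λ n → Letters (suc n) v) rank″ (RedWord-Letters {π″} rv))

  rl : RedWord σ (low (rank σ) (u ++ v))
  rl rewrite low-++ (rank σ) u v = Factors-any {σ} {σ′} {σ″} fσ
    (subst (λ k → RedWord σ′ (low k u)) rσ′ rlu) (subst (λ k → RedWord σ″ (low k v)) rσ″ rlv)

  rh : RedWord τ (high (rank σ) (u ++ v))
  rh rewrite high-++ (rank σ) u v = Factors-any {τ} {τ′} {τ″} fτ
    (subst (λ k → RedWord τ′ (high k u)) rσ′ rhu) (subst (λ k → RedWord τ″ (high k v)) rσ″ rhv)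

-- The sets 𝓑 m n

-- A cycle with one-line notation (k+1) 1 2 ⋯ k: it puts the value k+1 in first place.
down : ℕ → Word
down zero    = []
down (suc k) = suc k ∷ down k

-- The word (k+1)(k+2)⋯(k+l), a cycle that puts the value k+1 in place k+l+1 and keeps the order of
-- the other values.
up : ℕ → ℕ → Word
up k zero    = []
up k (suc l) = suc k ∷ up (suc k) l

-- The increasing map of ℕ that misses only m. Flattening undoes it, so it describes one-line
-- notation after the entry m has been removed.
skip : ℕ → ℕ → ℕ
skip zero    y       = suc y
skip (suc m) zero    = zero
skip (suc m) (suc y) = suc (skip m y)

skip-below : ∀ {m y} → y < m → skip m y ≡ y
skip-below {suc m} {zero}  _         = refl
skip-below {suc m} {suc y} (s≤s y<m) = cong suc (skip-below y<m)

sw-skip : ∀ m y → sw m (skip m y) ≡ skip (suc m) y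
sw-skip zero    zero    = refl
sw-skip zero    (suc y) = refl
sw-skip (suc m) zero    = refl
sw-skip (suc m) (suc y) = cong suc (sw-skip m y)

skip-≤ᵇ : ∀ m x y → (skip m x ≤ᵇ skip m y) ≡ (x ≤ᵇ y)
skip-≤ᵇ zero    zero    y       = refl
skip-≤ᵇ zero    (suc x) y       = refl
skip-≤ᵇ (suc m) zero    y       = refl
skip-≤ᵇ (suc m) (suc x) zero    = refl
skip-≤ᵇ (suc m) (suc x) (suc y) = trans (<ᵇ-suc (skip m x) (skip m y)) (trans (skip-≤ᵇ m x y) (sym (<ᵇ-suc x y)))
  where
  <ᵇ-suc : ∀ x y → (x <ᵇ suc y) ≡ (x ≤ᵇ y)
  <ᵇ-suc zero    y = refl
  <ᵇ-suc (suc x) y = refl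

act-down : ∀ k y → 1 ≤ y → act (down k) (suc y) ≡ skip (suc k) y
act-down zero    (suc y) _   = refl
act-down (suc k) y       1≤y = trans (cong (sw (suc k)) (act-down k y 1≤y)) (sw-skip (suc k) y)

act-down-one : ∀ k → act (down k) 1 ≡ suc k
act-down-one zero    = refl
act-down-one (suc k) = trans (cong (sw (suc k)) (act-down-one k)) (sw-left (suc k))

act-up : ∀ k l y → y ≤ k + l → act (up k l) y ≡ skip (suc k) y
act-up k zero    y y≤ = sym (skip-below (s≤s (subst (y ≤_) (+-identityʳ k) y≤)))
act-up k (suc l) y y≤ = trans (cong (sw (suc k)) (trans (act-up (suc k) l y (subst (y ≤_) (+-suc k l) y≤))
  (sym (sw-skip (suc k) y)))) (sw-involutive (suc k) (skip (suc k) y))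

act-up-last : ∀ k l → act (up k l) (suc (k + l)) ≡ suc k
act-up-last k zero    = cong suc (+-identityʳ k)
act-up-last k (suc l) = trans (cong (sw (suc k)) (trans (cong (act (up (suc k) l) ∘ suc) (+-suc k l)) (act-up-last (suc k) l)))
  (sw-right (suc k))

private
  act⇒pre-point : ∀ u {x y} → act u x ≡ y → pre u y ≡ x
  act⇒pre-point u {x} eq = trans (cong (pre u) (sym eq)) (pre-act u x)

pre-down-top : ∀ k → pre (down k) (suc k) ≡ 1
pre-down-top k = act⇒pre-point (down k) (act-down-one k)

pre-down : ∀ k {x} → InRange k x → pre (down k) x ≡ suc x
pre-down k {x} (1≤x , x≤k) = act⇒pre-point (down k) (trans (act-down k x 1≤x) (skip-below (s≤s x≤k)))

pre-down-above : ∀ k {x} → suc k < x → pre (down k) x ≡ x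
pre-down-above zero    _   = refl
pre-down-above (suc k) k<x = trans (cong (pre (down k)) (sw-above k<x)) (pre-down-above k (<⇒≤ k<x))

pre-up-bottom : ∀ k l → pre (up k l) (suc k) ≡ suc (k + l)
pre-up-bottom k l = act⇒pre-point (up k l) (act-up-last k l)

pre-up-below : ∀ k l {x} → x ≤ k → pre (up k l) x ≡ x
pre-up-below k zero    _   = refl
pre-up-below k (suc l) x≤k = trans (cong (pre (up (suc k) l)) (sw-below (s≤s x≤k))) (pre-up-below (suc k) l (m≤n⇒m≤1+n x≤k))

pre-up-zero : ∀ l {x} → InRange l x → pre (up 0 l) (suc x) ≡ x
pre-up-zero l {suc x} (_ , x≤l) = act⇒pre-point (up 0 l) (act-up 0 l (suc x) x≤l)

pre-map-suc : ∀ u x → pre (map suc u) (suc x) ≡ suc (pre u x)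
pre-map-suc []      x = refl
pre-map-suc (i ∷ u) x = pre-map-suc u (sw i x)

act-map-suc : ∀ u x → act (map suc u) (suc x) ≡ suc (act u x)
act-map-suc []      x = refl
act-map-suc (i ∷ u) x = cong (sw (suc i)) (act-map-suc u x)

Reduced-map-suc⁻ : ∀ u → Reduced (map suc u) → Reduced u
Reduced-map-suc⁻ []      _       = tt
Reduced-map-suc⁻ (i ∷ u) (a , r) =
  ≤-pred (subst₂ _<_ (pre-map-suc u i) (pre-map-suc u (suc i)) a) , Reduced-map-suc⁻ u r

Reduced-map-suc⁺ : ∀ u → Reduced u → Reduced (map suc u)
Reduced-map-suc⁺ []      _       = tt
Reduced-map-suc⁺ (i ∷ u) (a , r) =
  subst₂ _<_ (sym (pre-map-suc u i)) (sym (pre-map-suc u (suc i))) (s≤s a) , Reduced-map-suc⁺ u r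

pre-zero : ∀ {u} → All (1 ≤_) u → pre u 0 ≡ 0
pre-zero []       = refl
pre-zero {i ∷ u} (p ∷ ps) = trans (cong (pre u) (sw-below p)) (pre-zero ps)

pre-positive : ∀ {u x} → All (1 ≤_) u → 1 ≤ x → 1 ≤ pre u x
pre-positive {u} {x} ps 1≤x with pre u x in eq
... | suc _ = s≤s z≤n
... | zero  = contradiction (pre-injective u (trans eq (sym (pre-zero ps)))) (>⇒≢ 1≤x)

pre-beyond : ∀ {n u x} → Letters n u → n < x → pre u x ≡ x
pre-beyond {u = u} l n<x = act⇒pre-point u (act-beyond l n<x)

-- When a letter i of `down` is put in front, the value i stands at position 1, so the letter is an
-- ascent.
Reduced-down : ∀ k w → All (1 ≤_) w → Reduced w → Reduced (down k ++ map suc w)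
Reduced-down zero    w ps r = Reduced-map-suc⁺ w r
Reduced-down (suc k) w ps r = subst₂ _<_
  (sym (trans (pre-++ (down k) _ (suc k)) (trans (cong (pre (map suc w)) (pre-down-top k))
    (trans (pre-map-suc w 0) (cong suc (pre-zero ps))))))
  (sym (trans (pre-++ (down k) _ (suc (suc k))) (trans (cong (pre (map suc w)) (pre-down-above k (n<1+n _)))
    (pre-map-suc w (suc k)))))
  (s≤s (pre-positive ps (s≤s z≤n))) , Reduced-down k w ps r

-- When the letter k+1 is put in front, the value k+2 stands at the last position n+1, which w
-- fixes, so the letter is an ascent.
Reduced-up : ∀ k l {n} w → k + l ≡ n → Letters n w → Reduced w → Reduced (up k l ++ w)
Reduced-up k zero    w eq lw r = r
Reduced-up k (suc l) {n} w refl lw r = subst₂ _<_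
  (sym (trans (pre-++ (up (suc k) l) w (suc k)) (cong (pre w) (pre-up-below (suc k) l ≤-refl))))
  (sym (trans (pre-++ (up (suc k) l) w (suc (suc k))) (trans (cong (pre w) (pre-up-bottom (suc k) l))
    (pre-beyond lw (subst (k + suc l <_) (cong suc (+-suc k l)) ≤-refl)))))
  (s≤s (subst (pre w (suc k) ≤_) (+-suc k l) (proj₂ (pre-range lw (s≤s z≤n , subst (suc k ≤_) (sym (+-suc k l)) (s≤s (m≤m+n k l)))))))
  , Reduced-up (suc k) l w (sym (+-suc k l)) lw r

low-map-suc : ∀ k u → low (suc k) (map suc u) ≡ map suc (low k u)
low-map-suc k []      = refl
low-map-suc k (i ∷ u) with i ≤? k
... | yes p = trans (low-∷-≤ (map suc u) (s≤s p)) (cong (suc i ∷_) (low-map-suc k u))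
... | no  p = trans (low-∷-> (map suc u) (s≤s (≰⇒> p))) (low-map-suc k u)

high-map-suc : ∀ k u → high (suc k) (map suc u) ≡ high k u
high-map-suc k []      = refl
high-map-suc k (i ∷ u) with i ≤? k
... | yes p = trans (high-∷-≤ (map suc u) (s≤s p)) (high-map-suc k u)
... | no  p = trans (high-∷-> (map suc u) (s≤s (≰⇒> p))) (cong (i ∸ k ∷_) (high-map-suc k u))

down-≤ : ∀ k → All (_≤ k) (down k)
down-≤ zero    = []
down-≤ (suc k) = ≤-refl ∷ All.map m≤n⇒m≤1+n (down-≤ k)

low-up : ∀ k j l → k ≤ j → low k (up j l) ≡ []
low-up k j zero    _   = refl
low-up k j (suc l) k≤j = trans (low-∷-> (up (suc j) l) (s≤s k≤j)) (low-up k (suc j) l (m≤n⇒m≤1+n k≤j))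

high-up : ∀ k j l → k ≤ j → high k (up j l) ≡ up (j ∸ k) l
high-up k j zero    _   = refl
high-up k j (suc l) k≤j = trans (high-∷-> (up (suc j) l) (s≤s k≤j))
  (cong₂ _∷_ (+-∸-assoc 1 k≤j) (trans (high-up k (suc j) l (m≤n⇒m≤1+n k≤j)) (cong (λ i → up i l) (+-∸-assoc 1 k≤j))))

-- Value and position add up to k+2; the additive form avoids truncated subtraction.
Reversing : ℕ → Word → Set
Reversing k u = ∀ {x} → InRange (suc k) x → pre u x + x ≡ suc (suc k)

-- u is a reduced word of the reversal permutation of S_{k+1}.
Longest : ℕ → Word → Set
Longest k u = Reduced u × Reversing k u

Longest-resp : ∀ {k u v} → u ~ v → Longest k u → Longest k v
Longest-resp p (r , eq) = ~-Reduced p r , λ {x} x∈ → trans (cong (_+ x) (sym (~-pre p x))) (eq x∈)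

-- The reversal of S_{k+2} starts with k+2, put there by `down (suc k)`; the reversal of S_{k+1}
-- follows, shifted by one place.
Longest-down : ∀ {k w} → All (1 ≤_) w → Longest k w → Longest (suc k) (down (suc k) ++ map suc w)
Longest-down {k} {w} ps (r , eq) = Reduced-down (suc k) w ps r , eq′
  where
  eq′ : ∀ {x} → InRange (suc (suc k)) x → pre (down (suc k) ++ map suc w) x + x ≡ suc (suc (suc k))
  eq′ {x} (1≤x , x≤) rewrite pre-++ (down (suc k)) (map suc w) x with x ≟ suc (suc k)
  ... | yes refl rewrite pre-down-top (suc k) | pre-map-suc w 0 | pre-zero ps = refl
  ... | no  x≢ with x∈ ← 1≤x , ≤-pred (≤∧≢⇒< x≤ x≢)
    rewrite pre-down (suc k) x∈ | pre-map-suc w x = cong suc (eq x∈)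

Longest-down⁻ : ∀ {k w} → Longest (suc k) (down (suc k) ++ map suc w) → Longest k w
Longest-down⁻ {k} {w} (r , eq) = Reduced-map-suc⁻ w (Reduced-++ʳ (down (suc k)) r) , λ {x} x∈ →
  suc-injective (trans (cong (_+ x) (sym (trans (pre-++ (down (suc k)) _ x)
    (trans (cong (pre (map suc w)) (pre-down (suc k) x∈)) (pre-map-suc w x)))))
    (eq (proj₁ x∈ , m≤n⇒m≤1+n (proj₂ x∈))))

-- The reversal of S_{l+2} ends with 1, which `up 0 (suc l)` moves to the last place.
Longest-up : ∀ {l w} → Letters (suc l) w → Longest l w → Longest (suc l) (up 0 (suc l) ++ w)
Longest-up {l} {w} lw (r , eq) = Reduced-up 0 (suc l) w refl lw r , eq′
  where
  eq′ : ∀ {x} → InRange (suc (suc l)) x → pre (up 0 (suc l) ++ w) x + x ≡ suc (suc (suc l))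
  eq′ {suc zero} _ rewrite pre-++ (up 0 (suc l)) w 1 | pre-up-bottom 0 (suc l) | pre-beyond lw (n<1+n (suc l)) =
    +-comm (suc (suc l)) 1
  eq′ {suc (suc x)} (_ , s≤s x≤) rewrite pre-++ (up 0 (suc l)) w (suc (suc x)) | pre-up-zero (suc l) (s≤s z≤n , x≤) =
    trans (+-suc _ (suc x)) (cong suc (eq (s≤s z≤n , x≤)))

Longest-up⁻ : ∀ {l w} → Longest (suc l) (up 0 (suc l) ++ w) → Longest l w
Longest-up⁻ {l} {w} (r , eq) = Reduced-++ʳ (up 0 (suc l)) r , λ {x} x∈ →
  suc-injective (trans (sym (+-suc (pre w x) x)) (trans (cong (_+ suc x) (sym (trans (pre-++ (up 0 (suc l)) w (suc x))
    (cong (pre w) (pre-up-zero (suc l) x∈))))) (eq (s≤s z≤n , s≤s (proj₂ x∈)))))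

-- Cut at k, such a word belongs to the product of the reversals of S_{k+1} and S_{l+1}.
LongestSplit : ℕ → ℕ → Word → Set
LongestSplit k l u = Longest k (low k u) × Longest l (high k u)

LongestSplit-resp : ∀ {k l u v} → u ~ v → LongestSplit k l u → LongestSplit k l v
LongestSplit-resp p (a , b) with pl , ph ← ~-split p (proj₁ a , proj₁ b) = Longest-resp pl a , Longest-resp ph b

private
  low-down : ∀ k v → low (suc k) (down (suc k) ++ map suc v) ≡ down (suc k) ++ map suc (low k v)
  low-down k v = trans (low-++ (suc k) (down (suc k)) _) (cong₂ _++_ (low-all (down-≤ (suc k))) (low-map-suc k v))

  high-down : ∀ k v → high (suc k) (down (suc k) ++ map suc v) ≡ high k v
  high-down k v = trans (high-++ (suc k) (down (suc k)) _) (cong₂ _++_ (high-none (down-≤ (suc k))) (high-map-suc k v))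

  low-up-++ : ∀ k l v → low k (up k l ++ v) ≡ low k v
  low-up-++ k l v = trans (low-++ k (up k l) v) (cong (_++ low k v) (low-up k k l ≤-refl))

  high-up-++ : ∀ k l v → high k (up k l ++ v) ≡ up 0 l ++ high k v
  high-up-++ k l v = trans (high-++ k (up k l) v)
    (cong (_++ high k v) (trans (high-up k k l ≤-refl) (cong (λ i → up i l) (n∸n≡0 k))))

  low-1≤ : ∀ {u} k → All (1 ≤_) u → All (1 ≤_) (low k u)
  low-1≤ k [] = []
  low-1≤ {i ∷ u} k (p ∷ ps) with i ≤? k
  ... | yes _ = p ∷ low-1≤ k ps
  ... | no  _ = low-1≤ k ps

-- The letters of `down` are all low, and shifting v moves the cut along, so only the low part
-- grows. On words this is the step from `𝓑` (m, n) to (m-1, n-1).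
LongestSplit-down : ∀ {k l v} → All (1 ≤_) v →
  LongestSplit (suc k) l (down (suc k) ++ map suc v) ⇔ LongestSplit k l v
LongestSplit-down {k} {l} {v} ps rewrite low-down k v | high-down k v =
  mk⇔ (λ (a , b) → Longest-down⁻ a , b) (λ (a , b) → Longest-down (low-1≤ k ps) a , b)

-- The letters of `up` are all high and become 1, ..., l+1 when lowered. On words this is the step
-- from `𝓑` (m, n) to (m, n-1).
LongestSplit-up : ∀ {k l v} → Letters (k + suc l) v →
  LongestSplit k (suc l) (up k (suc l) ++ v) ⇔ LongestSplit k l v
LongestSplit-up {k} {l} {v} lv rewrite low-up-++ k (suc l) v | high-up-++ k (suc l) v =
  mk⇔ (λ (a , b) → a , Longest-up⁻ b)
      (λ (a , b) → a , Longest-up (subst (λ n → Letters n (high k v)) (m+n∸m≡n k (suc l)) (Letters-high k lv)) b)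

-- Following the value k+1 through a word, the first letter k or k+1 moves it into
-- the low or the high part; reducedness of that part keeps it from coming back.

sw-+ : ∀ k j y → sw (k + j) (k + y) ≡ k + sw j y
sw-+ zero    j y = refl
sw-+ (suc k) j y = cong suc (sw-+ k j y)

-- High letters do not touch values up to k. Bound for position 1 in the reduced low part, the value
-- never moves up and so stays in this range.
trace-low : ∀ {k} u {x} → All (1 ≤_) u → Reduced (low k u) → x ≤ k → pre (low k u) x ≡ 1 → pre u x ≡ 1
trace-low []      _        _ _   eq = eq
trace-low {k} (i ∷ u) {x} (p ∷ ps) r x≤k eq with i ≤? k
... | no i≰k = trans (pre-below u x<i) (trace-low u ps r x≤k eq)
  where
  x<i : x < i
  x<i = ≤-<-trans x≤k (≰⇒> i≰k)
... | yes i≤k with position x i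
...   | below = trans (pre-right i u) (trace-low u ps (proj₂ r) i≤k (trans (sym (pre-right i (low k u))) eq))
...   | far q = trans (pre-below u x<i) (trace-low u ps (proj₂ r) x≤k (trans (sym (pre-below (low k u) x<i)) eq))
  where
  x<i : x < i
  x<i = <-trans (n<1+n x) q
...   | far⁻ q = trans (pre-above u q) (trace-low u ps (proj₂ r) x≤k (trans (sym (pre-above (low k u) q)) eq))
...   | above = trans (pre-below u (n<1+n x)) (trace-low u ps (proj₂ r) x≤k (trans (sym (pre-below (low k u) (n<1+n x))) eq))
-- As an ascent, a letter x raising the value would require a position before 1.
...   | same = contradiction (subst (pre (low k u) x <_) (trans (sym (pre-left x (low k u))) eq) (proj₁ r))
                 (≤⇒≯ (pre-positive (low-1≤ k ps) p))

-- Here y is the value lowered by k. From y = 2 on it is out of reach of low letters, which move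
-- values up to k+1 only, and the reduced high part never lets it come down.
trace-high : ∀ {k l} u {y} → All (1 ≤_) u → Letters (suc l) (high k u) → Reduced (high k u) →
  2 ≤ y → y ≤ suc l → pre (high k u) y ≡ suc l → pre u (k + y) ≡ k + suc l
trace-high []      _ _ _ _ _ eq = cong (_ +_) eq
trace-high {k} (i ∷ u) {y} (p ∷ ps) lu r 2≤y y≤ eq with i ≤? k
... | yes i≤k = trans (pre-above u (≤-trans (≤-trans (s≤s (s≤s i≤k)) (≤-reflexive (+-comm 2 k))) (+-monoʳ-≤ k 2≤y)))
                  (trace-high u ps lu r 2≤y y≤ eq)
trace-high {k} (i ∷ u) {y} (p ∷ ps) ((1≤j , j<) ∷ lu) (a , r) 2≤y y≤ eq | no i≰k
  with i ∸ k | m+[n∸m]≡n (<⇒≤ (≰⇒> i≰k))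
... | j | refl with position y j
...   | same   = trans (cong (pre u) (trans (sw-+ k j j) (cong (k +_) (sw-left j))))
                   (trace-high u ps lu r (m≤n⇒m≤1+n 2≤y) j< (trans (sym (pre-left j (high k u))) eq))
...   | below  = contradiction (subst (_< pre (high k u) (suc j)) (trans (sym (pre-right j (high k u))) eq) a)
                   (≤⇒≯ (proj₂ (pre-range lu (s≤s z≤n , y≤))))
...   | above  = trans (cong (pre u) (trans (sw-+ k j y) (cong (k +_) (sw-below (n<1+n y)))))
                   (trace-high u ps lu r 2≤y y≤ (trans (sym (pre-below (high k u) (n<1+n y))) eq))
...   | far q  = trans (cong (pre u) (trans (sw-+ k j y) (cong (k +_) (sw-below (<-trans (n<1+n y) q)))))
                   (trace-high u ps lu r 2≤y y≤ (trans (sym (pre-below (high k u) (<-trans (n<1+n y) q))) eq))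
...   | far⁻ q = trans (cong (pre u) (trans (sw-+ k j y) (cong (k +_) (sw-above q))))
                   (trace-high u ps lu r 2≤y y≤ (trans (sym (pre-above (high k u) q)) eq))

-- The value k+1 is the largest one of the low part and, lowered by k, the smallest one of the high
-- part. The letter k hands it to the low part, k+1 to the high part, and every other letter fixes
-- it.
trace-middle : ∀ {k l} u → 1 ≤ k → 1 ≤ l → All (1 ≤_) u → Letters (suc l) (high k u) → Good k u →
  pre (low k u) (suc k) ≡ 1 → pre (high k u) 1 ≡ suc l →
  pre u (suc k) ≡ 1 ⊎ pre u (suc k) ≡ suc (k + l)
trace-middle []      1≤k _ _ _ _ eq _ = contradiction (suc-injective eq) (>⇒≢ 1≤k)
trace-middle {k} {l} (i ∷ u) 1≤k 1≤l (p ∷ ps) lu g eq eq′ with i ≤? k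
... | yes i≤k with m≤n⇒m<n∨m≡n i≤k
...   | inj₂ refl = inj₁ (trans (pre-right i u) (trace-low u ps (proj₂ (proj₁ g)) ≤-refl (trans (sym (pre-right i (low i u))) eq)))
...   | inj₁ i<k rewrite pre-above u (s≤s i<k) =
        trace-middle u 1≤k 1≤l ps lu (proj₂ (proj₁ g) , proj₂ g) (trans (sym (pre-above (low k u) (s≤s i<k))) eq) eq′
trace-middle {k} {l} (i ∷ u) 1≤k 1≤l (p ∷ ps) ((1≤j , j<) ∷ lu) (gl , a , gh) eq eq′ | no i≰k
  with i ∸ k | m+[n∸m]≡n (<⇒≤ (≰⇒> i≰k))
... | suc zero | refl = inj₂ (trans (cong (pre u) (trans (cong (sw (k + 1)) (+-comm 1 k)) (sw-+ k 1 1)))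
        (trans (trace-high u ps lu gh ≤-refl (s≤s 1≤l) eq′) (+-suc k l)))
... | suc (suc j) | refl rewrite pre-below {k + suc (suc j)} {suc k} u (≤-trans (≤-reflexive (+-comm 2 k)) (+-monoʳ-≤ k (s≤s (s≤s (z≤n {j}))))) =
        trace-middle u 1≤k 1≤l ps lu (gl , gh) eq (trans (sym (pre-below (high k u) (s≤s (s≤s (z≤n {j}))))) eq′)

LongestSplit-middle : ∀ {k l u} → 1 ≤ k → 1 ≤ l → Letters (suc (k + l)) u → LongestSplit k l u →
  pre u (suc k) ≡ 1 ⊎ pre u (suc k) ≡ suc (k + l)
LongestSplit-middle {k} {l} {u} 1≤k 1≤l lu ((rl , eql) , (rh , eqh)) =
  trace-middle u 1≤k 1≤l (All.map proj₁ lu)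
    (subst (λ n → Letters n (high k u)) (trans (cong (_∸ k) (sym (+-suc k l))) (m+n∸m≡n k (suc l))) (Letters-high k lu))
    (rl , rh) (+-cancelʳ-≡ (suc k) _ 1 (eql (s≤s z≤n , ≤-refl)))
    (+-cancelʳ-≡ 1 _ _ (trans (eqh (s≤s z≤n , s≤s z≤n)) (+-comm 1 (suc l))))

-- If the letter 1 came next, its ascent condition would ask for a position before 1; so all letters
-- are at least 2 and can be lowered.
strip-bottom : ∀ {n} u → Letters (suc n) u → Reduced u → pre u 1 ≡ 1 → ∃[ v ] u ≡ map suc v × Letters n v
strip-bottom []                  _                  _       _  = [] , refl , []
strip-bottom (suc zero ∷ u)      (_ ∷ l)            (a , r) eq =
  contradiction (subst (pre u 1 <_) eq a) (≤⇒≯ (pre-positive (All.map proj₁ l) ≤-refl))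
strip-bottom (suc (suc i) ∷ u)   ((_ , s≤s i<n) ∷ l) (a , r) eq
  with v , refl , lv ← strip-bottom u l r eq = suc i ∷ v , refl , (s≤s z≤n , i<n) ∷ lv

-- For k > 0 the value k+1 in first place makes k a descent; `exchange` splits off k and leaves the
-- value k in first place.
strip-down : ∀ {n} k u → Letters (suc n) u → Reduced u → k ≤ n → pre u (suc k) ≡ 1 →
             ∃[ v ] u ~ down k ++ map suc v × Letters n v
strip-down zero    u l r k≤n eq with v , refl , lv ← strip-bottom u l r eq = v , ~-refl , lv
strip-down (suc k) u l r k<n eq
  with w , p ← exchange u (suc k) r (subst (_< pre u (suc k)) (sym eq)
         (≤∧≢⇒< (pre-positive (All.map proj₁ l) (s≤s z≤n)) λ e → 1+n≢n (pre-injective u (trans eq e))))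
  with _ ∷ lw ← ~-All p l
  with v , q , lv ← strip-down k w lw (proj₂ (~-Reduced p r)) (<⇒≤ k<n)
         (trans (sym (trans (~-pre p (suc (suc k))) (pre-right (suc k) w))) eq)
  = v , ~-trans p (suc k ∷~ q) , lv

strip-top : ∀ {n} u → Letters (suc n) u → Reduced u → pre u (suc n) ≡ suc n → Letters n u
strip-top     []      _                         _       _  = []
strip-top {n} (i ∷ u) ((1≤i , s≤s i≤n) ∷ l) (a , r) eq with m≤n⇒m<n∨m≡n i≤n
... | inj₁ i<n  = (1≤i , i<n) ∷ strip-top u l r (trans (sym (pre-above u (s≤s i<n))) eq)
... | inj₂ refl = contradiction (subst (_< pre u (suc i)) (trans (sym (pre-right i u)) eq) a)
                    (≤⇒≯ (proj₂ (pre-range l (s≤s z≤n , ≤-refl))))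

-- For l > 0 the value k+1 in last place makes k+1 a descent; splitting it off leaves the value k+2
-- there.
strip-up : ∀ {n} k l u → k + l ≡ n → Letters (suc n) u → Reduced u → pre u (suc k) ≡ suc n →
           ∃[ v ] u ~ up k l ++ v × Letters n v
strip-up k zero    u refl lu r eq rewrite +-identityʳ k = u , ~-refl , strip-top u lu r eq
strip-up {n} k (suc l) u k+l≡n lu r eq
  with k<n ← subst (suc k ≤_) k+l≡n (subst (suc k ≤_) (sym (+-suc k l)) (s≤s (m≤m+n k l)))
  with w , p ← exchange u (suc k) r (subst (pre u (suc (suc k)) <_) (sym eq)
         (≤∧≢⇒< (proj₂ (pre-range lu (s≤s z≤n , s≤s k<n))) λ e → 1+n≢n (pre-injective u (trans e (sym eq)))))
  with _ ∷ lw ← ~-All p lu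
  with v , q , lv ← strip-up (suc k) l w (trans (sym (+-suc k l)) k+l≡n) lw (proj₂ (~-Reduced p r))
         (trans (sym (trans (~-pre p (suc k)) (pre-left (suc k) w))) eq)
  = v , ~-trans p (suc k ∷~ q) , lv

private
  length-filter-map : ∀ {p q : ℕ → Bool} (g : ℕ → ℕ) → (∀ y → p (g y) ≡ q y) → ∀ w →
                      length (filterᵇ p (map g w)) ≡ length (filterᵇ q w)
  length-filter-map g eq []      = refl
  length-filter-map {p} {q} g eq (y ∷ w) with p (g y) | q y | eq y
  ... | true  | .true  | refl = cong suc (length-filter-map g eq w)
  ... | false | .false | refl = length-filter-map g eq w

  map-fixed : ∀ {f : ℕ → ℕ} w → (∀ {x} → x ∈ w → f x ≡ x) → map f w ≡ w
  map-fixed []      _  = refl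
  map-fixed (x ∷ w) eq = cong₂ _∷_ (eq (here refl)) (map-fixed w (eq ∘ there))

oneLine : ℕ → Word → List ℕ
oneLine n u = map (act u) (range n)

-- The entries not exceeding x are 1, ..., x, so every entry is its own rank.
fl-oneLine : ∀ {n v} → Letters n v → fl (oneLine n v) ≡ oneLine n v
fl-oneLine {n} {v} lv = map-fixed (oneLine n v) λ {x} x∈ →
  trans (↭-length (enum-↭ (λ {y} (y∈ , y≤x) → proj₁ y∈ , ≤ᵇ⇒≤ y x y≤x)
    (λ (1≤y , y≤x) → (1≤y , ≤-trans y≤x (proj₂ (sound (enum-map-act lv) x∈))) , ≤⇒≤ᵇ y≤x)
    (enum-filter (_≤ᵇ x) (enum-map-act lv)) (enum-range x)))
  (length-range x)

fl-skip : ∀ m w → fl (map (skip m) w) ≡ fl w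
fl-skip m w = trans (sym (map-∘ w))
  (map-cong (λ x → length-filter-map (skip m) (λ y → skip-≤ᵇ m y x) w) w)

range-∷ : ∀ n → range (suc n) ≡ 1 ∷ map suc (range n)
range-∷ n = cong (1 ∷_) (trans (map-applyUpTo suc suc n) (sym (trans (cong (map suc) (map-applyUpTo id suc n)) (map-applyUpTo suc suc n))))

range-∷ʳ : ∀ n → range (suc n) ≡ range n ∷ʳ suc n
range-∷ʳ n = trans (cong (map suc) (sym (upTo-∷ʳ n))) (map-++ suc (upTo n) (n ∷ []))

oneLine-resp : ∀ {n u v} → u ~ v → oneLine n u ≡ oneLine n v
oneLine-resp {n} p = map-cong (~-act p) (range n)

oneLine-down : ∀ {n v} k → Letters n v → oneLine (suc n) (down k ++ map suc v) ≡ suc k ∷ map (skip (suc k)) (oneLine n v)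
oneLine-down {n} {v} k lv = trans (cong (map (act (down k ++ map suc v))) (range-∷ n)) (cong₂ _∷_
  (trans (act-++ (down k) _ 1) (trans (cong (act (down k)) (trans (act-map-suc v 0) (cong suc (act-zero lv)))) (act-down-one k)))
  (trans (sym (map-∘ (range n))) (trans (map-range-cong n λ {x} x∈ →
      trans (act-++ (down k) _ (suc x)) (trans (cong (act (down k)) (act-map-suc v x)) (act-down k _ (proj₁ (act-range lv x∈)))))
    (map-∘ (range n)))))

oneLine-up : ∀ {n v} k l → k + l ≡ n → Letters n v → oneLine (suc n) (up k l ++ v) ≡ map (skip (suc k)) (oneLine n v) ∷ʳ suc k
oneLine-up {n} {v} k l refl lv = trans (cong (map (act (up k l ++ v))) (range-∷ʳ n))
  (trans (map-++ _ (range n) _) (cong₂ _++_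
    (trans (map-range-cong n λ {x} x∈ → trans (act-++ (up k l) v x) (act-up k l _ (proj₂ (act-range lv x∈)))) (map-∘ (range n)))
    (cong (_∷ []) (trans (act-++ (up k l) v (suc n)) (trans (cong (act (up k l)) (act-beyond lv ≤-refl)) (act-up-last k l))))))

last-∷ʳ : ∀ (xs : List ℕ) x → ListB.last (xs ∷ʳ x) ≡ just x
last-∷ʳ []           x = refl
last-∷ʳ (y ∷ [])     x = refl
last-∷ʳ (y ∷ z ∷ xs) x = last-∷ʳ (z ∷ xs) x

init-∷ʳ : ∀ xs x → init (xs ∷ʳ x) ≡ xs
init-∷ʳ xs x rewrite reverse-++ xs (x ∷ []) = reverse-involutive xs

revW-map : ∀ n → revW n ≡ map (suc n ∸_) (range n)
revW-map n = trans (cong reverse (map-applyUpTo id suc n)) (trans (reverse-applyUpTo suc n)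
  (trans (go n) (sym (trans (sym (map-∘ (upTo n))) (map-applyUpTo id (n ∸_) n)))))
  where
  go : ∀ n → applyDownFrom suc n ≡ applyUpTo (n ∸_) n
  go zero    = refl
  go (suc n) = cong (suc n ∷_) (go n)

revW⇔ : ∀ {k u} → Letters (suc k) u → oneLine (suc k) u ≡ revW (suc k) ⇔ Reversing k u
revW⇔ {k} {u} lu = mk⇔
  (λ eq {x} x∈ → let y∈ = pre-range lu x∈ in
    trans (cong (pre u x +_) (trans (sym (act-pre u x)) (map-range-injective (suc k) (trans eq (revW-map (suc k))) y∈)))
          (m+[n∸m]≡n (m≤n⇒m≤1+n (proj₂ y∈))))
  (λ eq → trans (map-range-cong (suc k) λ {x} x∈ → trans (sym (m+n∸m≡n x (act u x)))
      (cong (_∸ x) (trans (cong (_+ act u x) (sym (pre-act u x))) (eq (act-range lu x∈)))))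
    (sym (revW-map (suc k))))

inB-end : ∀ {m n w} → m ≡ 1 ⊎ m ≡ suc n → T (inB m (suc n) w) ⇔ w ≡ revW (suc n)
inB-end {m} {n} {w} m-end = mk⇔ to from
  where
  end? : m ≡ 1 ⊎ m ≡ suc n → T ((m ≡ᵇ 1) ∨ (m ≡ᵇ suc n))
  end? (inj₁ eq) = Equivalence.from (T-∨ {m ≡ᵇ 1}) (inj₁ (≡⇒≡ᵇ m 1 eq))
  end? (inj₂ eq) = Equivalence.from (T-∨ {m ≡ᵇ 1}) (inj₂ (≡⇒≡ᵇ m (suc n) eq))

  inner : m ≡ 1 ⊎ m ≡ suc n → ¬ (1 < m × m < suc n)
  inner (inj₁ eq) (1<m , _) = >⇒≢ 1<m eq
  inner (inj₂ eq) (_ , m<n) = <⇒≢ m<n eq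

  to : T (inB m (suc n) w) → w ≡ revW (suc n)
  to t with Equivalence.to (T-∨ {((m ≡ᵇ 1) ∨ (m ≡ᵇ suc n)) ∧ (w == revW (suc n))}) t
  ... | inj₁ t₁ = ==⇒≡ w (revW (suc n)) (proj₂ (Equivalence.to (T-∧ {(m ≡ᵇ 1) ∨ (m ≡ᵇ suc n)}) t₁))
  ... | inj₂ t₂ with a , b ← Equivalence.to (T-∧ {1 <ᵇ m}) (proj₁ (Equivalence.to (T-∧ {(1 <ᵇ m) ∧ (m <ᵇ suc n)}) t₂)) =
    contradiction (<ᵇ⇒< 1 m a , <ᵇ⇒< m (suc n) b) (inner m-end)

  from : w ≡ revW (suc n) → T (inB m (suc n) w)
  from eq = Equivalence.from T-∨ (inj₁ (Equivalence.from T-∧ (end? m-end , ≡⇒== eq)))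

inB-inner : ∀ {m n w} → 1 < m → m < suc n → T (inB m (suc n) w) ⇔
  (T (isJust m (ListB.head w)) × T (inB (m ∸ 1) n (fl (tailW w))) ⊎
   T (isJust m (ListB.last w)) × T (inB m n (fl (init w))))
inB-inner {m} {n} {w} 1<m m<n = mk⇔ to from
  where
  A C : Bool
  A = isJust m (ListB.head w) ∧ inB (m ∸ 1) n (fl (tailW w))
  C = isJust m (ListB.last w) ∧ inB m n (fl (init w))

  to : T (inB m (suc n) w) → _
  to t with Equivalence.to (T-∨ {((m ≡ᵇ 1) ∨ (m ≡ᵇ suc n)) ∧ (w == revW (suc n))}) t
  ... | inj₁ t₁ with Equivalence.to (T-∨ {m ≡ᵇ 1}) (proj₁ (Equivalence.to (T-∧ {(m ≡ᵇ 1) ∨ (m ≡ᵇ suc n)}) t₁))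
  ...   | inj₁ eq = contradiction (≡ᵇ⇒≡ m 1 eq) (>⇒≢ 1<m)
  ...   | inj₂ eq = contradiction (≡ᵇ⇒≡ m (suc n) eq) (<⇒≢ m<n)
  to t | inj₂ t₂ with Equivalence.to (T-∨ {A}) (proj₂ (Equivalence.to (T-∧ {(1 <ᵇ m) ∧ (m <ᵇ suc n)}) t₂))
  ... | inj₁ a = inj₁ (Equivalence.to T-∧ a)
  ... | inj₂ c = inj₂ (Equivalence.to T-∧ c)

  from : _ → T (inB m (suc n) w)
  from e = Equivalence.from (T-∨ {((m ≡ᵇ 1) ∨ (m ≡ᵇ suc n)) ∧ (w == revW (suc n))}) (inj₂
    (Equivalence.from (T-∧ {(1 <ᵇ m) ∧ (m <ᵇ suc n)}) (Equivalence.from T-∧ (<⇒<ᵇ 1<m , <⇒<ᵇ m<n) , inner e)))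
    where
    inner : _ → T (A ∨ C)
    inner (inj₁ a) = Equivalence.from (T-∨ {A}) (inj₁ (Equivalence.from T-∧ a))
    inner (inj₂ c) = Equivalence.from (T-∨ {A}) (inj₂ (Equivalence.from T-∧ c))

Longest-cong : ∀ {k u v} → u ≡ v → Longest k u → Longest k v
Longest-cong {k} = subst (Longest k)

Longest-[] : Longest 0 []
Longest-[] = tt , λ { {suc zero} _ → refl ; {suc (suc x)} (_ , s≤s ()) }

-- Induction along the recursion of `inB`, with m = k+1. In the base cases one part is empty and the
-- other is the whole word; otherwise the first or last entry of the permutation shows which of
-- `down` and `up` splits off. Any reduced word may serve as u.
inB-longest : ∀ k l n u → n ≡ k + l → Letters (suc n) u → Reduced u →
              T (inB (suc k) (suc n) (oneLine (suc n) u)) ⇔ LongestSplit k l u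
inB-longest zero l n u refl lu r = mk⇔
  (λ t → Longest-cong (sym (low-zero 1≤u)) Longest-[] ,
         Longest-cong (sym (high-zero 1≤u)) (r , Equivalence.to (revW⇔ lu) (Equivalence.to (inB-end {1} {l} (inj₁ refl)) t)))
  (λ (_ , b) → Equivalence.from (inB-end {1} {l} (inj₁ refl))
    (Equivalence.from (revW⇔ lu) (proj₂ (Longest-cong (high-zero 1≤u) b))))
  where
  1≤u = All.map proj₁ lu
inB-longest (suc k) zero n u refl lu r rewrite +-identityʳ k = mk⇔
  (λ t → Longest-cong (sym (low-all u≤k)) (r , Equivalence.to (revW⇔ lu) (Equivalence.to (inB-end {m = suc (suc k)} (inj₂ refl)) t)) ,
         Longest-cong (sym (high-none u≤k)) Longest-[])
  (λ (a , _) → Equivalence.from (inB-end {m = suc (suc k)} (inj₂ refl))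
    (Equivalence.from (revW⇔ lu) (proj₂ (Longest-cong (low-all u≤k) a))))
  where
  u≤k = All.map (≤-pred ∘ proj₂) lu
inB-longest (suc k) (suc l) n@(suc n′) u refl lu r = mk⇔ to from
  where
  K L : ℕ
  K = suc k
  L = suc l

  inner : _
  inner = inB-inner {suc K} {n} {oneLine (suc n) u} (s≤s (s≤s z≤n)) (s≤s (s≤s (m<m+n k (s≤s z≤n))))

  stripped-down : pre u (suc K) ≡ 1 → ∃[ v ] Letters n v × u ~ down K ++ map suc v ×
                  oneLine (suc n) u ≡ suc K ∷ map (skip (suc K)) (oneLine n v) ×
                  (T (inB K n (oneLine n v)) ⇔ LongestSplit k L v)
  stripped-down eq with v , p , lv ← strip-down K u lu r (s≤s (m≤m+n k L)) eq =
    v , lv , p , trans (oneLine-resp p) (oneLine-down K lv) ,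
    inB-longest k (suc l) n′ v refl lv (Reduced-map-suc⁻ v (Reduced-++ʳ (down K) (~-Reduced p r)))

  stripped-up : pre u (suc K) ≡ suc n → ∃[ v ] Letters n v × u ~ up K L ++ v ×
                oneLine (suc n) u ≡ map (skip (suc K)) (oneLine n v) ∷ʳ suc K ×
                (T (inB (suc K) n (oneLine n v)) ⇔ LongestSplit K l v)
  stripped-up eq with v , p , lv ← strip-up K L u refl lu r eq =
    v , lv , p , trans (oneLine-resp p) (oneLine-up K L refl lv) ,
    inB-longest (suc k) l n′ v (+-suc k l) lv (Reduced-++ʳ (up K L) (~-Reduced p r))

  fl-stripped : ∀ {v} → Letters n v → fl (map (skip (suc K)) (oneLine n v)) ≡ oneLine n v
  fl-stripped {v} lv = trans (fl-skip (suc K) (oneLine n v)) (fl-oneLine lv)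

  to : T (inB (suc K) (suc n) (oneLine (suc n) u)) → LongestSplit K L u
  to t with Equivalence.to inner t
  ... | inj₁ (h , b)
    with v , lv , p , eq , ih ← stripped-down (act⇒pre-point u (≡ᵇ⇒≡ (act u 1) (suc K) h))
    = LongestSplit-resp (~-sym p) (Equivalence.from (LongestSplit-down (All.map proj₁ lv)) (Equivalence.to ih
        (subst (T ∘ inB K n) (trans (cong (fl ∘ tailW) eq) (fl-stripped lv)) b)))
  ... | inj₂ (h , b)
    with v , lv , p , eq , ih ← stripped-up (act⇒pre-point u (≡ᵇ⇒≡ (act u (suc n)) (suc K)
           (subst (T ∘ isJust (suc K)) (trans (cong ListB.last (trans (cong (map (act u)) (range-∷ʳ n)) (map-++ (act u) (range n) _)))
             (last-∷ʳ (map (act u) (range n)) (act u (suc n)))) h)))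
    = LongestSplit-resp (~-sym p) (Equivalence.from (LongestSplit-up lv) (Equivalence.to ih
        (subst (T ∘ inB (suc K) n) (trans (cong fl (trans (cong init eq) (init-∷ʳ (map (skip (suc K)) (oneLine n v)) (suc K)))) (fl-stripped lv)) b)))

  from : LongestSplit K L u → T (inB (suc K) (suc n) (oneLine (suc n) u))
  from s with LongestSplit-middle (s≤s z≤n) (s≤s z≤n) lu s
  ... | inj₁ eq with v , lv , p , eq′ , ih ← stripped-down eq = Equivalence.from inner (inj₁
    (subst (T ∘ isJust (suc K) ∘ ListB.head) (sym eq′) (≡⇒≡ᵇ (suc K) (suc K) refl) ,
     subst (T ∘ inB K n) (sym (trans (cong (fl ∘ tailW) eq′) (fl-stripped lv)))
       (Equivalence.from ih (Equivalence.to (LongestSplit-down (All.map proj₁ lv)) (LongestSplit-resp p s)))))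
  ... | inj₂ eq with v , lv , p , eq′ , ih ← stripped-up eq = Equivalence.from inner (inj₂
    (subst (T ∘ isJust (suc K)) (sym (trans (cong ListB.last eq′) (last-∷ʳ (map (skip (suc K)) (oneLine n v)) (suc K)))) (≡⇒≡ᵇ (suc K) (suc K) refl) ,
     subst (T ∘ inB (suc K) n) (sym (trans (cong fl (trans (cong init eq′) (init-∷ʳ (map (skip (suc K)) (oneLine n v)) (suc K)))) (fl-stripped lv)))
       (Equivalence.from ih (Equivalence.to (LongestSplit-up lv) (LongestSplit-resp p s)))))

-- Reversal permutations and their products

longestWord : ℕ → Word
longestWord zero    = []
longestWord (suc k) = down (suc k) ++ map suc (longestWord k)

longestWord-Letters : ∀ k → Letters (suc k) (longestWord k)
longestWord-Letters zero    = []
longestWord-Letters (suc k) = AllP.++⁺ (down-Letters (suc k))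
  (AllP.map⁺ (All.map (λ (1≤i , i<) → s≤s z≤n , s≤s i<) (longestWord-Letters k)))
  where
  down-Letters : ∀ k → Letters (suc k) (down k)
  down-Letters zero    = []
  down-Letters (suc k) = (s≤s z≤n , ≤-refl) ∷ All.map (λ (1≤i , i<) → 1≤i , m≤n⇒m≤1+n i<) (down-Letters k)

longestWord-Longest : ∀ k → Longest k (longestWord k)
longestWord-Longest zero    = Longest-[]
longestWord-Longest (suc k) = Longest-down (All.map proj₁ (longestWord-Letters k)) (longestWord-Longest k)

reversal : ℕ → Perm
reversal k = permOf (longestWord-Letters k)

reversal-rank : ∀ k → rank (reversal k) ≡ k
reversal-rank k = permOf-rank (longestWord-Letters k)

reversal-revW : ∀ k → proj₁ (reversal k) ≡ revW (suc k)
reversal-revW k = trans (wordProduct-act (longestWord-Letters k))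
  (Equivalence.from (revW⇔ (longestWord-Letters k)) (proj₂ (longestWord-Longest k)))

toPerm-revW : ∀ k → toPerm (revW (suc k)) ≡ just (reversal k)
toPerm-revW k = subst (λ w → toPerm w ≡ just (reversal k)) (reversal-revW k) (toPerm⁺ (reversal k))

reversal-RedWord : ∀ {k u} → Letters (suc k) u → RedWord (reversal k) u ⇔ Longest k u
reversal-RedWord {k} {u} lu = mk⇔
  (λ (_ , r , e) → r , Equivalence.to (revW⇔ lu) (trans (sym (wordProduct-act lu))
    (trans (cong (λ n → wordProduct n u) (sym size≡)) (trans e (reversal-revW k)))))
  (λ (r , eq) → subst (λ n → Letters n u) (sym size≡) lu , r ,
    trans (cong (λ n → wordProduct n u) size≡) (trans (wordProduct-act lu)
      (trans (Equivalence.from (revW⇔ lu) eq) (sym (reversal-revW k)))))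
  where
  size≡ : size (reversal k) ≡ suc k
  size≡ = trans (size-rank (reversal k)) (cong suc (reversal-rank k))

-- The reduced words of a reversal are the `Longest` words, so a term π is recognized by
-- `LongestSplit` on any of its reduced words, and `inB-longest` compares this with `inB`.
product-reversals : ∀ k l → product (reversal k) (reversal l) ↭ 𝓑 (suc k) (suc (k + l))
product-reversals k l = enum-↭ (λ {π} → to {π}) (λ {π} → from {π}) (enum-product (reversal k) (reversal l))
  (enum-filter (λ π → inB (suc k) (suc (k + l)) (proj₁ π)) (enum-allPerms (suc (k + l))))
  where
  module _ {π} (size≡ : size π ≡ suc (k + l)) {u} (ru : RedWord π u) where
    lu : Letters (suc (k + l)) u
    lu = subst (λ n → Letters n u) size≡ (proj₁ ru)

    lh : Letters (suc l) (high k u)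
    lh = subst (λ n → Letters n (high k u)) (trans (cong (_∸ k) (sym (+-suc k l))) (m+n∸m≡n k (suc l))) (Letters-high k lu)

    line : proj₁ π ≡ oneLine (suc (k + l)) u
    line = trans (sym (proj₂ (proj₂ ru))) (trans (cong (λ n → wordProduct n u) size≡) (wordProduct-act lu))

    equiv : T (inB (suc k) (suc (k + l)) (proj₁ π)) ⇔ LongestSplit k l u
    equiv rewrite line = inB-longest k l (k + l) u refl lu (proj₁ (proj₂ ru))

  to : ∀ {π} → Split (reversal k) (reversal l) π → size π ≡ suc (k + l) × T (inB (suc k) (suc (k + l)) (proj₁ π))
  to {π} (r , u , ru , rl , rh) rewrite reversal-rank k | reversal-rank l =
    size≡ , Equivalence.from (equiv {π} size≡ ru)
      (Equivalence.to (reversal-RedWord (Letters-low k (lu {π} size≡ ru))) rl , Equivalence.to (reversal-RedWord (lh {π} size≡ ru)) rh)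
    where
    size≡ : size π ≡ suc (k + l)
    size≡ = trans (size-rank π) (cong suc r)

  from : ∀ {π} → size π ≡ suc (k + l) × T (inB (suc k) (suc (k + l)) (proj₁ π)) → Split (reversal k) (reversal l) π
  from {π} (size≡ , t) with u , ru , _ ← perm-word π rewrite reversal-rank k | reversal-rank l =
    cong (_∸ 1) size≡ , u , ru ,
    Equivalence.from (reversal-RedWord (Letters-low k (lu {π} size≡ ru))) (proj₁ s) , Equivalence.from (reversal-RedWord (lh {π} size≡ ru)) (proj₂ s)
    where
    s = Equivalence.to (equiv {π} size≡ ru) t

-- Identity permutations, unit and counit

identity-RedWord : ∀ {σ} → ℓ σ ≡ 0 → RedWord σ []
identity-RedWord {σ} eq with redWord σ | redWord-RedWord σ
... | []    | r = r
... | i ∷ u | r = contradiction (trans (sym (RedWord-length {σ} r)) eq) λ ()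

identityPerm : ℕ → Perm
identityPerm n = permOf {n} {[]} []

identityPerm-RedWord : ∀ n → RedWord (identityPerm n) []
identityPerm-RedWord n = permOf-RedWord {n} {[]} [] tt

ℓ-identityPerm : ∀ n → ℓ (identityPerm n) ≡ 0
ℓ-identityPerm n = RedWord-length {identityPerm n} (identityPerm-RedWord n)

abstract
  -- Length and not rank is tested: the counit must be 1 on the identity of every S_n, as each
  -- occurs as a left and as a right factor in the coproduct.
  isIdentity : Perm → Bool
  isIdentity σ = ℓ σ ≡ᵇ 0

  isIdentity⁻ : ∀ {σ} → T (isIdentity σ) → ℓ σ ≡ 0
  isIdentity⁻ {σ} = ≡ᵇ⇒≡ (ℓ σ) 0

  isIdentity⁺ : ∀ {σ} → ℓ σ ≡ 0 → T (isIdentity σ)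
  isIdentity⁺ {σ} = ≡⇒≡ᵇ (ℓ σ) 0

-- An identity has only the empty reduced word, which spells one permutation for each rank. The
-- count 1 will be the counit of the product.
product-identities : ∀ {σ τ} → ℓ σ ≡ 0 → ℓ τ ≡ 0 → length (filterᵇ isIdentity (product σ τ)) ≡ 1
product-identities {σ} {τ} eqσ eqτ = ↭-length (enum-↭
  (λ {π} ((r , _) , t) → RedWord-rank-unique {π} {identityPerm n} (trans r (sym (permOf-rank {n} {[]} [])))
    (identity-RedWord {π} (isIdentity⁻ {π} t)) (identityPerm-RedWord n))
  (λ { refl → (permOf-rank {n} {[]} [] , [] , identityPerm-RedWord n , identity-RedWord {σ} eqσ , identity-RedWord {τ} eqτ) ,
              isIdentity⁺ {identityPerm n} (ℓ-identityPerm n) })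
  (enum-filter isIdentity (enum-product σ τ)) (enum-singleton (identityPerm n)))
  where
  n = rank σ + rank τ

product-nonidentities : ∀ {σ τ} → ¬ (ℓ σ + ℓ τ ≡ 0) → length (filterᵇ isIdentity (product σ τ)) ≡ 0
product-nonidentities {σ} {τ} ≢0 = ↭-length (enum-↭
  (λ {π} (s , t) → ≢0 (trans (sym (Split-length {σ} {τ} {π} s)) (isIdentity⁻ {π} t))) ⊥-elim
  (enum-filter isIdentity (enum-product σ τ))
  record { unique = [] ; sound = λ () ; complete = λ () })

-- Having rank 0, as left factor it puts the cut below all letters, as right factor above them.
unit₁ : Perm
unit₁ = 1 ∷ [] , tt

unit₁-RedWord : RedWord unit₁ []
unit₁-RedWord = [] , tt , refl

unit-splitˡ : ∀ {σ π} → ∃[ ρ ] ρ ≡ unit₁ × (∃[ τ ] τ ≡ σ × Split ρ τ π) → π ≡ σ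
unit-splitˡ {σ} {π} (_ , refl , _ , refl , (r , u , ru , _ , rσ)) =
  RedWord-rank-unique {π} {σ} r ru (subst (RedWord σ) (high-zero (RedWord-1≤ {π} ru)) rσ)

unit-splitˡ⁻ : ∀ {σ π} → π ≡ σ → ∃[ ρ ] ρ ≡ unit₁ × (∃[ τ ] τ ≡ σ × Split ρ τ π)
unit-splitˡ⁻ {σ} refl with u , ru , _ ← perm-word σ =
  unit₁ , refl , σ , refl , refl , u , ru ,
  subst (RedWord unit₁) (sym (low-zero (RedWord-1≤ {σ} ru))) unit₁-RedWord ,
  subst (RedWord σ) (sym (high-zero (RedWord-1≤ {σ} ru))) ru

unit-splitʳ : ∀ {σ π} → ∃[ ρ ] ρ ≡ σ × (∃[ τ ] τ ≡ unit₁ × Split ρ τ π) → π ≡ σ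
unit-splitʳ {σ} {π} (_ , refl , _ , refl , (r , u , ru , rσ , _)) =
  RedWord-rank-unique {π} {σ} r′ ru
    (subst (RedWord σ) (low-all (subst (λ k → All (_≤ k) u) r′ (RedWord-≤rank {π} ru))) rσ)
  where
  r′ : rank π ≡ rank σ
  r′ = trans r (+-identityʳ _)

unit-splitʳ⁻ : ∀ {σ π} → π ≡ σ → ∃[ ρ ] ρ ≡ σ × (∃[ τ ] τ ≡ unit₁ × Split ρ τ π)
unit-splitʳ⁻ {σ} refl with u , ru , _ ← perm-word σ =
  σ , refl , unit₁ , refl , sym (+-identityʳ _) , u , ru ,
  subst (RedWord σ) (sym (low-all (RedWord-≤rank {σ} ru))) ru ,
  subst (RedWord unit₁) (sym (high-none (RedWord-≤rank {σ} ru))) unit₁-RedWord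

counit-factorˡ : ∀ {π υ} → ∃[ στ ] (Factors π (proj₁ στ) (proj₂ στ) × T (isIdentity (proj₁ στ))) × υ ≡ proj₂ στ → υ ≡ π
counit-factorˡ {π} ((σ , τ) , (f@(_ , r , _ , v , _ , rv , _) , t) , refl) = RedWord-rank-unique {τ} {π} r rv
  (Factors-any {π} {σ} {τ} f (identity-RedWord {σ} (isIdentity⁻ {σ} t)) rv)

counit-factorˡ⁻ : ∀ {π υ} → υ ≡ π → ∃[ στ ] (Factors π (proj₁ στ) (proj₂ στ) × T (isIdentity (proj₁ στ))) × υ ≡ proj₂ στ
counit-factorˡ⁻ {π} refl with u , ru , _ ← perm-word π =
  (e , π) , ((permOf-rank {rank π} {[]} [] , refl , [] , u , identityPerm-RedWord (rank π) , ru , ru) ,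
             isIdentity⁺ {e} (ℓ-identityPerm (rank π))) , refl
  where
  e = identityPerm (rank π)

counit-factorʳ : ∀ {π υ} → ∃[ στ ] (Factors π (proj₁ στ) (proj₂ στ) × T (isIdentity (proj₂ στ))) × υ ≡ proj₁ στ → υ ≡ π
counit-factorʳ {π} ((σ , τ) , (f@(r , _ , u , _ , ru , _) , t) , refl) = RedWord-rank-unique {σ} {π} r ru
  (subst (RedWord π) (++-identityʳ u) (Factors-any {π} {σ} {τ} f ru (identity-RedWord {τ} (isIdentity⁻ {τ} t))))

counit-factorʳ⁻ : ∀ {π υ} → υ ≡ π → ∃[ στ ] (Factors π (proj₁ στ) (proj₂ στ) × T (isIdentity (proj₂ στ))) × υ ≡ proj₁ στ
counit-factorʳ⁻ {π} refl with u , ru , _ ← perm-word π =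
  (π , e) , ((refl , permOf-rank {rank π} {[]} [] , u , [] , ru , identityPerm-RedWord (rank π) ,
              subst (RedWord π) (sym (++-identityʳ u)) ru) ,
             isIdentity⁺ {e} (ℓ-identityPerm (rank π))) , refl
  where
  e = identityPerm (rank π)

identities-unique : ∀ {σ τ} → rank σ ≡ rank τ → T (isIdentity σ) → T (isIdentity τ) → σ ≡ τ
identities-unique {σ} {τ} eq tσ tτ =
  RedWord-rank-unique {σ} {τ} eq (identity-RedWord {σ} (isIdentity⁻ {σ} tσ)) (identity-RedWord {τ} (isIdentity⁻ {τ} tτ))

unit-factors : ∀ {σ τ} → Factors unit₁ σ τ → σ ≡ unit₁ × τ ≡ unit₁
unit-factors {σ} {τ} (rσ , rτ , u , v , ru , rv , _) =
  trivial {σ} rσ ru , trivial {τ} rτ rv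
  where
  trivial : ∀ {ρ w} → rank ρ ≡ 0 → RedWord ρ w → ρ ≡ unit₁
  trivial {ρ} {[]}    eq r = RedWord-rank-unique {ρ} {unit₁} eq r unit₁-RedWord
  trivial {ρ} {i ∷ w} eq r with (1≤i , i<1) ∷ _ ← subst (λ n → Letters (suc n) (i ∷ w)) eq (RedWord-Letters {ρ} r) =
    contradiction (≤-trans i<1 1≤i) 1+n≰n

-- The bialgebra: all structure constants are 0 or 1, so elements are given by lists of basis vectors.

module Construction {c ℓ′} (F : Field c ℓ′) where
  private module K = Field F

  ι : {X : Set} → List X → List (K.Carrier × X)
  ι = map (K.1# ,_)

  infix 4 _≅_
  infixr 5 _∷_

  -- The operations leave coefficients such as 1 * 1. This relation normalizes them with the basis
  -- vectors kept in order, before any rearrangement.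
  data _≅_ {X : Set} : List (K.Carrier × X) → List (K.Carrier × X) → Set (c Level.⊔ ℓ′) where
    []  : [] ≅ []
    _∷_ : ∀ {a b x xs ys} → a K.≈ b → xs ≅ ys → (a , x) ∷ xs ≅ (b , x) ∷ ys

  ≅-refl : ∀ {X} {xs : List (K.Carrier × X)} → xs ≅ xs
  ≅-refl {xs = []}     = []
  ≅-refl {xs = _ ∷ _} = K.refl ∷ ≅-refl

  ≅-trans : ∀ {X} {xs ys zs : List (K.Carrier × X)} → xs ≅ ys → ys ≅ zs → xs ≅ zs
  ≅-trans []       []       = []
  ≅-trans (p ∷ ps) (q ∷ qs) = K.trans p q ∷ ≅-trans ps qs

  ≅-++ : ∀ {X} {xs xs′ ys ys′ : List (K.Carrier × X)} → xs ≅ xs′ → ys ≅ ys′ → xs ++ ys ≅ xs′ ++ ys′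
  ≅-++ []       q = q
  ≅-++ (p ∷ ps) q = p ∷ ≅-++ ps q

  ι-++ : ∀ {X} (xs ys : List X) → ι xs ++ ι ys ≅ ι (xs ++ ys)
  ι-++ []       ys = ≅-refl
  ι-++ (x ∷ xs) ys = K.refl ∷ ι-++ xs ys

  concatMap-ι : ∀ {X Y} (f : K.Carrier × X → List (K.Carrier × Y)) (g : X → List Y) →
                (∀ x → f (K.1# , x) ≅ ι (g x)) → ∀ xs → concatMap f (ι xs) ≅ ι (concatMap g xs)
  concatMap-ι f g eq []       = []
  concatMap-ι f g eq (x ∷ xs) = ≅-trans (≅-++ (eq x) (concatMap-ι f g eq xs)) (ι-++ (g x) (concatMap g xs))

  map-ι : ∀ {X Y} (f : K.Carrier × X → K.Carrier × Y) (g : X → Y) →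
          (∀ x → proj₁ (f (K.1# , x)) K.≈ K.1#) → (∀ x → proj₂ (f (K.1# , x)) ≡ g x) →
          ∀ xs → map f (ι xs) ≅ ι (map g xs)
  map-ι f g eq₁ eq₂ []       = []
  map-ι f g eq₁ eq₂ (x ∷ xs) with f (K.1# , x) | eq₁ x | eq₂ x
  ... | a , y | p | refl = p ∷ map-ι f g eq₁ eq₂ xs

  map-ι-id : ∀ {X} (f : K.Carrier × X → K.Carrier × X) →
             (∀ x → proj₁ (f (K.1# , x)) K.≈ K.1#) → (∀ x → proj₂ (f (K.1# , x)) ≡ x) →
             ∀ xs → map f (ι xs) ≅ ι xs
  map-ι-id f eq₁ eq₂ xs = subst (λ ys → map f (ι xs) ≅ ι ys) (map-id xs) (map-ι f id eq₁ eq₂ xs)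

  sum-↭ : ∀ {a} {X : Set a} (f : X → K.Carrier) {xs ys} → xs ↭ ys → sumK F (map f xs) K.≈ sumK F (map f ys)
  sum-↭ f Perm.refl          = K.refl
  sum-↭ f (Perm.prep x p)    = K.+-cong K.refl (sum-↭ f p)
  sum-↭ f (Perm.swap x y p)  = K.trans (K.sym (K.+-assoc _ _ _))
    (K.trans (K.+-cong (K.+-comm _ _) (sum-↭ f p)) (K.+-assoc _ _ _))
  sum-↭ f (Perm.trans p q)   = K.trans (sum-↭ f p) (sum-↭ f q)

  -- The common shape of `coeff`, `coeff₂` and `coeff₃`, with the comparison of indices as a Boolean
  -- test.
  coefficient : {X : Set} → (X → Bool) → List (K.Carrier × X) → K.Carrier
  coefficient t xs = sumK F (map (λ (a , x) → if t x then a else K.0#) xs)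

  coefficient-≅ : ∀ {X} (t : X → Bool) {xs ys} → xs ≅ ys → coefficient t xs K.≈ coefficient t ys
  coefficient-≅ t []                = K.refl
  coefficient-≅ t (_∷_ {x = x} p ps) with t x
  ... | true  = K.+-cong p (coefficient-≅ t ps)
  ... | false = K.+-cong K.refl (coefficient-≅ t ps)

  -- Once both sums have been brought to coefficients 1, only the order of their terms differs.
  coefficient-↭ : ∀ {X} (t : X → Bool) {xs ys : List X} {x y} → x ≅ ι xs → y ≅ ι ys → xs ↭ ys →
                  coefficient t x K.≈ coefficient t y
  coefficient-↭ t p q r = K.trans (coefficient-≅ t p) (K.trans (sum-↭ _ (map⁺ (K.1# ,_) r)) (K.sym (coefficient-≅ t q)))

  coefficient-∉ : ∀ {X} (t : X → Bool) (xs : List X) → (∀ {x} → x ∈ xs → ¬ T (t x)) → coefficient t (ι xs) K.≈ K.0#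
  coefficient-∉ t []       _ = K.refl
  coefficient-∉ t (x ∷ xs) n with t x | n {x} (here refl)
  ... | true  | ¬t = contradiction tt ¬t
  ... | false | _  = K.trans (K.+-identityˡ _) (coefficient-∉ t xs (n ∘ there))

  indicator : Bool → K.Carrier
  indicator b = if b then K.1# else K.0#

  -- A counit sum contains terms with coefficient 0, so it is not of the form `ι`; filtering drops
  -- these terms.
  coefficient-filter : ∀ {X Y : Set} (t : Y → Bool) (q : X → Bool) (h : X → Y) xs →
    coefficient t (map (λ x → K.1# K.* indicator (q x) , h x) xs) K.≈ coefficient t (ι (map h (filterᵇ q xs)))
  coefficient-filter t q h []       = K.refl
  coefficient-filter t q h (x ∷ xs) with q x
  ... | false = K.trans (K.+-cong (zero-term (t (h x))) (coefficient-filter t q h xs)) (K.+-identityˡ _)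
    where
    zero-term : ∀ b → (if b then K.1# K.* K.0# else K.0#) K.≈ K.0#
    zero-term true  = K.zeroʳ _
    zero-term false = K.refl
  ... | true with t (h x)
  ...   | true  = K.+-cong (K.*-identityˡ _) (coefficient-filter t q h xs)
  ...   | false = K.+-cong K.refl (coefficient-filter t q h xs)

  mulΠ : Perm → Perm → V F
  mulΠ σ τ = ι (product σ τ)

  unitΠ : V F
  unitΠ = ι (unit₁ ∷ [])

  ΔΠ : Perm → V⊗V F
  ΔΠ π = ι (LAfactorizations π)

  εΠ : Perm → K.Carrier
  εΠ π = indicator (isIdentity π)

  1*1 : K.1# K.* K.1# K.≈ K.1#
  1*1 = K.*-identityˡ _

  mulL-ι : ∀ xs ys → mulL F mulΠ (ι xs) (ι ys) ≅ ι (concatMap (λ σ → concatMap (product σ) ys) xs)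
  mulL-ι xs ys = concatMap-ι _ _ (λ σ → concatMap-ι _ _ (λ τ →
    map-ι-id _ (λ _ → K.trans (K.*-cong 1*1 K.refl) 1*1) (λ _ → refl) (product σ τ)) ys) xs

  ⊗-ι : ∀ xs ys → _⊗_ F (ι xs) (ι ys) ≅ ι (cartesianProduct xs ys)
  ⊗-ι []       ys = []
  ⊗-ι (x ∷ xs) ys = ≅-trans
    (≅-++ (map-ι _ (x ,_) (λ _ → 1*1) (λ _ → refl) ys) (⊗-ι xs ys)) (ι-++ (map (x ,_) ys) _)

  mulL₂-ι : ∀ xs ys → mulL₂ F mulΠ (ι xs) (ι ys) ≅
    ι (concatMap (λ (σ′ , σ″) → concatMap (λ (τ′ , τ″) → cartesianProduct (product σ′ τ′) (product σ″ τ″)) ys) xs)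
  mulL₂-ι xs ys = concatMap-ι (λ p → concatMap (factor p) (ι ys)) _
    (λ (σ′ , σ″) → concatMap-ι (factor (K.1# , σ′ , σ″)) _ (λ (τ′ , τ″) →
      ≅-trans (scale₂-cong (⊗-ι (product σ′ τ′) (product σ″ τ″)))
        (map-ι-id _ (λ _ → K.trans (K.*-cong 1*1 K.refl) 1*1) (λ _ → refl) _)) ys) xs
    where
    factor : K.Carrier × Perm × Perm → K.Carrier × Perm × Perm → V⊗V F
    factor (a , σ′ , σ″) (b , τ′ , τ″) = scale₂ F (a K.* b) (_⊗_ F (mulΠ σ′ τ′) (mulΠ σ″ τ″))

    scale₂-cong : ∀ {a x y} → x ≅ y → scale₂ F a x ≅ scale₂ F a y
    scale₂-cong []       = []
    scale₂-cong (p ∷ ps) = K.*-cong K.refl p ∷ scale₂-cong ps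

  linL₂-ι : ∀ xs → linL₂ F ΔΠ (ι xs) ≅ ι (concatMap LAfactorizations xs)
  linL₂-ι xs = concatMap-ι _ _ (λ π → map-ι-id _ (λ _ → 1*1) (λ _ → refl) (LAfactorizations π)) xs

  linK-indicator : ∀ xs → linK F εΠ (ι xs) K.≈ fromℕ F (length (filterᵇ isIdentity xs))
  linK-indicator []       = K.refl
  linK-indicator (x ∷ xs) with isIdentity x
  ... | true  = K.+-cong 1*1 (linK-indicator xs)
  ... | false = K.trans (K.+-cong (K.zeroʳ _) (linK-indicator xs)) (K.+-identityˡ _)

  Δ⊗id-ι : ∀ π → Δ⊗id F ΔΠ π ≅ ι (concatMap (λ (ρ , υ) → map (λ (σ , τ) → σ , τ , υ) (LAfactorizations ρ)) (LAfactorizations π))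
  Δ⊗id-ι π = concatMap-ι _ _ (λ (ρ , υ) → map-ι _ _ (λ _ → 1*1) (λ _ → refl) (LAfactorizations ρ)) (LAfactorizations π)

  id⊗Δ-ι : ∀ π → id⊗Δ F ΔΠ π ≅ ι (concatMap (λ (σ , ρ) → map (λ (τ , υ) → σ , τ , υ) (LAfactorizations ρ)) (LAfactorizations π))
  id⊗Δ-ι π = concatMap-ι _ _ (λ (σ , ρ) → map-ι _ _ (λ _ → 1*1) (λ _ → refl) (LAfactorizations ρ)) (LAfactorizations π)

  assoc-↭ : ∀ σ τ υ → concatMap (λ ρ → concatMap (product ρ) (υ ∷ [])) (product σ τ) ↭
                      concatMap (λ ρ → concatMap (product ρ) (product τ υ)) (σ ∷ [])
  assoc-↭ σ τ υ = enum-↭ (λ {π} → to {π}) (λ {π} → from {π})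
    (enum-productOf (enum-product σ τ) (enum-singleton υ) λ (r , _) (r′ , _) → trans r (sym r′))
    (enum-productOf (enum-singleton σ) (enum-product τ υ) λ { refl refl → refl })
    where
    Left Right : Perm → Set
    Left π  = ∃[ ρ ] Split σ τ ρ × ∃[ κ ] κ ≡ υ × Split ρ κ π
    Right π = ∃[ κ ] κ ≡ σ × ∃[ ρ ] Split τ υ ρ × Split κ ρ π

    to : ∀ {π} → Left π → Right π
    to {π} (ρ , s , κ , eq , s′) = σ , refl ,
      split₃ʳ⁻ {σ} {τ} {υ} {π} (split₃ˡ {σ} {τ} {υ} {π} (ρ , s , subst (λ κ → Split ρ κ π) eq s′))

    from : ∀ {π} → Right π → Left π
    from {π} (κ , eq , ρ , s , s′) = regroup
      (split₃ˡ⁻ {σ} {τ} {υ} {π} (split₃ʳ {σ} {τ} {υ} {π} (ρ , s , subst (λ κ → Split κ ρ π) eq s′)))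
      where
      regroup : ∃[ ρ ] Split σ τ ρ × Split ρ υ π → Left π
      regroup (ρ , t , t′) = ρ , t , υ , refl , t′

  coassoc-↭ : ∀ π → concatMap (λ (ρ , υ) → map (λ (σ , τ) → σ , τ , υ) (LAfactorizations ρ)) (LAfactorizations π) ↭
                    concatMap (λ (σ , ρ) → map (λ (τ , υ) → σ , τ , υ) (LAfactorizations ρ)) (LAfactorizations π)
  coassoc-↭ π = enum-↭
    (λ { ((ρ , υ) , f , (σ , τ) , f′ , refl) →
         let (ρ′ , g , g′) = factors₃ʳ⁻ {π} {σ} {τ} {υ} (factors₃ˡ {π} {σ} {τ} {υ} (ρ , f , f′)) in (σ , ρ′) , g , (τ , υ) , g′ , refl })
    (λ { ((σ , ρ) , f , (τ , υ) , f′ , refl) →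
         let (ρ′ , g , g′) = factors₃ˡ⁻ {π} {σ} {τ} {υ} (factors₃ʳ {π} {σ} {τ} {υ} (ρ , f , f′)) in (ρ′ , υ) , g , (σ , τ) , g′ , refl })
    (enum-concatMap (enum-LAfactorizations π)
      (λ {(ρ , υ)} _ → enum-map (enum-LAfactorizations ρ) λ { _ _ refl → refl })
      λ { {ρ , _} {ρ′ , _} _ _ ((σ , τ) , f , refl) (_ , f′ , refl) → cong (_, _) (Factors-unique {ρ} {ρ′} {σ} {τ} f f′) })
    (enum-concatMap (enum-LAfactorizations π)
      (λ {(σ , ρ)} _ → enum-map (enum-LAfactorizations ρ) λ { _ _ refl → refl })
      λ { {_ , ρ} {_ , ρ′} _ _ ((τ , υ) , f , refl) (_ , f′ , refl) → cong (_ ,_) (Factors-unique {ρ} {ρ′} {τ} {υ} f f′) })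

  Δ-mul-↭ : ∀ σ τ → concatMap LAfactorizations (product σ τ) ↭
    concatMap (λ (σ′ , σ″) → concatMap (λ (τ′ , τ″) → cartesianProduct (product σ′ τ′) (product σ″ τ″))
      (LAfactorizations τ)) (LAfactorizations σ)
  Δ-mul-↭ σ τ = enum-↭
    (λ {(π′ , π″)} → split-factors {σ} {τ} {π′} {π″})
    (λ {(π′ , π″)} → factors-split {σ} {τ} {π′} {π″})
    (enum-concatMap (enum-product σ τ) (λ {π} _ → enum-LAfactorizations π)
      λ {π} {π′} {(ρ , υ)} _ _ f f′ → Factors-unique {π} {π′} {ρ} {υ} f f′)
    (enum-concatMap (enum-LAfactorizations σ)
      (λ {(σ′ , σ″)} _ → enum-concatMap (enum-LAfactorizations τ)
        (λ {(τ′ , τ″)} _ → enum-cartesianProduct (enum-product σ′ τ′) (enum-product σ″ τ″))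
        λ {(τ′ , τ″)} {(τ‴ , τ⁗)} {(π′ , π″)} _ _ (s , t) (s′ , t′) →
          cong₂ _,_ (proj₂ (Split-unique {σ′} {σ′} {τ′} {τ‴} {π′} refl s s′))
                    (proj₂ (Split-unique {σ″} {σ″} {τ″} {τ⁗} {π″} refl t t′)))
      λ {(σ′ , σ″)} {(σ‴ , σ⁗)} {(π′ , π″)} (r , r′ , _) (r″ , r‴ , _) ((τ′ , τ″) , _ , s , t) ((τ‴ , τ⁗) , _ , s′ , t′) →
          cong₂ _,_ (proj₁ (Split-unique {σ′} {σ‴} {τ′} {τ‴} {π′} (trans r (sym r″)) s s′))
                    (proj₁ (Split-unique {σ″} {σ⁗} {τ″} {τ⁗} {π″} (trans r′ (sym r‴)) t t′)))

  Δ-unit-↭ : concatMap LAfactorizations (unit₁ ∷ []) ↭ cartesianProduct (unit₁ ∷ []) (unit₁ ∷ [])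
  Δ-unit-↭ = enum-↭
    (λ { {σ , τ} (_ , refl , f) → unit-factors {σ} {τ} f })
    (λ { (refl , refl) → unit₁ , refl , refl , refl , [] , [] , unit₁-RedWord , unit₁-RedWord , unit₁-RedWord })
    (enum-concatMap (enum-singleton unit₁) (λ {π} _ → enum-LAfactorizations π) λ { refl refl _ _ → refl })
    (enum-cartesianProduct (enum-singleton unit₁) (enum-singleton unit₁))

  ε-mulΠ : ∀ σ τ → linK F εΠ (mulΠ σ τ) K.≈ εΠ σ K.* εΠ τ
  ε-mulΠ σ τ = K.trans (linK-indicator (product σ τ)) (cases (isIdentity σ) (isIdentity τ) refl refl)
    where
    cases : ∀ p q → isIdentity σ ≡ p → isIdentity τ ≡ q →
            fromℕ F (length (filterᵇ isIdentity (product σ τ))) K.≈ indicator p K.* indicator q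
    cases true true eqσ eqτ = K.trans (K.reflexive (cong (fromℕ F) (product-identities {σ} {τ}
      (isIdentity⁻ {σ} (Equivalence.from (T-≡ {isIdentity σ}) eqσ)) (isIdentity⁻ {τ} (Equivalence.from (T-≡ {isIdentity τ}) eqτ)))))
      (K.trans (K.+-identityʳ _) (K.sym 1*1))
    cases false q eqσ eqτ = K.trans (K.reflexive (cong (fromℕ F) (product-nonidentities {σ} {τ}
      λ eq → subst T eqσ (isIdentity⁺ {σ} (m+n≡0⇒m≡0 (ℓ σ) eq))))) (K.sym (K.zeroˡ _))
    cases true false eqσ eqτ = K.trans (K.reflexive (cong (fromℕ F) (product-nonidentities {σ} {τ}
      λ eq → subst T eqτ (isIdentity⁺ {τ} (m+n≡0⇒n≡0 (ℓ σ) eq))))) (K.sym (K.zeroʳ _))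

  isPerm₁ : Perm → Perm → Bool
  isPerm₁ π σ = proj₁ σ == proj₁ π

  isPerm₂ : Perm → Perm → Perm × Perm → Bool
  isPerm₂ π ρ (σ , τ) = (proj₁ σ == proj₁ π) ∧ (proj₁ τ == proj₁ ρ)

  isPerm₃ : Perm → Perm → Perm → Perm × Perm × Perm → Bool
  isPerm₃ π ρ κ (σ , τ , υ) = (proj₁ σ == proj₁ π) ∧ (proj₁ τ == proj₁ ρ) ∧ (proj₁ υ == proj₁ κ)

  isPerm₁⁻ : ∀ {π σ} → T (isPerm₁ π σ) → σ ≡ π
  isPerm₁⁻ {π} {σ} t = perm-≡ (==⇒≡ (proj₁ σ) (proj₁ π) t)

  B : GradedBialgebraΠ F
  B = record
    { mul     = mulΠ
    ; unit    = unitΠ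
    ; Δ       = ΔΠ
    ; ε       = εΠ
    ; assoc   = λ σ τ υ π → coefficient-↭ (isPerm₁ π)
        (mulL-ι (product σ τ) (υ ∷ [])) (mulL-ι (σ ∷ []) (product τ υ)) (assoc-↭ σ τ υ)
    ; unitˡ   = λ σ π → coefficient-↭ (isPerm₁ π) (mulL-ι (unit₁ ∷ []) (σ ∷ [])) (≅-refl {xs = ι (σ ∷ [])})
        (enum-↭ (λ {ρ} → unit-splitˡ {σ} {ρ}) (λ {ρ} → unit-splitˡ⁻ {σ} {ρ})
          (enum-productOf (enum-singleton unit₁) (enum-singleton σ) λ { refl refl → refl }) (enum-singleton σ))
    ; unitʳ   = λ σ π → coefficient-↭ (isPerm₁ π) (mulL-ι (σ ∷ []) (unit₁ ∷ [])) (≅-refl {xs = ι (σ ∷ [])})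
        (enum-↭ (λ {ρ} → unit-splitʳ {σ} {ρ}) (λ {ρ} → unit-splitʳ⁻ {σ} {ρ})
          (enum-productOf (enum-singleton σ) (enum-singleton unit₁) λ { refl refl → refl }) (enum-singleton σ))
    ; coassoc = λ π ρ κ υ → coefficient-↭ (isPerm₃ ρ κ υ) (Δ⊗id-ι π) (id⊗Δ-ι π) (coassoc-↭ π)
    ; counitˡ = λ π ρ → K.trans (counit (isPerm₁ ρ) proj₁ proj₂ π)
        (coefficient-↭ (isPerm₁ ρ) ≅-refl (≅-refl {xs = ι (π ∷ [])})
          (enum-↭ (λ {υ} → counit-factorˡ {π} {υ}) (λ {υ} → counit-factorˡ⁻ {π} {υ})
            (enum-map (enum-filter (isIdentity ∘ proj₁) (enum-LAfactorizations π))
              λ { {σ , _} {σ′ , _} ((r , _) , t) ((r′ , _) , t′) refl →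
                  cong (_, _) (identities-unique {σ} {σ′} (trans r (sym r′)) t t′) })
            (enum-singleton π)))
    ; counitʳ = λ π ρ → K.trans (counit (isPerm₁ ρ) proj₂ proj₁ π)
        (coefficient-↭ (isPerm₁ ρ) ≅-refl (≅-refl {xs = ι (π ∷ [])})
          (enum-↭ (λ {υ} → counit-factorʳ {π} {υ}) (λ {υ} → counit-factorʳ⁻ {π} {υ})
            (enum-map (enum-filter (isIdentity ∘ proj₂) (enum-LAfactorizations π))
              λ { {_ , τ} {_ , τ′} ((_ , r , _) , t) ((_ , r′ , _) , t′) refl →
                  cong (_ ,_) (identities-unique {τ} {τ′} (trans r (sym r′)) t t′) })
            (enum-singleton π)))
    ; Δ-mul   = λ σ τ π ρ → coefficient-↭ (isPerm₂ π ρ) (linL₂-ι (product σ τ))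
        (mulL₂-ι (LAfactorizations σ) (LAfactorizations τ)) (Δ-mul-↭ σ τ)
    ; Δ-unit  = λ π ρ → coefficient-↭ (isPerm₂ π ρ) (linL₂-ι (unit₁ ∷ [])) (⊗-ι (unit₁ ∷ []) (unit₁ ∷ [])) Δ-unit-↭
    ; ε-mul   = ε-mulΠ
    ; ε-unit  = K.trans (K.+-identityʳ _) (K.trans (K.*-identityˡ _) (K.reflexive
        (cong indicator (Equivalence.to (T-≡ {isIdentity unit₁}) (isIdentity⁺ {unit₁} refl)))))
    ; mul-graded  = λ σ τ π ≢ → coefficient-∉ (isPerm₁ π) (product σ τ) λ {ρ} ρ∈ t →
        ≢ (subst (λ ρ → ℓ ρ ≡ ℓ σ + ℓ τ) (isPerm₁⁻ {π} {ρ} t)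
             (Split-length {σ} {τ} {ρ} (sound (enum-product σ τ) ρ∈)))
    ; unit-graded = λ π ≢ → coefficient-∉ (isPerm₁ π) (unit₁ ∷ []) λ { (here refl) t →
        ≢ (subst (λ ρ → ℓ ρ ≡ 0) (isPerm₁⁻ {π} {unit₁} t) refl) }
    ; Δ-graded    = λ π σ τ ≢ → coefficient-∉ (isPerm₂ σ τ) (LAfactorizations π) λ {(σ′ , τ′)} ∈LA t →
        let tσ , tτ = Equivalence.to (T-∧ {proj₁ σ′ == proj₁ σ}) t in
        ≢ (trans (Factors-length {π} {σ′} {τ′} (sound (enum-LAfactorizations π) ∈LA))
             (cong₂ (λ ρ ρ′ → ℓ ρ + ℓ ρ′) (isPerm₁⁻ {σ} {σ′} tσ) (isPerm₁⁻ {τ} {τ′} tτ)))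
    ; ε-graded    = λ π ≢ → ε-zero π ≢
    }
    where
    counit : ∀ t (f g : Perm × Perm → Perm) π →
      coefficient t (map (λ (a , p) → a K.* εΠ (f p) , g p) (ΔΠ π)) K.≈
      coefficient t (ι (map g (filterᵇ (isIdentity ∘ f) (LAfactorizations π))))
    counit t f g π = K.trans (K.reflexive (cong (coefficient t) (sym (map-∘ (LAfactorizations π)))))
      (coefficient-filter t (isIdentity ∘ f) g (LAfactorizations π))

    ε-zero : ∀ π → ¬ (ℓ π ≡ 0) → εΠ π K.≈ K.0#
    ε-zero π ≢ with isIdentity π in eq
    ... | true  = contradiction (isIdentity⁻ {π} (Equivalence.from (T-≡ {isIdentity π}) eq)) ≢
    ... | false = K.refl

-- Counting shuffles of reduced words

shuffles : Word → Word → List Word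
shuffles []      v       = v ∷ []
shuffles (i ∷ u) []      = (i ∷ u) ∷ []
shuffles (i ∷ u) (j ∷ v) = map (i ∷_) (shuffles u (j ∷ v)) ++ map (j ∷_) (shuffles (i ∷ u) v)

private
  -- Pascal's rule with the denominators multiplied out, so that the count stays in ℕ.
  factorial-step : ∀ a b x y → x * (a ! * suc b !) ≡ (a + suc b) ! → y * (suc a ! * b !) ≡ (suc a + b) ! →
                   (x + y) * (suc a ! * suc b !) ≡ (suc a + suc b) !
  factorial-step a b x y p q = begin
    (x + y) * (suc a ! * suc b !)                                       ≡⟨ regroup (suc a) (suc b) x y (a !) (b !) ⟩
    suc a * (x * (a ! * suc b !)) + suc b * (y * (suc a ! * b !))       ≡⟨ cong₂ (λ m n → suc a * m + suc b * n) p q ⟩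
    suc a * (a + suc b) ! + suc b * (suc a + b) !                       ≡⟨ cong (λ n → suc a * (a + suc b) ! + suc b * n !) (sym (+-suc a b)) ⟩
    suc a * (a + suc b) ! + suc b * (a + suc b) !                       ≡⟨ sym (*-distribʳ-+ ((a + suc b) !) (suc a) (suc b)) ⟩
    (suc a + suc b) * (a + suc b) !                                     ∎
    where
    open ≡-Reasoning
    regroup : ∀ a′ b′ x y m n → (x + y) * ((a′ * m) * (b′ * n)) ≡ a′ * (x * (m * (b′ * n))) + b′ * (y * ((a′ * m) * n))
    regroup = solve-∀

length-shuffles : ∀ u v → length (shuffles u v) * (length u ! * length v !) ≡ (length u + length v) !
length-shuffles []      v       = trans (*-identityˡ _) (*-identityˡ _)
length-shuffles (i ∷ u) []      = trans (*-identityˡ _) (trans (*-identityʳ _) (cong _! (sym (+-identityʳ (suc (length u))))))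
length-shuffles (i ∷ u) (j ∷ v)
  = trans (cong (_* (suc (length u) ! * suc (length v) !))
      (trans (length-++ (map (i ∷_) (shuffles u (j ∷ v))))
        (cong₂ _+_ (length-map (i ∷_) (shuffles u (j ∷ v))) (length-map (j ∷_) (shuffles (i ∷ u) v)))))
    (factorial-step (length u) (length v) (length (shuffles u (j ∷ v))) (length (shuffles (i ∷ u) v))
      (length-shuffles u (j ∷ v)) (length-shuffles (i ∷ u) v))

enum-++ : ∀ {A : Set} {P Q : A → Set} {xs ys} → Enumerates P xs → Enumerates Q ys →
          (∀ {x} → P x → Q x → ⊥) → Enumerates (λ x → P x ⊎ Q x) (xs ++ ys)
enum-++ {P = P} {Q} {xs} {ys} e e′ disjoint = record
  { unique   = UniqueP.++⁺ (unique e) (unique e′) λ (x∈ , x∈′) → disjoint (sound e x∈) (sound e′ x∈′)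
  ; sound    = λ x∈ → classify (∈-++⁻ xs x∈)
  ; complete = λ { (inj₁ p) → ∈-++⁺ˡ (complete e p) ; (inj₂ q) → ∈-++⁺ʳ xs (complete e′ q) }
  }
  where
  classify : ∀ {x} → x ∈ xs ⊎ x ∈ ys → P x ⊎ Q x
  classify (inj₁ x∈) = inj₁ (sound e x∈)
  classify (inj₂ x∈) = inj₂ (sound e′ x∈)

Merges : ℕ → Word → Word → Word → Set
Merges k u v w = low k w ≡ u × high k w ≡ v

-- A high letter is written k + j with j at least 1, so that lowering it needs no subtraction.
data FirstLetter (k : ℕ) : Word → Word → Word → Set where
  nil    : FirstLetter k [] [] []
  low∷   : ∀ {i w u v} → i ≤ k → Merges k u v w → FirstLetter k (i ∷ u) v (i ∷ w)
  high∷  : ∀ {j w u v} → 1 ≤ j → Merges k u v w → FirstLetter k u (j ∷ v) (k + j ∷ w)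

firstLetter : ∀ {k u v} w → Merges k u v w → FirstLetter k u v w
firstLetter []      (refl , refl) = nil
firstLetter {k} (i ∷ w) (p , q) with i ≤? k
firstLetter {k} (i ∷ w) (refl , refl) | yes i≤k = low∷ i≤k (refl , refl)
firstLetter {k} (i ∷ w) (refl , refl) | no  i≰k with i ∸ k | m+[n∸m]≡n (<⇒≤ (≰⇒> i≰k)) | m<n⇒0<n∸m (≰⇒> i≰k)
... | j | refl | 1≤j = high∷ 1≤j (refl , refl)

merges-low : ∀ {k i u v} w → i ≤ k → Merges k u v w → Merges k (i ∷ u) v (i ∷ w)
merges-low {i = i} w i≤k (p , q) =
  trans (low-∷-≤ w i≤k) (cong (i ∷_) p) , trans (high-∷-≤ w i≤k) q

merges-high : ∀ k {j u v} w → 1 ≤ j → Merges k u v w → Merges k u (j ∷ v) (k + j ∷ w)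
merges-high k {j} w 1≤j (p , q) =
  trans (low-∷-> w (m<m+n k 1≤j)) p , trans (high-∷-> w (m<m+n k 1≤j)) (cong₂ _∷_ (m+n∸m≡n k j) q)

merges-nilˡ : ∀ {k v} w → Merges k [] v w → w ≡ map (k +_) v
merges-nilˡ w m with firstLetter w m
... | nil             = refl
... | high∷ {j} {w} _ m′ = cong (_ ∷_) (merges-nilˡ w m′)

merges-nilʳ : ∀ {k u} w → Merges k u [] w → w ≡ u
merges-nilʳ w m with firstLetter w m
... | nil              = refl
... | low∷ {i} {w} _ m′ = cong (i ∷_) (merges-nilʳ w m′)

-- The alphabets are disjoint: u has letters up to k, the raised v letters beyond k. So the first
-- letter tells which word it comes from, and no shuffle occurs twice.
enum-shuffles : ∀ {k u v} → All (_≤ k) u → All (1 ≤_) v →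
                Enumerates (Merges k u v) (shuffles u (map (k +_) v))
enum-shuffles {k} {[]} {v} [] vs = enum-resp (λ { refl → merges v vs }) (λ {w} → merges-nilˡ w) (enum-singleton (map (k +_) v))
  where
  merges : ∀ v → All (1 ≤_) v → Merges k [] v (map (k +_) v)
  merges []      []       = refl , refl
  merges (j ∷ v) (p ∷ ps) = merges-high k (map (k +_) v) p (merges v ps)
enum-shuffles {k} {i ∷ u} {[]} us [] = enum-resp (λ { refl → low-all us , high-none us }) (λ {w} → merges-nilʳ w) (enum-singleton (i ∷ u))
enum-shuffles {k} {i ∷ u} {j ∷ v} (p ∷ us) (q ∷ vs) = enum-resp
  (λ { (inj₁ (w , m , refl)) → merges-low w p m ; (inj₂ (w , m , refl)) → merges-high k w q m })
  (λ {w} m → classify w (firstLetter w m))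
  (enum-++ (enum-map (enum-shuffles us (q ∷ vs)) λ { _ _ refl → refl })
           (enum-map (enum-shuffles (p ∷ us) vs) λ { _ _ refl → refl })
           λ (_ , _ , eq) (_ , _ , eq′) →
             <⇒≢ (≤-<-trans p (m<m+n k q)) (∷-injectiveˡ (trans (sym eq) eq′)))
  where
  classify : ∀ w → FirstLetter k (i ∷ u) (j ∷ v) w →
             (∃[ w′ ] Merges k u (j ∷ v) w′ × w ≡ i ∷ w′) ⊎ (∃[ w′ ] Merges k (i ∷ u) v w′ × w ≡ k + j ∷ w′)
  classify _ (low∷ _ m)  = inj₁ (_ , m , refl)
  classify _ (high∷ _ m) = inj₂ (_ , m , refl)

Letters-merge : ∀ k {l} w → Letters (suc k) (low k w) → Letters (suc l) (high k w) → Letters (suc (k + l)) w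
Letters-merge k []      _  _  = []
Letters-merge k {l} (i ∷ w) ll lh with i ≤? k
Letters-merge k {l} (i ∷ w) ((1≤i , s≤s i≤k) ∷ ll) lh | yes _ = (1≤i , s≤s (≤-trans i≤k (m≤m+n k l))) ∷ Letters-merge k w ll lh
Letters-merge k {l} (i ∷ w) ll ((1≤j , s≤s j≤l) ∷ lh) | no i≰k =
  (≤-trans (s≤s z≤n) (≰⇒> i≰k) , s≤s (subst (_≤ k + l) (m+[n∸m]≡n (<⇒≤ (≰⇒> i≰k))) (+-monoʳ-≤ k j≤l))) ∷ Letters-merge k w ll lh

productWords : Perm → Perm → List Word
productWords σ τ = concatMap reducedWords (product σ τ)

-- A reduced word of a term of [σ][τ] is a shuffle of its own two parts. Conversely a shuffle is
-- reduced by `Good⇒Reduced` and, the rank being fixed, spells exactly one term.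
productWords-shuffles : ∀ σ τ → productWords σ τ ↭
  concatMap (λ u → concatMap (λ v → shuffles u (map (rank σ +_) v)) (reducedWords τ)) (reducedWords σ)
productWords-shuffles σ τ = enum-↭
  (λ {w} (π , s , rw) → let rl , rh = Split-any {σ} {τ} {π} s rw in
     low (rank σ) w , rl , high (rank σ) w , rh , refl , refl)
  (λ {w} (u , ru , v , rv , eq , eq′) → construct w (subst (RedWord σ) (sym eq) ru) (subst (RedWord τ) (sym eq′) rv))
  (enum-concatMap (enum-product σ τ) (λ {π} _ → enum-reducedWords π)
    λ {π} {π′} (r , _) (r′ , _) → RedWord-rank-unique {π} {π′} (trans r (sym r′)))
  (enum-concatMap (enum-reducedWords σ) (λ {u} ru →
    enum-concatMap (enum-reducedWords τ) (λ {v} rv → enum-shuffles (RedWord-≤rank {σ} ru) (RedWord-1≤ {τ} rv))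
      λ _ _ (_ , p) (_ , q) → trans (sym p) q)
    λ _ _ (_ , _ , p , _) (_ , _ , q , _) → trans (sym p) q)
  where
  construct : ∀ w → RedWord σ (low (rank σ) w) → RedWord τ (high (rank σ) w) → ∃[ π ] Split σ τ π × RedWord π w
  construct w rl rh = permOf l , Split-construct {σ} {τ} l rl rh ,
    permOf-RedWord l (Good⇒Reduced w (proj₁ (proj₂ rl) , proj₁ (proj₂ rh)))
    where
    l : Letters (suc (rank σ + rank τ)) w
    l = Letters-merge (rank σ) w (RedWord-Letters {σ} rl) (RedWord-Letters {τ} rh)

length-concatMap : ∀ {A B : Set} {f : A → List B} {c d} xs → (∀ {x} → x ∈ xs → length (f x) * c ≡ d) →
                   length (concatMap f xs) * c ≡ length xs * d
length-concatMap []       _ = refl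
length-concatMap {f = f} {c} (x ∷ xs) eq = trans (cong (_* c) (length-++ (f x)))
  (trans (*-distribʳ-+ c (length (f x)) _) (cong₂ _+_ (eq (here refl)) (length-concatMap xs (eq ∘ there))))

-- All reduced words of σ have length `ℓ σ`, those of τ length `ℓ τ`, so every pair has the same
-- number of shuffles.
length-productWords : ∀ σ τ → length (productWords σ τ) * (ℓ σ ! * ℓ τ !) ≡ r σ * (r τ * (ℓ σ + ℓ τ) !)
length-productWords σ τ = trans (cong (_* (ℓ σ ! * ℓ τ !)) (↭-length (productWords-shuffles σ τ)))
  (length-concatMap (reducedWords σ) λ {u} u∈ → length-concatMap (reducedWords τ) λ {v} v∈ →
    subst₂ (λ a b → length (shuffles u (map (rank σ +_) v)) * (a ! * b !) ≡ (a + b) !)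
      (sym (RedWord-length {σ} (sound (enum-reducedWords σ) u∈)))
      (trans (length-map (rank σ +_) v) (sym (RedWord-length {τ} (sound (enum-reducedWords τ) v∈))))
      (length-shuffles u (map (rank σ +_) v)))

-- Properties (a), (b) and (c)

module Properties {c ℓ′} (F : Field c ℓ′) where
  private module K = Field F
  open Construction F

  basisW-revW : ∀ k → basisW F (revW (suc k)) ≡ ι (reversal k ∷ [])
  basisW-revW k = cong (maybe ([_] F) []) (toPerm-revW k)

  mul-reversals : ∀ k l → _≋_ F (mulL F mulΠ (ι (reversal k ∷ [])) (ι (reversal l ∷ []))) (sumB F (suc k) (suc (k + l)))
  mul-reversals k l π = coefficient-↭ (isPerm₁ π) (mulL-ι (reversal k ∷ []) (reversal l ∷ []))
    (≅-refl {xs = sumB F (suc k) (suc (k + l))})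
    (↭-trans (↭-reflexive (trans (++-identityʳ _) (++-identityʳ _))) (product-reversals k l))

  propertyA : PropertyA F B
  -- With m = k+1 and n = m + l, the second factor is the reversal of l+1 = n-m+1 letters.
  propertyA (suc k) n _ m≤n = subst
    (λ n → _≋_ F (mulL F mulΠ (basisW F (revW (suc k))) (basisW F (revW (n ∸ suc k + 1)))) (sumB F (suc k) n))
    (m+[n∸m]≡n m≤n)
    (subst₂ (λ x y → _≋_ F (mulL F mulΠ x y) (sumB F (suc k) (suc (k + l))))
      (sym (basisW-revW k))
      (sym (trans (cong (basisW F ∘ revW) (trans (+-comm (k + l ∸ k) 1) (cong suc (m+n∸m≡n k l)))) (basisW-revW l)))
      (mul-reversals k l))
    where
    l : ℕ
    l = n ∸ suc k

  propertyB : PropertyB F B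
  propertyB π ρ κ = K.refl

  fromℕ-+ : ∀ m n → fromℕ F (m + n) K.≈ fromℕ F m K.+ fromℕ F n
  fromℕ-+ zero    n = K.sym (K.+-identityˡ _)
  fromℕ-+ (suc m) n = K.trans (K.+-cong K.refl (fromℕ-+ m n)) (K.sym (K.+-assoc _ _ _))

  fromℕ-* : ∀ m n → fromℕ F (m * n) K.≈ fromℕ F m K.* fromℕ F n
  fromℕ-* zero    n = K.sym (K.zeroˡ _)
  fromℕ-* (suc m) n = K.trans (fromℕ-+ n (m * n))
    (K.trans (K.+-cong (K.sym (K.*-identityˡ _)) (fromℕ-* m n)) (K.sym (K.distribʳ _ _ _)))

  module _ (ch : CharZero F) where
    1/_! : ℕ → K.Carrier
    1/ l ! = proj₁ (K.inverse (fromℕ F (l !)) (ch (l !) {{l !≢0}}))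

    1/!-inverse : ∀ l → fromℕ F (l !) K.* 1/ l ! K.≈ K.1#
    1/!-inverse l = proj₂ (K.inverse (fromℕ F (l !)) (ch (l !) {{l !≢0}}))

    -- Terms of one length l share the denominator l!, so their numerators add up to a number of
    -- words.
    linK-φ : ∀ {l} xs → (∀ {π} → π ∈ xs → ℓ π ≡ l) →
             linK F (φ F ch) (ι xs) K.≈ fromℕ F (length (concatMap reducedWords xs)) K.* 1/ l !
    linK-φ []           _  = K.sym (K.zeroˡ _)
    linK-φ {l} (π ∷ xs) eq = K.trans (K.+-cong
        (K.trans (K.*-identityˡ _) (K.reflexive (cong (λ l → fromℕ F (r π) K.* 1/ l !) (eq (here refl)))))
        (linK-φ xs (eq ∘ there)))
      (K.trans (K.sym (K.distribʳ _ _ _)) (K.*-cong (K.trans (K.sym (fromℕ-+ (r π) _))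
        (K.reflexive (cong (fromℕ F) (sym (length-++ (reducedWords π)))))) K.refl))

    φ-mul : ∀ σ τ → linK F (φ F ch) (mulΠ σ τ) K.≈ φ F ch σ K.* φ F ch τ
    φ-mul σ τ = begin
      linK F (φ F ch) (mulΠ σ τ)
        ≈⟨ linK-φ (product σ τ) (λ {π} π∈ → Split-length {σ} {τ} {π} (sound (enum-product σ τ) π∈)) ⟩
      N K.* C⁻¹
        -- Each factorial is inserted with its inverse, so that the product counted in ℕ appears.
        ≈⟨ K.sym (K.trans (K.*-cong K.refl (K.*-cong (1/!-inverse (ℓ σ)) (1/!-inverse (ℓ τ))))
             (K.trans (K.*-cong K.refl (K.*-identityˡ _)) (K.*-identityʳ _))) ⟩
      (N K.* C⁻¹) K.* ((A K.* A⁻¹) K.* (B! K.* B⁻¹))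
        ≈⟨ solve 6 (λ n c a a′ b b′ → (n ⊕ c) ⊕ ((a ⊕ a′) ⊕ (b ⊕ b′)) ⊜ (n ⊕ (a ⊕ b)) ⊕ (c ⊕ (a′ ⊕ b′))) K.refl
             N C⁻¹ A A⁻¹ B! B⁻¹ ⟩
      (N K.* (A K.* B!)) K.* (C⁻¹ K.* (A⁻¹ K.* B⁻¹))
        ≈⟨ K.*-cong counted K.refl ⟩
      (R K.* (S K.* C)) K.* (C⁻¹ K.* (A⁻¹ K.* B⁻¹))
        ≈⟨ solve 6 (λ p s c c′ a′ b′ → (p ⊕ (s ⊕ c)) ⊕ (c′ ⊕ (a′ ⊕ b′)) ⊜ (c ⊕ c′) ⊕ ((p ⊕ a′) ⊕ (s ⊕ b′))) K.refl
             R S C C⁻¹ A⁻¹ B⁻¹ ⟩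
      (C K.* C⁻¹) K.* ((R K.* A⁻¹) K.* (S K.* B⁻¹))
        ≈⟨ K.trans (K.*-cong (1/!-inverse (ℓ σ + ℓ τ)) K.refl) (K.*-identityˡ _) ⟩
      (R K.* A⁻¹) K.* (S K.* B⁻¹) ∎
      where
      open import Relation.Binary.Reasoning.Setoid K.setoid
      open import Algebra.Solver.CommutativeMonoid K.*-commutativeMonoid using (solve; _⊕_; _⊜_)

      N R S A B! C A⁻¹ B⁻¹ C⁻¹ : K.Carrier
      N   = fromℕ F (length (productWords σ τ))
      R   = fromℕ F (r σ)
      S   = fromℕ F (r τ)
      A   = fromℕ F (ℓ σ !)
      B!  = fromℕ F (ℓ τ !)
      C   = fromℕ F ((ℓ σ + ℓ τ) !)
      A⁻¹ = 1/ ℓ σ !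
      B⁻¹ = 1/ ℓ τ !
      C⁻¹ = 1/ (ℓ σ + ℓ τ) !

      counted : N K.* (A K.* B!) K.≈ R K.* (S K.* C)
      counted = K.trans (K.sym (K.trans (fromℕ-* (length (productWords σ τ)) _) (K.*-cong K.refl (fromℕ-* (ℓ σ !) (ℓ τ !)))))
        (K.trans (K.reflexive (cong (fromℕ F) (length-productWords σ τ)))
          (K.trans (fromℕ-* (r σ) _) (K.*-cong K.refl (fromℕ-* (r τ) ((ℓ σ + ℓ τ) !)))))

    φ-unit : linK F (φ F ch) unitΠ K.≈ K.1#
    φ-unit = K.trans (K.+-identityʳ _) (K.trans (K.*-identityˡ _) (1/!-inverse 0))

  propertyC : PropertyC F B
  propertyC ch = φ-mul ch , φ-unit ch

theorem1p4 : ∀ {c ℓ′} (F : Field c ℓ′) →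
    Σ (GradedBialgebraΠ F) (λ B → PropertyA F B × PropertyB F B × PropertyC F B)
theorem1p4 F = Construction.B F , propertyA , propertyB , propertyC
  where open Properties F
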